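{- If $t\ge 2$, $n\ge 20t^2-t$ and $\pi=(d_1,\ldots,d_n)$ is a graphic sequence with $\sigma(\pi)>4tn-2n-4t^2+2t$, then $\pi$ has a realization containing every 2-tree on $3t$ vertices as a subgraph.
   Context: A simple graph $G$ is a 2-tree if $G=K_3$, or $G$ has a vertex $v$ of degree 2 whose two neighbors are adjacent and $G-v$ is a 2-tree. A non-increasing sequence $\pi=(d_1,\ldots,d_n)$ of nonnegative integers is graphic if it is the degree sequence of some simple graph on $n$ vertices, called a realization of $\pi$. We write $\sigma(\pi)=d_1+\cdots+d_n$. -}

module Defs where

open import Data.Nat using (ℕ; zero; suc; _+_; _*_; _≤_; _<_; _≥_)
open import Data.Bool using (Bool; true; false)
open import Data.Fin using (Fin; punchIn)
open import Data.List using (List; map; filter; length)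
open import Data.Nat.ListAction using (sum)
open import Data.Vec.Functional using (Vector)
open import Data.Product using (Σ; _×_; ∃; _,_)
open import Function.Definitions using (Injective)
open import Relation.Binary.PropositionalEquality using (_≡_; _≢_)
open import Data.List using (allFin)
open import Data.Bool using (T)
open import Data.Bool.Properties using (T?)

record Graph (n : ℕ) : Set where
  field
    adj   : Fin n → Fin n → Bool
    sym   : ∀ i j → adj i j ≡ adj j i
    irrefl : ∀ i → adj i i ≡ false
open Graph public

_~[_]_ : ∀ {n} → Fin n → Graph n → Fin n → Set
i ~[ G ] j = T (adj G i j)

degree : ∀ {n} → Graph n → Fin n → ℕ
degree {n} G i = length (filter (λ j → T? (adj G i j)) (allFin n))

delete : ∀ {m} → Graph (suc m) → Fin (suc m) → Graph m
delete G v = record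
  { adj    = λ i j → adj G (punchIn v i) (punchIn v j)
  ; sym    = λ i j → sym G (punchIn v i) (punchIn v j)
  ; irrefl = λ i → irrefl G (punchIn v i)
  }

IsK3 : Graph 3 → Set
IsK3 G = ∀ i j → i ≢ j → i ~[ G ] j

data IsTwoTree : ∀ {n} → Graph n → Set where
  base : (G : Graph 3) → IsK3 G → IsTwoTree G
  step : ∀ {m} (G : Graph (suc m)) (v : Fin (suc m)) →
         degree G v ≡ 2 →
         (∀ a b → v ~[ G ] a → v ~[ G ] b → a ≢ b → a ~[ G ] b) →
         IsTwoTree (delete G v) →
         IsTwoTree G

_⊆ᵍ_ : ∀ {m n} → Graph m → Graph n → Set
_⊆ᵍ_ {m} {n} H G = Σ (Fin m → Fin n) λ f →
  Injective _≡_ _≡_ f × (∀ i j → i ~[ H ] j → f i ~[ G ] f j)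

NonIncreasing : ∀ {n} → Vector ℕ n → Set
NonIncreasing {n} d = ∀ (i j : Fin n) → Data.Fin._≤_ i j → d j ≤ d i

Realizes : ∀ {n} → Graph n → Vector ℕ n → Set
Realizes {n} G d = ∀ (i : Fin n) → degree G i ≡ d i

Graphic : ∀ {n} → Vector ℕ n → Set
Graphic {n} d = NonIncreasing d × Σ (Graph n) λ G → Realizes G d

σ : ∀ {n} → Vector ℕ n → ℕ
σ {n} d = sum (map d (allFin n))

{-# OPTIONS --safe #-}
-- A 2-tree H on 3t vertices is 2-degenerate. Taking a vertex with at most two remaining neighbours and
-- discarding these neighbours, s times, gives an independent set of size s with at most 2s neighbours,
-- for every s ≤ t. Hence H is contained in K_c ∨ (K_q ∪ s K_1) as soon as c ≥ 2s and c + q + s ≥ 3t, and a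
-- realization containing one such graph will do.
--
-- Such a graph F is planted on the 3t vertices of largest degree by exchanges that never remove an edge
-- of F. If uv ∈ F is missing, then u and v have neighbours z and w along edges outside F, and
-- uz, vw, ab can be replaced by uv, za, wb unless every edge ab outside F has a ∈ N[z] or b ∈ N[w].
-- The threshold is the degree sum of K_(2t-1) ∨ (n-2t+1) K_1, so many edges avoid the c vertices of
-- largest degree, more than two neighbourhoods of bounded degree can cover.
--
-- If 3t vertices have degree at least 6t - 2, then K_3t can be planted. If only i < 2t - 1 vertices have
-- degree at least 3t - 1, take c = i and q = 2(2t - 1 - i) + 1. Otherwise take c = 2t - 1 and q = 2; now
-- some of the c vertices may have moderate degree. Such a vertex either is unaffected by a suitable
-- exchange or misses many vertices, and every missing pair forces a further edge among the others.
module Submission where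

open import Defs
open import Data.Nat hiding (_≟_)
open import Data.Nat.Properties hiding (_≟_)
open import Data.Bool using (Bool; true; false; _∧_; _∨_; not; T)
open import Data.Bool.Properties using (T?; ∧-comm; ∨-comm)
open import Data.Fin using (Fin; zero; suc; toℕ; punchIn; punchOut; fromℕ<)
open import Data.Fin.Properties as Fin using (_≟_; toℕ-fromℕ<)
open import Data.List using (List; []; _∷_; filter; length; tabulate)
open import Data.List.Properties using (map-tabulate)
import Data.Nat.ListAction as ListAction
open import Data.Nat.Induction using (<-wellFounded)
open import Induction.WellFounded using (Acc; acc)
open import Data.List.Relation.Unary.All using (All; []; _∷_)
open import Data.List.Relation.Unary.AllPairs using (AllPairs; []; _∷_)
open import Data.Vec.Functional using (Vector)
open import Data.Product using (Σ; ∃; _×_; _,_; proj₁; proj₂)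
open import Data.Sum using (_⊎_; inj₁; inj₂)
open import Data.Empty using (⊥; ⊥-elim)
open import Relation.Nullary using (yes; no; does)
open import Relation.Binary.PropositionalEquality
  using (_≡_; _≢_; _≗_; refl; trans; cong; cong₂; subst)
  renaming (sym to ≡-sym)
open import Function using (_∘_; id)
open import Algebra.Properties.CommutativeMonoid.Sum +-0-commutativeMonoid
  using (∑-distrib-+; ∑-comm; sum-cong-≗; sum-remove) renaming (sum to ∑)
open import Data.Nat.Tactic.RingSolver using (solve-∀)

-- Booleans and their indicators

-- Call the first 2t - 1 vertices rows. The obstacle is a short row, one with only O(t) neighbours
-- outside the first 3t vertices: all of them may lie in the closed neighbourhood that an exchange
-- has to avoid. Such a row bounds every degree outside the rows, so that with t = s + 1 two
-- neighbourhoods cover at most about 2(36 + 3)s² = 78s² ordered pairs of adjacent vertices outside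
-- the rows. It also misses almost all of the n vertices, and each missing pair forces two further
-- ordered pairs; but one short row forces only about 2·20s² = 40s² of them. Two short rows force
-- 80s² > 78s². Hence the failing exchanges are arranged so that each failure exhibits a second
-- short row, and this comparison is where the constant 20 is nearly exhausted. The exact form of
-- the threshold matters in `inner-large` and in `two-large`, which have no slack at all; elsewhere
-- only its leading term counts.

χ : Bool → ℕ
χ true  = 1
χ false = 0

χ≤1 : ∀ b → χ b ≤ 1
χ≤1 true  = ≤-refl
χ≤1 false = z≤n

true⊎false : ∀ b → b ≡ true ⊎ b ≡ false
true⊎false true  = inj₁ refl
true⊎false false = inj₂ refl

true≢false : ∀ {b} → b ≡ true → b ≡ false → ⊥
true≢false refl ()

not-true : ∀ {b} → b ≢ true → b ≡ false
not-true {true}  h = ⊥-elim (h refl)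
not-true {false} h = refl

not-false : ∀ {b} → b ≢ false → b ≡ true
not-false {true}  h = refl
not-false {false} h = ⊥-elim (h refl)

∧-intro : ∀ {a b} → a ≡ true → b ≡ true → a ∧ b ≡ true
∧-intro refl refl = refl

∧-elim : ∀ {a b} → a ∧ b ≡ true → a ≡ true × b ≡ true
∧-elim {true} h = refl , h

∧-falseˡ : ∀ {a} b → a ≡ false → a ∧ b ≡ false
∧-falseˡ b refl = refl

∧-falseʳ : ∀ a {b} → b ≡ false → a ∧ b ≡ false
∧-falseʳ true  refl = refl
∧-falseʳ false _    = refl

∨-introˡ : ∀ {a b} → a ≡ true → a ∨ b ≡ true
∨-introˡ refl = refl

∨-introʳ : ∀ {a b} → b ≡ true → a ∨ b ≡ true
∨-introʳ {true}  refl = refl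
∨-introʳ {false} refl = refl

∨-elim : ∀ {a b} → a ∨ b ≡ true → a ≡ true ⊎ b ≡ true
∨-elim {true}  h = inj₁ refl
∨-elim {false} h = inj₂ h

∨-false : ∀ {a b} → a ∨ b ≡ false → a ≡ false × b ≡ false
∨-false {false} h = refl , h

not-intro : ∀ {a} → a ≡ false → not a ≡ true
not-intro refl = refl

not-elim : ∀ {a} → not a ≡ true → a ≡ false
not-elim {false} h = refl

χ-mono : ∀ {a b} → (a ≡ true → b ≡ true) → χ a ≤ χ b
χ-mono {true}  h rewrite h refl = ≤-refl
χ-mono {false} h = z≤n

T⇒true : ∀ {b} → T b → b ≡ true
T⇒true {true} _ = refl

true⇒T : ∀ {b} → b ≡ true → T b
true⇒T refl = _

-- Sums over Fin

∑-mono : ∀ {n} {f g : Fin n → ℕ} → (∀ i → f i ≤ g i) → ∑ f ≤ ∑ g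
∑-mono {zero}  h = z≤n
∑-mono {suc n} h = +-mono-≤ (h zero) (∑-mono (h ∘ suc))

∑-mono-< : ∀ {n} {f g : Fin n → ℕ} → (∀ i → f i ≤ g i) → ∀ k → f k < g k → ∑ f < ∑ g
∑-mono-< h zero    lt = +-mono-<-≤ lt (∑-mono (h ∘ suc))
∑-mono-< h (suc k) lt = +-mono-≤-< (h zero) (∑-mono-< (h ∘ suc) k lt)

∑-const : ∀ n c → ∑ {n} (λ _ → c) ≡ n * c
∑-const zero    c = refl
∑-const (suc n) c = cong (c +_) (∑-const n c)

∑-*ʳ : ∀ {n} (f : Fin n → ℕ) c → ∑ (λ i → f i * c) ≡ ∑ f * c
∑-*ʳ {zero}  f c = refl
∑-*ʳ {suc n} f c = trans (cong (f zero * c +_) (∑-*ʳ (f ∘ suc) c)) (≡-sym (*-distribʳ-+ c (f zero) (∑ (f ∘ suc))))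

∑-term : ∀ {n} (f : Fin n → ℕ) k → f k ≤ ∑ f
∑-term f zero    = m≤m+n _ _
∑-term f (suc k) = ≤-trans (∑-term (f ∘ suc) k) (m≤n+m _ _)

-- Cardinalities of sets given by Boolean predicates.

# : ∀ {n} → (Fin n → Bool) → ℕ
# p = ∑ (χ ∘ p)

#-mono : ∀ {n} {p q : Fin n → Bool} → (∀ i → p i ≡ true → q i ≡ true) → # p ≤ # q
#-mono h = ∑-mono (λ i → χ-mono (h i))

#-mono-< : ∀ {n} {p q : Fin n → Bool} → (∀ i → p i ≡ true → q i ≡ true) →
           ∀ k → p k ≡ false → q k ≡ true → # p < # q
#-mono-< {p = p} {q} h k pk qk = ∑-mono-< (λ i → χ-mono (h i)) k lt
  where
  lt : χ (p k) < χ (q k)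
  lt rewrite pk | qk = ≤-refl

#-cong : ∀ {n} {p q : Fin n → Bool} → p ≗ q → # p ≡ # q
#-cong h = sum-cong-≗ (λ i → cong χ (h i))

#≤n : ∀ {n} (p : Fin n → Bool) → # p ≤ n
#≤n {n} p = ≤-trans (∑-mono (λ i → χ≤1 (p i))) (≤-reflexive (trans (∑-const n 1) (*-identityʳ n)))

#-true : ∀ n → # {n} (λ _ → true) ≡ n
#-true n = trans (∑-const n 1) (*-identityʳ n)

#-∪ : ∀ {n} {p q r : Fin n → Bool} → (∀ i → p i ≡ true → q i ∨ r i ≡ true) → # p ≤ # q + # r
#-∪ {p = p} {q} {r} h = ≤-trans (∑-mono pointwise) (≤-reflexive (∑-distrib-+ (χ ∘ q) (χ ∘ r)))
  where
  ∨≤+ : ∀ a b → χ (a ∨ b) ≤ χ a + χ b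
  ∨≤+ true  b = s≤s z≤n
  ∨≤+ false b = ≤-refl
  pointwise : ∀ i → χ (p i) ≤ χ (q i) + χ (r i)
  pointwise i = ≤-trans (χ-mono (h i)) (∨≤+ (q i) (r i))

#-split : ∀ {n} (p q : Fin n → Bool) → # p ≡ # (λ i → p i ∧ q i) + # (λ i → p i ∧ not (q i))
#-split p q = trans (sum-cong-≗ λ i → pointwise (p i) (q i))
                    (∑-distrib-+ (λ i → χ (p i ∧ q i)) (λ i → χ (p i ∧ not (q i))))
  where
  pointwise : ∀ a b → χ a ≡ χ (a ∧ b) + χ (a ∧ not b)
  pointwise true  true  = refl
  pointwise true  false = refl
  pointwise false b     = refl

#-disjoint : ∀ {n} {p q r : Fin n → Bool} →
             (∀ i → p i ≡ true → r i ≡ true) → (∀ i → q i ≡ true → r i ≡ true) →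
             (∀ i → p i ≡ true → q i ≡ false) → # p + # q ≤ # r
#-disjoint {p = p} {q} {r} hp hq hd =
  ≤-trans (≤-reflexive (≡-sym (∑-distrib-+ (χ ∘ p) (χ ∘ q)))) (∑-mono λ i → pointwise (hp i) (hq i) (hd i))
  where
  pointwise : ∀ {a b c} → (a ≡ true → c ≡ true) → (b ≡ true → c ≡ true) → (a ≡ true → b ≡ false) → χ a + χ b ≤ χ c
  pointwise {true}  {b}     {c} h₁ h₂ h₃ rewrite h₁ refl | h₃ refl = ≤-refl
  pointwise {false} {true}  {c} h₁ h₂ h₃ rewrite h₂ refl = ≤-refl
  pointwise {false} {false} {c} h₁ h₂ h₃ = z≤n

#-complement : ∀ {n} (p : Fin n → Bool) → # p + # (not ∘ p) ≡ n
#-complement {n} p = trans (≡-sym (#-split (λ _ → true) p)) (#-true n)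

search : ∀ {n} (p : Fin n → Bool) → (∃ λ i → p i ≡ true) ⊎ (∀ i → p i ≡ false)
search {zero}  p = inj₂ λ ()
search {suc n} p with true⊎false (p zero) | search (p ∘ suc)
... | inj₁ h | _ = inj₁ (zero , h)
... | inj₂ h | inj₁ (i , k) = inj₁ (suc i , k)
... | inj₂ h | inj₂ k = inj₂ λ { zero → h ; (suc i) → k i }

-- Boolean, so that the absence of a witness can itself be part of a predicate that is searched or
-- counted.
empty : ∀ {n} → (Fin n → Bool) → Bool
empty p with search p
... | inj₁ _ = false
... | inj₂ _ = true

empty-true : ∀ {n} (p : Fin n → Bool) → empty p ≡ true → ∀ i → p i ≡ false
empty-true p h with search p
... | inj₂ none = none

empty-false : ∀ {n} (p : Fin n → Bool) → empty p ≡ false → ∃ λ i → p i ≡ true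
empty-false p h with search p
... | inj₁ w = w

search₂ : ∀ {m n} (p : Fin m → Fin n → Bool) →
          (∃ λ i → ∃ λ j → p i j ≡ true) ⊎ (∀ i j → p i j ≡ false)
search₂ p with search (λ i → not (empty (p i)))
... | inj₁ (i , h) = inj₁ (i , empty-false (p i) (not-elim h))
... | inj₂ h = inj₂ λ i → empty-true (p i) (not-false λ e → true≢false (not-intro e) (h i))

#-zero : ∀ {n} {p : Fin n → Bool} → (∀ i → p i ≡ false) → # p ≡ 0
#-zero {n} h = trans (sum-cong-≗ λ i → cong χ (h i)) (trans (∑-const n 0) (*-zeroʳ n))

#-witness : ∀ {n} (p : Fin n → Bool) → 0 < # p → ∃ λ i → p i ≡ true
#-witness p h with search p
... | inj₁ w = w
... | inj₂ k = ⊥-elim (<-irrefl (≡-sym (#-zero k)) h)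

-- Equality tests and initial segments.

infix 4 _==_

abstract
  _==_ : ∀ {n} → Fin n → Fin n → Bool
  i == j = does (i ≟ j)

  ==-refl : ∀ {n} (i : Fin n) → (i == i) ≡ true
  ==-refl i with i ≟ i
  ... | yes _ = refl
  ... | no h  = ⊥-elim (h refl)

  ==⇒≡ : ∀ {n} {i j : Fin n} → (i == j) ≡ true → i ≡ j
  ==⇒≡ {i = i} {j} h with i ≟ j
  ... | yes e = e

  ≢⇒== : ∀ {n} {i j : Fin n} → i ≢ j → (i == j) ≡ false
  ≢⇒== {i = i} {j} h with i ≟ j
  ... | yes e = ⊥-elim (h e)
  ... | no _  = refl

==⇒≢ : ∀ {n} {i j : Fin n} → (i == j) ≡ false → i ≢ j
==⇒≢ {i = i} h refl = true≢false (==-refl i) h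

==-dec : ∀ {n} (i j : Fin n) → i ≡ j ⊎ i ≢ j
==-dec i j with true⊎false (i == j)
... | inj₁ h = inj₁ (==⇒≡ h)
... | inj₂ h = inj₂ (==⇒≢ h)

#-single : ∀ {n} (a : Fin n) → # (λ j → j == a) ≡ 1
#-single {suc n} zero    = cong₂ _+_ (cong χ (==-refl {suc n} zero)) (#-zero {n} {λ i → suc i == zero} λ i → ≢⇒== λ ())
#-single {suc n} (suc a) = cong₂ _+_ (cong χ (≢⇒== {i = zero} {suc a} λ ())) (trans (sum-cong-≗ λ i → cong χ (shift i)) (#-single a))
  where
  shift : ∀ i → (suc i == suc a) ≡ (i == a)
  shift i with ==-dec i a
  ... | inj₁ refl = trans (==-refl (suc i)) (≡-sym (==-refl i))
  ... | inj₂ h = trans (≢⇒== λ { refl → h refl }) (≡-sym (≢⇒== h))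

#-insert : ∀ {n} {p : Fin n → Bool} (a : Fin n) → p a ≡ false → # (λ i → p i ∨ (i == a)) ≡ suc (# p)
#-insert {p = p} a h = trans (sum-cong-≗ λ i → pointwise i)
    (trans (∑-distrib-+ (χ ∘ p) (λ i → χ (i == a))) (trans (cong (# p +_) (#-single a)) (+-comm _ 1)))
  where
  pointwise : ∀ i → χ (p i ∨ (i == a)) ≡ χ (p i) + χ (i == a)
  pointwise i with true⊎false (i == a)
  ... | inj₁ e rewrite ==⇒≡ {i = i} {a} e | h = refl
  ... | inj₂ e with p i
  ... | true  rewrite e = refl
  ... | false = refl

#-remove : ∀ {n} (p : Fin n → Bool) (a : Fin n) → p a ≡ true → suc (# (λ i → p i ∧ not (i == a))) ≡ # p
#-remove p a h = trans (≡-sym (#-insert {p = λ i → p i ∧ not (i == a)} a gone)) (#-cong back)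
  where
  gone : p a ∧ not (a == a) ≡ false
  gone rewrite ==-refl a | h = refl
  back : ∀ i → (p i ∧ not (i == a)) ∨ (i == a) ≡ p i
  back i with true⊎false (i == a)
  ... | inj₁ e rewrite ==⇒≡ {i = i} {a} e | ==-refl a | h = refl
  ... | inj₂ e rewrite e with p i
  ... | true  = refl
  ... | false = refl

abstract
  below : ∀ {n} → ℕ → Fin n → Bool
  below k i = toℕ i <ᵇ k

  below-true : ∀ {n k} {i : Fin n} → toℕ i < k → below k i ≡ true
  below-true h = T⇒true (<⇒<ᵇ h)

  below-< : ∀ {n k} {i : Fin n} → below k i ≡ true → toℕ i < k
  below-< {k = k} {i} h = <ᵇ⇒< (toℕ i) k (true⇒T h)

  below-false : ∀ {n k} {i : Fin n} → k ≤ toℕ i → below k i ≡ false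
  below-false h = not-true λ e → <⇒≱ (below-< e) h

  below-≥ : ∀ {n k} {i : Fin n} → below k i ≡ false → k ≤ toℕ i
  below-≥ h = ≮⇒≥ λ lt → true≢false (below-true lt) h

  #-below : ∀ {n k} → k ≤ n → # {n} (below k) ≡ k
  #-below {n} {zero} _ = #-zero λ i → below-false {n} {0} {i} z≤n
  #-below {suc n} {suc k} (s≤s h) = cong suc (#-below {n} {k} h)

dg : ∀ {n} → Graph n → Fin n → ℕ
dg G i = # (adj G i)

degree≡dg : ∀ {n} (G : Graph n) i → degree G i ≡ dg G i
degree≡dg {n} G i = count id
  where
  count : ∀ {m} (f : Fin m → Fin n) →
          length (filter (λ j → T? (adj G i j)) (tabulate f)) ≡ ∑ (λ k → χ (adj G i (f k)))
  count {zero}  f = refl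
  count {suc m} f with adj G i (f zero)
  ... | true  = cong suc (count (f ∘ suc))
  ... | false = count (f ∘ suc)

σ≡∑ : ∀ {n} (d : Vector ℕ n) → σ d ≡ ∑ d
σ≡∑ {n} d = trans (cong ListAction.sum (map-tabulate id d)) (go d)
  where
  go : ∀ {m} (f : Fin m → ℕ) → ListAction.sum (tabulate f) ≡ ∑ f
  go {zero}  f = refl
  go {suc m} f = cong (f zero +_) (go (f ∘ suc))

-- Edge exchanges preserving all degrees

Pair : ℕ → Set
Pair n = Fin n × Fin n

-- Degree changes are sums of indicators of single vertices. That an exchange preserves all degrees
-- is then a mere rearrangement of summands, valid also when some of its vertices coincide.
ends : ∀ {n} → Pair n → Fin n → ℕ
ends (a , b) i = χ (i == a) + χ (i == b)

abstract
  same : ∀ {n} → Pair n → Fin n → Fin n → Bool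
  same (a , b) i j = ((i == a) ∧ (j == b)) ∨ ((i == b) ∧ (j == a))

  same-sym : ∀ {n} (e : Pair n) i j → same e i j ≡ same e j i
  same-sym (a , b) i j = trans (∨-comm ((i == a) ∧ (j == b)) _)
    (cong₂ _∨_ (∧-comm (i == b) (j == a)) (∧-comm (i == a) (j == b)))

  same-cases : ∀ {n} (a b i j : Fin n) → same (a , b) i j ≡ true → (i ≡ a × j ≡ b) ⊎ (i ≡ b × j ≡ a)
  same-cases a b i j h with ∨-elim {(i == a) ∧ (j == b)} h
  ... | inj₁ k = inj₁ (==⇒≡ (proj₁ (∧-elim {i == a} k)) , ==⇒≡ (proj₂ (∧-elim {i == a} k)))
  ... | inj₂ k = inj₂ (==⇒≡ (proj₁ (∧-elim {i == b} k)) , ==⇒≡ (proj₂ (∧-elim {i == b} k)))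

  same-self : ∀ {n} (a b : Fin n) → same (a , b) a b ≡ true
  same-self a b rewrite ==-refl a | ==-refl b = refl

  #-same : ∀ {n} {a b : Fin n} → a ≢ b → ∀ i → # (same (a , b) i) ≡ ends (a , b) i
  #-same {n} {a} {b} a≢b i with true⊎false (i == a) | true⊎false (i == b)
  ... | inj₁ p | inj₁ q = ⊥-elim (a≢b (trans (≡-sym (==⇒≡ {i = i} {a} p)) (==⇒≡ {i = i} {b} q)))
  ... | inj₁ p | inj₂ q rewrite p | q = trans (#-cong λ j → ∨-false-right (j == b)) (#-single b)
    where
    ∨-false-right : ∀ x → x ∨ false ≡ x
    ∨-false-right true  = refl
    ∨-false-right false = refl
  ... | inj₂ p | inj₁ q rewrite p | q = #-single a
  ... | inj₂ p | inj₂ q rewrite p | q = #-zero {n} {λ _ → false} λ _ → refl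

Off : ∀ {n} → Pair n → Pair n → Set
Off e (i , j) = same e i j ≡ false

off : ∀ {n} {a b i j : Fin n} → (i ≡ a → j ≡ b → ⊥) → (i ≡ b → j ≡ a → ⊥) → Off (a , b) (i , j)
off {a = a} {b} {i} {j} h k = not-true λ e → case (same-cases a b i j e)
  where
  case : (i ≡ a × j ≡ b) ⊎ (i ≡ b × j ≡ a) → ⊥
  case (inj₁ (p , q)) = h p q
  case (inj₂ (p , q)) = k p q

same-adj : ∀ {n} (G : Graph n) {a b i j c} → same (a , b) i j ≡ true → adj G a b ≡ c → adj G i j ≡ c
same-adj G {a} {b} {i} {j} h k with same-cases a b i j h
... | inj₁ (refl , refl) = k
... | inj₂ (refl , refl) = trans (sym G i j) k

Edge NonEdge : ∀ {n} → Graph n → Pair n → Set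
Edge    G (a , b) = adj G a b ≡ true
NonEdge G (a , b) = a ≢ b × adj G a b ≡ false

edge-≢ : ∀ {n} (G : Graph n) {a b} → adj G a b ≡ true → a ≢ b
edge-≢ G h refl = true≢false h (irrefl G _)

del : ∀ {n} → Graph n → Pair n → Graph n
adj    (del G e) i j = adj G i j ∧ not (same e i j)
sym    (del G e) i j = cong₂ (λ x y → x ∧ not y) (sym G i j) (same-sym e i j)
irrefl (del G e) i rewrite irrefl G i = refl

-- The factor `not (i == j)` keeps the graph loopless for a degenerate pair `(a , a)`, which makes
-- the operation total.
add : ∀ {n} → Graph n → Pair n → Graph n
adj    (add G e) i j = adj G i j ∨ (same e i j ∧ not (i == j))
sym    (add G e) i j = cong₂ _∨_ (sym G i j) (cong₂ (λ x y → x ∧ not y) (same-sym e i j) (==-sym i j))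
  where
  ==-sym : ∀ {n} (i j : Fin n) → (i == j) ≡ (j == i)
  ==-sym i j with true⊎false (i == j) | true⊎false (j == i)
  ... | inj₁ p | inj₁ q = trans p (≡-sym q)
  ... | inj₂ p | inj₂ q = trans p (≡-sym q)
  ... | inj₁ p | inj₂ q = ⊥-elim (==⇒≢ q (≡-sym (==⇒≡ p)))
  ... | inj₂ p | inj₁ q = ⊥-elim (==⇒≢ p (≡-sym (==⇒≡ q)))
irrefl (add G e) i rewrite irrefl G i | ==-refl i with same e i i
... | true  = refl
... | false = refl

dg-del : ∀ {n} (G : Graph n) e → Edge G e → ∀ i → dg (del G e) i + ends e i ≡ dg G i
dg-del {n} G (a , b) h i =
  trans (cong (dg (del G (a , b)) i +_) (≡-sym (#-same (edge-≢ G h) i)))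
  (trans (≡-sym (∑-distrib-+ (χ ∘ adj (del G (a , b)) i) (χ ∘ same (a , b) i)))
         (sum-cong-≗ pointwise))
  where
  split : ∀ x s → (s ≡ true → x ≡ true) → χ (x ∧ not s) + χ s ≡ χ x
  split x     true  k rewrite k refl = refl
  split true  false k = refl
  split false false k = refl
  pointwise : ∀ j → χ (adj G i j ∧ not (same (a , b) i j)) + χ (same (a , b) i j) ≡ χ (adj G i j)
  pointwise j = split (adj G i j) (same (a , b) i j) λ p → same-adj G {a} {b} {i} {j} p h

dg-add : ∀ {n} (G : Graph n) e → NonEdge G e → ∀ i → dg (add G e) i ≡ dg G i + ends e i
dg-add G (a , b) (a≢b , h) i =
  trans (sum-cong-≗ pointwise)
  (trans (∑-distrib-+ (χ ∘ adj G i) (χ ∘ same (a , b) i))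
         (cong (dg G i +_) (#-same a≢b i)))
  where
  distinct : ∀ {j} → (i ≡ a × j ≡ b) ⊎ (i ≡ b × j ≡ a) → i ≢ j
  distinct (inj₁ (refl , refl)) = a≢b
  distinct (inj₂ (refl , refl)) = a≢b ∘ ≡-sym
  join : ∀ x s e → (s ≡ true → x ≡ false × e ≡ false) → χ (x ∨ (s ∧ not e)) ≡ χ x + χ s
  join x     true  e k rewrite proj₁ (k refl) | proj₂ (k refl) = refl
  join true  false e k = refl
  join false false e k = refl
  pointwise : ∀ j → χ (adj G i j ∨ (same (a , b) i j ∧ not (i == j))) ≡ χ (adj G i j) + χ (same (a , b) i j)
  pointwise j = join (adj G i j) (same (a , b) i j) (i == j) λ p →
    same-adj G {a} {b} {i} {j} p h , ≢⇒== (distinct (same-cases a b i j p))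

delAll addAll : ∀ {n} → Graph n → List (Pair n) → Graph n
delAll G []      = G
delAll G (e ∷ R) = del (delAll G R) e
addAll G []      = G
addAll G (e ∷ A) = add (addAll G A) e

load : ∀ {n} → List (Pair n) → Fin n → ℕ
load []      i = 0
load (e ∷ R) i = ends e i + load R i

-- Pairs may share a vertex, but no two are the same edge in either orientation. Each deletion or
-- addition then finds its pair in the state it has in the original graph, and the degree changes
-- add up.
Apart : ∀ {n} → List (Pair n) → Set
Apart = AllPairs (λ e f → Off f e)

delAll-off : ∀ {n} (G : Graph n) R i j → All (λ e → Off e (i , j)) R → adj (delAll G R) i j ≡ adj G i j
delAll-off G []      i j []       = refl
delAll-off G (e ∷ R) i j (h ∷ hs) rewrite h | delAll-off G R i j hs with adj G i j
... | true  = refl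
... | false = refl

delAll-⊆ : ∀ {n} (G : Graph n) R i j → adj G i j ≡ false → adj (delAll G R) i j ≡ false
delAll-⊆ G []      i j h = h
delAll-⊆ G (e ∷ R) i j h rewrite delAll-⊆ G R i j h = refl

dg-delAll : ∀ {n} (G : Graph n) R → All (Edge G) R → Apart R → ∀ i → dg (delAll G R) i + load R i ≡ dg G i
dg-delAll G []      _        _        i = +-identityʳ _
dg-delAll G ((a , b) ∷ R) (h ∷ hs) (k ∷ ks) i =
  trans (≡-sym (+-assoc (dg (delAll G ((a , b) ∷ R)) i) _ _))
  (trans (cong (_+ load R i) (dg-del (delAll G R) (a , b) (trans (delAll-off G R a b k) h) i))
         (dg-delAll G R hs ks i))

addAll-⊇ : ∀ {n} (G : Graph n) A i j → adj G i j ≡ true → adj (addAll G A) i j ≡ true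
addAll-⊇ G []      i j h = h
addAll-⊇ G (e ∷ A) i j h = ∨-introˡ (addAll-⊇ G A i j h)

addAll-off : ∀ {n} (G : Graph n) A i j → All (λ e → Off e (i , j)) A → adj (addAll G A) i j ≡ adj G i j
addAll-off G []      i j []       = refl
addAll-off G (e ∷ A) i j (h ∷ hs) rewrite h | addAll-off G A i j hs with adj G i j
... | true  = refl
... | false = refl

dg-addAll : ∀ {n} (G : Graph n) A → All (NonEdge G) A → Apart A → ∀ i → dg (addAll G A) i ≡ dg G i + load A i
dg-addAll G []            _              _        i = ≡-sym (+-identityʳ _)
dg-addAll G ((a , b) ∷ A) ((d , h) ∷ hs) (k ∷ ks) i =
  trans (dg-add (addAll G A) (a , b) (d , trans (addAll-off G A a b k) h) i)
  (trans (cong (_+ ends (a , b) i) (dg-addAll G A hs ks i))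
  (trans (+-assoc (dg G i) _ _) (cong (dg G i +_) (+-comm (load A i) _))))

record Gain {n} (F : Fin n → Fin n → Bool) (G : Graph n) (u v : Fin n) : Set where
  constructor gain
  field
    graph : Graph n
    same-dg : dg graph ≗ dg G
    gained : adj graph u v ≡ true
    kept : ∀ i j → F i j ≡ true → adj G i j ≡ true → adj graph i j ≡ true
open Gain public

Free : ∀ {n} → (Fin n → Fin n → Bool) → Pair n → Set
Free F (a , b) = F a b ≡ false × F b a ≡ false

-- Deleting `R` first leaves the non-edges of `G` non-edges, so the additions can be checked against
-- `G` itself. The two loads cancel in every degree, and an edge of `F` survives because no deleted
-- pair belongs to `F` in either orientation.
rewire : ∀ {n} (F : Fin n → Fin n → Bool) (G : Graph n) (u v : Fin n) (R A : List (Pair n)) →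
         All (Edge G) R → Apart R → All (Free F) R →
         All (NonEdge G) ((u , v) ∷ A) → Apart ((u , v) ∷ A) →
         load R ≗ load ((u , v) ∷ A) → Gain F G u v
rewire F G u v R A hR aR fR (hA@((u≢v , _) ∷ _)) aA balance = gain G″ degrees new keep
  where
  G′ G″ : Graph _
  G′ = delAll G R
  G″ = addAll G′ ((u , v) ∷ A)
  lift : ∀ {B} → All (NonEdge G) B → All (NonEdge G′) B
  lift [] = []
  lift {(a , b) ∷ _} ((d , h) ∷ hs) = (d , delAll-⊆ G R a b h) ∷ lift hs
  degrees : ∀ i → dg G″ i ≡ dg G i
  degrees i = trans (dg-addAll G′ ((u , v) ∷ A) (lift hA) aA i)
    (trans (cong (dg G′ i +_) (≡-sym (balance i))) (dg-delAll G R hR aR i))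
  new : adj G″ u v ≡ true
  new rewrite same-self u v | ≢⇒== u≢v with adj (addAll G′ A) u v
  ... | true  = refl
  ... | false = refl
  keep : ∀ i j → F i j ≡ true → adj G i j ≡ true → adj G″ i j ≡ true
  keep i j f h = addAll-⊇ G′ ((u , v) ∷ A) i j (trans (delAll-off G R i j (apart fR)) h)
    where
    apart : ∀ {B} → All (Free F) B → All (λ e → Off e (i , j)) B
    apart [] = []
    apart ((p , q) ∷ ps) = off (λ { refl refl → true≢false f p }) (λ { refl refl → true≢false f q }) ∷ apart ps

-- The alternating cycle u, z, w, v: `u z` and `v w` give way to `u v` and `z w`.
swap₂ : ∀ {n} (F : Fin n → Fin n → Bool) (G : Graph n) {u v z w : Fin n} →
        u ≢ v → adj G u v ≡ false → adj G u z ≡ true → adj G v w ≡ true →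
        z ≢ w → adj G z w ≡ false → Free F (u , z) → Free F (v , w) → Gain F G u v
swap₂ F G {u} {v} {z} {w} u≢v uv uz vw z≢w zw fuz fvw =
  rewire F G u v ((u , z) ∷ (v , w) ∷ []) ((z , w) ∷ [])
    (uz ∷ vw ∷ [])
    ((off (λ p _ → u≢v p) (λ { refl refl → true≢false uz uv }) ∷ []) ∷ [] ∷ [])
    (fuz ∷ fvw ∷ [])
    ((u≢v , uv) ∷ (z≢w , zw) ∷ [])
    ((off (λ { refl refl → true≢false uz (irrefl G _) }) (λ { refl refl → true≢false uz uv }) ∷ []) ∷ [] ∷ [])
    (λ i → arith (χ (i == u)) (χ (i == z)) (χ (i == v)) (χ (i == w)))
  where
  arith : ∀ a b c d → (a + b) + ((c + d) + 0) ≡ (a + c) + ((b + d) + 0)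
  arith = solve-∀

-- The closed alternating walk u, z, a, b, w, v of length six. Vertices may coincide, for instance z
-- = w: the adjacencies with `z ≢ a` and `w ≢ b` already keep the pairs distinct.
swap₃ : ∀ {n} (F : Fin n → Fin n → Bool) (G : Graph n) {u v z w a b : Fin n} →
        u ≢ v → adj G u v ≡ false → adj G u z ≡ true → adj G v w ≡ true → adj G a b ≡ true →
        z ≢ a → adj G z a ≡ false → w ≢ b → adj G w b ≡ false →
        Free F (u , z) → Free F (v , w) → Free F (a , b) → Gain F G u v
swap₃ F G {u} {v} {z} {w} {a} {b} u≢v uv uz vw ab z≢a za w≢b wb fuz fvw fab =
  rewire F G u v ((u , z) ∷ (v , w) ∷ (a , b) ∷ []) ((z , a) ∷ (w , b) ∷ [])
    (uz ∷ vw ∷ ab ∷ [])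
    (( off (λ p _ → u≢v p) (λ { refl refl → true≢false uz uv })
     ∷ off (λ { refl refl → true≢false (trans (sym G _ _) uz) za }) (λ { refl refl → z≢a refl }) ∷ [])
    ∷ (off (λ { refl refl → w≢b refl }) (λ { refl refl → true≢false (trans (sym G _ _) vw) wb }) ∷ [])
    ∷ [] ∷ [])
    (fuz ∷ fvw ∷ fab ∷ [])
    ((u≢v , uv) ∷ (z≢a , za) ∷ (w≢b , wb) ∷ [])
    (( off (λ { refl refl → true≢false uz (irrefl G _) }) (λ { refl refl → true≢false uz uv })
     ∷ off (λ { refl refl → true≢false vw (trans (sym G _ _) uv) }) (λ { refl refl → true≢false vw (irrefl G _) }) ∷ [])
    ∷ (off (λ { refl refl → true≢false ab (irrefl G _) }) (λ { refl refl → true≢false (trans (sym G _ _) ab) za }) ∷ [])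
    ∷ [] ∷ [])
    (λ i → arith (χ (i == u)) (χ (i == z)) (χ (i == v)) (χ (i == w)) (χ (i == a)) (χ (i == b)))
  where
  arith : ∀ u z v w a b → (u + z) + ((v + w) + ((a + b) + 0)) ≡ (u + v) + ((z + a) + ((w + b) + 0))
  arith = solve-∀

-- The closed alternating walk u, z, a, b, e, c, w, v of length eight. Adjacency alone no longer
-- separates the pairs, hence the additional inequalities and the `Off` condition. They still allow
-- a = c, the case that `twins` uses.
swap₄ : ∀ {n} (F : Fin n → Fin n → Bool) (G : Graph n) {u v z w a b c e : Fin n} →
        u ≢ v → adj G u v ≡ false → adj G u z ≡ true → adj G v w ≡ true →
        adj G a b ≡ true → adj G c e ≡ true →
        z ≢ a → adj G z a ≡ false → w ≢ c → adj G w c ≡ false → b ≢ e → adj G b e ≡ false →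
        u ≢ c → u ≢ e → u ≢ b → v ≢ a → v ≢ b → Off (w , c) (z , a) →
        Free F (u , z) → Free F (v , w) → Free F (a , b) → Free F (c , e) → Gain F G u v
swap₄ F G {u} {v} {z} {w} {a} {b} {c} {e} u≢v uv uz vw ab ce z≢a za w≢c wc b≢e be u≢c u≢e u≢b v≢a v≢b zawc fuz fvw fab fce =
  rewire F G u v ((u , z) ∷ (v , w) ∷ (a , b) ∷ (c , e) ∷ []) ((z , a) ∷ (w , c) ∷ (b , e) ∷ [])
    (uz ∷ vw ∷ ab ∷ ce ∷ [])
    (( off (λ p _ → u≢v p) (λ { refl refl → true≢false uz uv })
     ∷ off (λ { refl refl → true≢false (trans (sym G _ _) uz) za }) (λ { refl refl → z≢a refl })
     ∷ off (λ p _ → u≢c p) (λ p _ → u≢e p) ∷ [])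
    ∷ ( off (λ p _ → v≢a p) (λ p _ → v≢b p)
      ∷ off (λ { refl refl → true≢false (trans (sym G _ _) vw) wc }) (λ { refl refl → w≢c refl }) ∷ [])
    ∷ (off (λ _ p → b≢e p) (λ { refl refl → true≢false ab (trans (sym G _ _) be) }) ∷ [])
    ∷ [] ∷ [])
    (fuz ∷ fvw ∷ fab ∷ fce ∷ [])
    ((u≢v , uv) ∷ (z≢a , za) ∷ (w≢c , wc) ∷ (b≢e , be) ∷ [])
    (( off (λ { refl refl → true≢false uz (irrefl G _) }) (λ { refl refl → true≢false uz uv })
     ∷ off (λ { refl refl → true≢false vw (trans (sym G _ _) uv) }) (λ { refl refl → true≢false vw (irrefl G _) })
     ∷ off (λ p _ → u≢b p) (λ p _ → u≢e p) ∷ [])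
    ∷ ( zawc
      ∷ off (λ { refl refl → true≢false (trans (sym G _ _) ab) za }) (λ { refl refl → true≢false ab (irrefl G _) }) ∷ [])
    ∷ (off (λ { refl refl → true≢false ce (irrefl G _) }) (λ { refl refl → true≢false ce (trans (sym G _ _) wc) }) ∷ [])
    ∷ [] ∷ [])
    (λ i → arith (χ (i == u)) (χ (i == z)) (χ (i == v)) (χ (i == w)) (χ (i == a)) (χ (i == b)) (χ (i == c)) (χ (i == e)))
  where
  arith : ∀ u z v w a b c e →
    (u + z) + ((v + w) + ((a + b) + ((c + e) + 0))) ≡ (u + v) + ((z + a) + ((w + c) + ((b + e) + 0)))
  arith = solve-∀

-- Counting ordered pairs by rows and columns.

## : ∀ {m n} → (Fin m → Fin n → Bool) → ℕ
## r = ∑ (λ i → # (r i))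

##-∪ : ∀ {m n} {r s t : Fin m → Fin n → Bool} → (∀ i j → r i j ≡ true → s i j ∨ t i j ≡ true) → ## r ≤ ## s + ## t
##-∪ {m} {s = s} {t} h = ≤-trans (∑-mono λ i → #-∪ (h i)) (≤-reflexive (∑-distrib-+ (λ i → # (s i)) (λ i → # (t i))))

##-zero : ∀ {m n} {r : Fin m → Fin n → Bool} → (∀ i j → r i j ≡ false) → ## r ≡ 0
##-zero {m} {n} h = trans (sum-cong-≗ λ i → #-zero (h i)) (trans (∑-const m 0) (*-zeroʳ m))

##-flip : ∀ {m n} (r : Fin m → Fin n → Bool) → ## r ≡ ## (λ j i → r i j)
##-flip r = ∑-comm (λ i j → χ (r i j))

##-split : ∀ {m n} (r s : Fin m → Fin n → Bool) →
           ## r ≡ ## (λ i j → r i j ∧ s i j) + ## (λ i j → r i j ∧ not (s i j))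
##-split r s = trans (sum-cong-≗ λ i → #-split (r i) (s i))
                     (∑-distrib-+ (λ i → # λ j → r i j ∧ s i j) (λ i → # λ j → r i j ∧ not (s i j)))

##-cong : ∀ {m n} {r s : Fin m → Fin n → Bool} → (∀ i j → r i j ≡ s i j) → ## r ≡ ## s
##-cong h = sum-cong-≗ (λ i → #-cong (h i))

##-rows : ∀ {m n} (r : Fin m → Fin n → Bool) (p q : Fin m → Bool) B C →
          (∀ i → # (r i) ≤ χ (p i) * B + χ (q i) * C) → ## r ≤ # p * B + # q * C
##-rows r p q B C h = ≤-trans (∑-mono h)
  (≤-reflexive (trans (∑-distrib-+ (λ i → χ (p i) * B) (λ i → χ (q i) * C))
                      (cong₂ _+_ (∑-*ʳ (χ ∘ p) B) (∑-*ʳ (χ ∘ q) C))))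

##-rows₁ : ∀ {m n} (r : Fin m → Fin n → Bool) (p : Fin m → Bool) B →
           (∀ i → p i ≡ true → # (r i) ≤ B) → (∀ i j → r i j ≡ true → p i ≡ true) → ## r ≤ # p * B
##-rows₁ r p B h k = ≤-trans (∑-mono row) (≤-reflexive (∑-*ʳ (χ ∘ p) B))
  where
  row : ∀ i → # (r i) ≤ χ (p i) * B
  row i with true⊎false (p i)
  ... | inj₁ e rewrite e = ≤-trans (h i e) (≤-reflexive (≡-sym (+-identityʳ B)))
  ... | inj₂ e = ≤-trans (≤-reflexive (#-zero λ j → not-true λ t → true≢false (k i j t) e)) z≤n

#-product : ∀ {m n} (p : Fin m → Bool) (q : Fin n → Bool) → ## (λ i j → p i ∧ q j) ≡ # p * # q
#-product {n = n} p q = trans (sum-cong-≗ row) (∑-*ʳ (χ ∘ p) (# q))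
  where
  row : ∀ i → # (λ j → p i ∧ q j) ≡ χ (p i) * # q
  row i with p i
  ... | true  = ≡-sym (+-identityʳ _)
  ... | false = #-zero {n} {λ j → false} λ _ → refl

-- Neighbourhoods and the edges avoiding a set of vertices

nbr : ∀ {n} → Graph n → Fin n → Fin n → Bool
nbr G w j = adj G w j ∨ (j == w)

#-nbr : ∀ {n} (G : Graph n) w → # (nbr G w) ≡ suc (dg G w)
#-nbr G w = #-insert w (irrefl G w)

nbr-false : ∀ {n} {G : Graph n} {w j} → nbr G w j ≡ false → adj G w j ≡ false × w ≢ j
nbr-false h = proj₁ (∨-false h) , λ e → ==⇒≢ (proj₂ (∨-false h)) (≡-sym e)

spare : ∀ {n} (p q : Fin n → Bool) → # q ≤ # p → ∀ u → q u ≡ true → p u ≡ false →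
        ∃ λ w → p w ≡ true × q w ≡ false
spare p q h u qu pu with search (λ w → p w ∧ not (q w))
... | inj₁ (w , e) = w , proj₁ (∧-elim e) , not-elim (proj₂ (∧-elim {p w} e))
... | inj₂ none = ⊥-elim (<⇒≱ (#-mono-< p⊆q u pu qu) h)
  where
  p⊆q : ∀ i → p i ≡ true → q i ≡ true
  p⊆q i e = not-false λ f → true≢false (∧-intro e (not-intro f)) (none i)

spare-< : ∀ {n} (p q : Fin n → Bool) → # q < # p → ∃ λ w → p w ≡ true × q w ≡ false
spare-< p q h with search (λ w → p w ∧ not (q w))
... | inj₁ (w , e) = w , proj₁ (∧-elim e) , not-elim (proj₂ (∧-elim {p w} e))
... | inj₂ none = ⊥-elim (<⇒≱ h (#-mono λ i e → not-false λ f → true≢false (∧-intro e (not-intro f)) (none i)))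

-- Since `u` is a neighbour of `y` only and `y` has no larger degree, `v` must have a neighbour that
-- `y` lacks.
exchange : ∀ {n} (G : Graph n) {u v y} → dg G y ≤ dg G v → adj G y u ≡ true → adj G v u ≡ false → u ≢ v →
           ∃ λ b → adj G v b ≡ true × adj G y b ≡ false × y ≢ b
exchange G {u} {v} {y} h yu vu u≢v = finish (spare p q q≤p u qu pu)
  where
  -- `y` and `v` are removed from each other's neighbourhoods. By symmetry both sizes drop or
  -- neither does, so the comparison of degrees survives, and the vertex found differs from `y`.
  p q : Fin _ → Bool
  p j = adj G v j ∧ not (j == y)
  q j = adj G y j ∧ not (j == v)
  pu : p u ≡ false
  pu rewrite vu = refl
  qu : q u ≡ true
  qu rewrite yu | ≢⇒== u≢v = refl
  unhit : ∀ {a b} → adj G a b ≡ false → # (λ j → adj G a j ∧ not (j == b)) ≡ dg G a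
  unhit {a} {b} e = #-cong keep
    where
    keep : ∀ j → adj G a j ∧ not (j == b) ≡ adj G a j
    keep j with ==-dec j b
    ... | inj₁ refl rewrite e = refl
    ... | inj₂ ne rewrite ≢⇒== ne with adj G a j
    ... | true  = refl
    ... | false = refl
  q≤p : # q ≤ # p
  q≤p with true⊎false (adj G v y)
  ... | inj₁ e = s≤s⁻¹ (≤-trans (≤-reflexive (#-remove (adj G y) v (trans (sym G y v) e)))
                        (≤-trans h (≤-reflexive (≡-sym (#-remove (adj G v) y e)))))
  ... | inj₂ e = ≤-trans (≤-reflexive (unhit (trans (sym G y v) e))) (≤-trans h (≤-reflexive (≡-sym (unhit e))))
  finish : (∃ λ w → p w ≡ true × q w ≡ false) → ∃ λ b → adj G v b ≡ true × adj G y b ≡ false × y ≢ b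
  finish (b , pb , qb) = b , vb , not-true yb , λ e → ==⇒≢ (not-elim (proj₂ (∧-elim {adj G v b} pb))) (≡-sym e)
    where
    vb = proj₁ (∧-elim pb)
    yb : adj G y b ≢ true
    yb e = edge-≢ G vb (≡-sym (==⇒≡ (not-false λ f → true≢false (∧-intro e (not-intro f)) qb)))

-- The pair gained need not be the missing pair at hand; `Rich` sometimes gains a different one.
Progress : ∀ {n} → (Fin n → Fin n → Bool) → Graph n → Set
Progress F G = ∃ λ u → ∃ λ v → F u v ≡ true × adj G u v ≡ false × Gain F G u v

-- The number of pairs of `F` missing in the graph drops with every exchange, because none that is
-- present gets lost. `W` is an alternative success that stops the process.
saturate : ∀ {n} (F : Fin n → Fin n → Bool) (d : Fin n → ℕ) {W : Set} →
           (∀ G → dg G ≗ d → ∀ u v → F u v ≡ true → adj G u v ≡ false → W ⊎ Progress F G) →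
           ∀ G → dg G ≗ d →
           W ⊎ (∃ λ G′ → dg G′ ≗ d × (∀ i j → F i j ≡ true → adj G′ i j ≡ true))
saturate {n} F d {W} improve G₀ r₀ = go G₀ r₀ (<-wellFounded _)
  where
  missing : Graph n → Fin n → Fin n → Bool
  missing G i j = F i j ∧ not (adj G i j)
  decrease : ∀ G {u v} → F u v ≡ true → adj G u v ≡ false → (g : Gain F G u v) → ## (missing (graph g)) < ## (missing G)
  decrease G {u} {v} f uv g = ∑-mono-< (λ i → #-mono (shrink i)) u
      (#-mono-< (shrink u) v gone (∧-intro f (not-intro uv)))
    where
    gone : missing (graph g) u v ≡ false
    gone rewrite gained g = ∧-falseʳ (F u v) refl
    shrink : ∀ i j → missing (graph g) i j ≡ true → missing G i j ≡ true
    shrink i j h = ∧-intro (proj₁ (∧-elim h)) (not-intro (not-true λ e →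
      true≢false (kept g i j (proj₁ (∧-elim h)) e) (not-elim (proj₂ (∧-elim {F i j} h)))))
  go : ∀ G → dg G ≗ d → Acc _<_ (## (missing G)) →
       W ⊎ (∃ λ G′ → dg G′ ≗ d × (∀ i j → F i j ≡ true → adj G′ i j ≡ true))
  go G r (acc rec) with search₂ (missing G)
  ... | inj₂ none = inj₂ (G , r , λ i j f → not-false λ e → true≢false (∧-intro f (not-intro e)) (none i j))
  ... | inj₁ (u , v , h) with improve G r u v (proj₁ (∧-elim h)) (not-elim (proj₂ (∧-elim {F u v} h)))
  ... | inj₁ w = inj₁ w
  ... | inj₂ (_ , _ , f , e , g) = go (graph g) (λ i → trans (same-dg g i) (r i)) (rec (decrease G f e g))

module _ {n} (G : Graph n) (C : Fin n → Bool) where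

  -- An edge avoiding `C` counts twice in `inner`, a missing pair between `C` and its complement
  -- once in `outer`.
  inner outer : Fin n → Fin n → Bool
  inner i j = (adj G i j ∧ not (C i)) ∧ not (C j)
  outer i j = (C i ∧ not (C j)) ∧ not (adj G i j)

  private
    CC CL LC : Fin n → Fin n → Bool
    CC i j = (adj G i j ∧ C i) ∧ C j
    CL i j = (adj G i j ∧ C i) ∧ not (C j)
    LC i j = (adj G i j ∧ not (C i)) ∧ C j

    CL≡LC : ## CL ≡ ## LC
    CL≡LC = trans (##-flip CL) (##-cong λ j i → trans (cong (λ x → (x ∧ C i) ∧ not (C j)) (sym G i j)) (perm (adj G j i) (C i) (not (C j))))
      where
      perm : ∀ a b c → (a ∧ b) ∧ c ≡ (a ∧ c) ∧ b
      perm true  b c = ∧-comm b c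
      perm false b c = refl

    CC-bound : ## CC + # C ≤ # C * # C
    CC-bound = ≤-trans (≤-reflexive (≡-sym (∑-distrib-+ (λ i → # (CC i)) (χ ∘ C))))
      (≤-trans (∑-mono row) (≤-reflexive (∑-*ʳ (χ ∘ C) (# C))))
      where
      row : ∀ i → # (CC i) + χ (C i) ≤ χ (C i) * # C
      row i with true⊎false (C i)
      ... | inj₂ e rewrite e = ≤-reflexive (trans (+-identityʳ _) (#-zero λ j → none (adj G i j)))
        where
        none : ∀ {x} y → (y ∧ false) ∧ x ≡ false
        none true  = refl
        none false = refl
      ... | inj₁ e rewrite e = ≤-trans (≤-reflexive (+-comm _ 1))
              (≤-trans (#-mono-< (λ j h → proj₂ (∧-elim {adj G i j ∧ true} h)) i gone e)
                       (≤-reflexive (≡-sym (+-identityʳ _))))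
        where
        gone : (adj G i i ∧ true) ∧ C i ≡ false
        gone rewrite irrefl G i = refl

    degree-sum : ∑ (dg G) ≡ (## CC + ## CL) + (## LC + ## inner)
    degree-sum = trans (##-split (adj G) (λ i j → C i))
      (cong₂ _+_ (##-split (λ i j → adj G i j ∧ C i) (λ i j → C j))
                 (##-split (λ i j → adj G i j ∧ not (C i)) (λ i j → C j)))

    CL+outer : ## CL + ## outer ≡ # C * # (not ∘ C)
    CL+outer = trans (cong (_+ ## outer) (##-cong λ i j → perm (adj G i j) (C i) (not (C j))))
      (trans (≡-sym (##-split (λ i j → C i ∧ not (C j)) (adj G))) (#-product C (not ∘ C)))
      where
      perm : ∀ a b c → (a ∧ b) ∧ c ≡ (b ∧ c) ∧ a
      perm true  b c = ≡-sym (∧-true-right (b ∧ c))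
        where
        ∧-true-right : ∀ x → x ∧ true ≡ x
        ∧-true-right true  = refl
        ∧-true-right false = refl
      perm false b c = ≡-sym (∧-false-right (b ∧ c))
        where
        ∧-false-right : ∀ x → x ∧ false ≡ false
        ∧-false-right true  = refl
        ∧-false-right false = refl

  -- With c = |C| and m vertices outside, K_c ∨ m K_1 has degree sum c(c - 1) + 2cm. Each of its
  -- pairs missing between `C` and the rest costs 2, and whatever the degree sum has beyond that
  -- must come from `inner`. All subtractions are moved to the other side.
  inner-lower-bound : ∑ (dg G) + 2 * ## outer + # C ≤ ## inner + 2 * (# C * # (not ∘ C)) + # C * # C
  inner-lower-bound = begin
    ∑ (dg G) + 2 * ## outer + # C
      ≡⟨ cong (λ x → x + 2 * ## outer + # C) degree-sum ⟩
    (## CC + ## CL) + (## LC + ## inner) + 2 * ## outer + # C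
      ≡⟨ cong (λ x → (## CC + ## CL) + (x + ## inner) + 2 * ## outer + # C) (≡-sym CL≡LC) ⟩
    (## CC + ## CL) + (## CL + ## inner) + 2 * ## outer + # C
      ≡⟨ arith (## CC) (## CL) (## inner) (## outer) (# C) ⟩
    (## CC + # C) + (## inner + 2 * (## CL + ## outer))
      ≤⟨ +-mono-≤ CC-bound (≤-reflexive (cong (λ x → ## inner + 2 * x) CL+outer)) ⟩
    # C * # C + (## inner + 2 * (# C * # (not ∘ C)))
      ≡⟨ +-comm (# C * # C) _ ⟩
    ## inner + 2 * (# C * # (not ∘ C)) + # C * # C ∎
    where
    open ≤-Reasoning
    arith : ∀ cc cl i o c → (cc + cl) + (cl + i) + 2 * o + c ≡ (cc + c) + (i + 2 * (cl + o))
    arith = solve-∀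

  -- The degrees outside `C` bound the pairs starting there, and by symmetry also those going from
  -- `C` to its complement; inside `C` there are at most c(c - 1) pairs.
  tail-bound : ∀ B → (∀ i → C i ≡ false → dg G i ≤ B) →
               ∑ (dg G) + # C ≤ # C * # C + 2 * (# (not ∘ C) * B)
  tail-bound B h = begin
    ∑ (dg G) + # C
      ≡⟨ cong (_+ # C) degree-sum ⟩
    (## CC + ## CL) + (## LC + ## inner) + # C
      ≡⟨ arith (## CC) (## CL) (## LC) (## inner) (# C) ⟩
    (## CC + # C) + (## CL + (## LC + ## inner))
      ≤⟨ +-mono-≤ CC-bound (+-mono-≤ (≤-trans (≤-reflexive CL≡LC) (≤-trans (m≤m+n _ _) rest)) rest) ⟩
    # C * # C + (# (not ∘ C) * B + # (not ∘ C) * B)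
      ≡⟨ cong (λ x → # C * # C + (# (not ∘ C) * B + x)) (≡-sym (+-identityʳ (# (not ∘ C) * B))) ⟩
    # C * # C + 2 * (# (not ∘ C) * B) ∎
    where
    open ≤-Reasoning
    arith : ∀ cc cl lc i c → (cc + cl) + (lc + i) + c ≡ (cc + c) + (cl + (lc + i))
    arith = solve-∀
    rest : ## LC + ## inner ≤ # (not ∘ C) * B
    rest = ≤-trans (≤-reflexive (≡-sym (##-split (λ i j → adj G i j ∧ not (C i)) (λ i j → C j))))
      (##-rows₁ (λ i j → adj G i j ∧ not (C i)) (not ∘ C) B
        (λ i e → ≤-trans (#-mono {n} {λ j → adj G i j ∧ not (C i)} {adj G i} λ j k → proj₁ (∧-elim k)) (h i (not-elim e)))
        (λ i j k → proj₂ (∧-elim {adj G i j} k)))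

-- Two-trees as subgraphs of joins

-- 2-degeneracy in hereditary form: `R` is the set of remaining vertices, and `v` only witnesses
-- that it is nonempty.
Sparse : ∀ {m} → Graph m → Set
Sparse {m} H = ∀ (R : Fin m → Bool) v → R v ≡ true →
               ∃ λ w → R w ≡ true × # (λ j → R j ∧ adj H w j) ≤ 2

-- If the vertex `v` of degree 2 is in `R`, it serves itself; otherwise `R` lives in the smaller
-- tree. In K_3 any vertex has at most two others.
twoTree-sparse : ∀ {m} {H : Graph m} → IsTwoTree H → Sparse H
twoTree-sparse (base H _) R v Rv = v , Rv , s≤s⁻¹ (≤-trans
  (#-mono-< {p = λ j → R j ∧ adj H v j} {λ _ → true} (λ _ _ → refl) v self refl) (≤-reflexive (#-true 3)))
  where
  self : R v ∧ adj H v v ≡ false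
  self rewrite irrefl H v | Rv = refl
twoTree-sparse (step {m} H v deg₂ _ tree) R x Rx with true⊎false (R v)
... | inj₁ Rv = v , Rv , ≤-trans (#-mono {p = λ j → R j ∧ adj H v j} {adj H v} λ j h → proj₂ (∧-elim {R j} h)) (≤-reflexive (trans (≡-sym (degree≡dg H v)) deg₂))
... | inj₂ Rv = result (twoTree-sparse tree (R ∘ punchIn v) (punchOut v≢x) (trans (cong R (Fin.punchIn-punchOut v≢x)) Rx))
  where
  v≢x : v ≢ x
  v≢x refl = true≢false Rx Rv
  result : (∃ λ w → R (punchIn v w) ≡ true × # (λ j → R (punchIn v j) ∧ adj (delete H v) w j) ≤ 2) →
           ∃ λ w → R w ≡ true × # (λ j → R j ∧ adj H w j) ≤ 2
  result (w , Rw , h) = punchIn v w , Rw , ≤-trans (≤-reflexive (trans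
      (sum-remove {i = v} (λ j → χ (R j ∧ adj H (punchIn v w) j)))
      (cong (λ b → χ (b ∧ adj H (punchIn v w) v) + # (λ j → R (punchIn v j) ∧ adj (delete H v) w j)) Rv))) h

record SparseSet {m} (H : Graph m) (s : ℕ) : Set where
  field
    I Y : Fin m → Bool
    disjoint : ∀ i → I i ≡ true → Y i ≡ false
    #I : # I ≡ s
    #Y : # Y ≤ 2 * s
    closed : ∀ i j → I i ≡ true → adj H i j ≡ true → Y j ≡ true

-- Repeatedly take a vertex with at most two neighbours left, and discard those neighbours.
sparseSet : ∀ {m} {H : Graph m} → Sparse H → ∀ s → 3 * s ≤ m → SparseSet H s
sparseSet {m} {H} sp zero h = record
  { I = λ _ → false ; Y = λ _ → false ; disjoint = λ _ () ; #I = #-zero {m} {λ _ → false} (λ _ → refl)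
  ; #Y = ≤-reflexive (#-zero {m} {λ _ → false} λ _ → refl) ; closed = λ _ _ () }
sparseSet {m} {H} sp (suc s) h = extend (#-witness R R>0)
  where
  open SparseSet (sparseSet {H = H} sp s (≤-trans (*-monoʳ-≤ 3 (n≤1+n s)) h))
  R : Fin m → Bool
  R i = not (I i ∨ Y i)
  R>0 : 0 < # R
  R>0 = +-cancelˡ-< (3 * s) 0 (# R) (begin-strict
    3 * s + 0                   ≡⟨ +-identityʳ (3 * s) ⟩
    3 * s                       <⟨ *-monoʳ-< 3 (n<1+n s) ⟩
    3 * suc s                   ≤⟨ h ⟩
    m                           ≡⟨ ≡-sym (#-complement {m} (λ i → I i ∨ Y i)) ⟩
    # (λ i → I i ∨ Y i) + # R   ≤⟨ +-monoˡ-≤ (# R) (#-∪ {p = λ i → I i ∨ Y i} {I} {Y} λ _ e → e) ⟩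
    # I + # Y + # R             ≤⟨ +-monoˡ-≤ (# R) (+-mono-≤ (≤-reflexive #I) #Y) ⟩
    3 * s + # R                 ∎)
    where open ≤-Reasoning
  extend : (∃ λ i → R i ≡ true) → SparseSet H (suc s)
  extend (x , Rx) with sp R x Rx
  ... | v , Rv , few = record
    { I = I′ ; Y = Y′ ; disjoint = disjoint′ ; #I = trans (#-insert v I-v) (cong suc #I)
    ; #Y = ≤-trans (#-∪ {p = Y′} {Y} {λ j → R j ∧ adj H v j} λ _ e → e)
             (≤-trans (+-mono-≤ #Y few) (≤-reflexive (arith s)))
    ; closed = closed′ }
    where
    arith : ∀ s → 2 * s + 2 ≡ 2 * suc s
    arith = solve-∀
    I′ Y′ : Fin m → Bool
    I′ j = I j ∨ (j == v)
    Y′ j = Y j ∨ (R j ∧ adj H v j)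
    I-v : I v ≡ false
    I-v = proj₁ (∨-false (not-elim Rv))
    Y-v : Y v ≡ false
    Y-v = proj₂ (∨-false {I v} (not-elim Rv))
    disjoint′ : ∀ i → I′ i ≡ true → Y′ i ≡ false
    disjoint′ i e with ∨-elim e
    ... | inj₁ Ii rewrite disjoint i Ii | Ii = refl
    ... | inj₂ iv rewrite ==⇒≡ iv = cong₂ _∨_ Y-v (∧-falseʳ (R v) (irrefl H v))
    closed′ : ∀ i j → I′ i ≡ true → adj H i j ≡ true → Y′ j ≡ true
    closed′ i j e h with ∨-elim e
    ... | inj₁ Ii = ∨-introˡ (closed i j Ii h)
    ... | inj₂ iv with ==⇒≡ iv
    ... | refl with true⊎false (Y j) | true⊎false (I j)
    ... | inj₁ Yj | _ = ∨-introˡ Yj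
    -- A neighbour of `v` in `I` would have put `v` into `Y` at an earlier stage.
    ... | inj₂ Yj | inj₁ Ij = ⊥-elim (true≢false (closed j v Ij (trans (sym H j v) h)) Y-v)
    ... | inj₂ Yj | inj₂ Ij = ∨-introʳ {Y j} (∧-intro (not-intro (cong₂ _∨_ Ij Yj)) h)

record Injection {m n} (p : Fin m → Bool) (q : Fin n → Bool) : Set where
  field
    to : ∀ i → p i ≡ true → Fin n
    hit : ∀ i h → q (to i h) ≡ true
    injective : ∀ i j h k → to i h ≡ to j k → i ≡ j
    rest : Fin n → Bool
    rest⊆q : ∀ j → rest j ≡ true → q j ≡ true
    rest-unhit : ∀ i h → rest (to i h) ≡ false
    #rest : # rest + # p ≡ # q

injection : ∀ {m n} (p : Fin m → Bool) (q : Fin n → Bool) → # p ≤ # q → Injection p q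
injection {zero} p q h = record
  { to = λ () ; hit = λ () ; injective = λ () ; rest = q ; rest⊆q = λ _ e → e
  ; rest-unhit = λ () ; #rest = +-identityʳ _ }
injection {suc m} {n} p q h with true⊎false (p zero)
... | inj₂ p₀ = record
  { to = λ { zero e → ⊥-elim (true≢false e p₀) ; (suc i) → to i }
  ; hit = λ { zero e → ⊥-elim (true≢false e p₀) ; (suc i) → hit i }
  ; injective = λ { zero _ e → ⊥-elim (true≢false e p₀) ; (suc _) zero _ e → ⊥-elim (true≢false e p₀)
                  ; (suc i) (suc j) h k e → cong suc (injective i j h k e) }
  ; rest = rest ; rest⊆q = rest⊆q
  ; rest-unhit = λ { zero e → ⊥-elim (true≢false e p₀) ; (suc i) → rest-unhit i }
  ; #rest = trans (cong (λ b → # rest + (χ b + # (p ∘ suc))) p₀) #rest }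
  where open Injection (injection (p ∘ suc) q (≤-trans (m≤n+m _ (χ (p zero))) h))
... | inj₁ p₀ with #-witness q (≤-trans (≤-trans (≤-reflexive (≡-sym (cong χ p₀))) (m≤m+n (χ (p zero)) _)) h)
... | w , qw = record
  { to = to′
  ; hit = λ { zero e → qw ; (suc i) e → proj₁ (∧-elim (hit i e)) }
  ; injective = inj′
  ; rest = rest ; rest⊆q = λ j e → proj₁ (∧-elim (rest⊆q j e))
  ; rest-unhit = λ { zero e → not-true λ r → other r refl ; (suc i) → rest-unhit i }
  ; #rest = trans (cong (λ b → # rest + (χ b + # (p ∘ suc))) p₀)
              (trans (+-suc _ _) (trans (cong suc #rest) (#-remove q w qw))) }
  where
  q′ : Fin n → Bool
  q′ j = q j ∧ not (j == w)
  open Injection (injection (p ∘ suc) q′ (s≤s⁻¹ (≤-trans (≤-trans (≤-reflexive (cong (λ b → χ b + # (p ∘ suc)) (≡-sym p₀))) h)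
                                              (≤-reflexive (≡-sym (#-remove q w qw))))))
  other : ∀ {j} → rest j ≡ true → j ≢ w
  other {j} e = ==⇒≢ (not-elim (proj₂ (∧-elim {q j} (rest⊆q j e))))
  hit-other : ∀ i e → to i e ≢ w
  hit-other i e = ==⇒≢ (not-elim (proj₂ (∧-elim {q (to i e)} (hit i e))))
  to′ : ∀ i → p i ≡ true → Fin n
  to′ zero    _ = w
  to′ (suc i) e = to i e
  inj′ : ∀ i j h k → to′ i h ≡ to′ j k → i ≡ j
  inj′ zero    zero    h k e = refl
  inj′ zero    (suc j) h k e = ⊥-elim (hit-other j k (≡-sym e))
  inj′ (suc i) zero    h k e = ⊥-elim (hit-other i h e)
  inj′ (suc i) (suc j) h k e = cong suc (injective i j h k e)

-- G contains the join of K_|C| with the disjoint union of K_|Q| and |I| isolated vertices.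
record Target (t : ℕ) {n} (G : Graph n) : Set where
  field
    C Q I : Fin n → Bool
    s : ℕ
    C-Q : ∀ i → C i ≡ true → Q i ≡ false
    I-CQ : ∀ i → I i ≡ true → C i ∨ Q i ≡ false
    s≤#I : s ≤ # I
    2s≤#C : 2 * s ≤ # C
    s≤t : s ≤ t
    total : 3 * t ≤ # C + # Q + s
    clique : ∀ i j → C i ∨ Q i ≡ true → C j ∨ Q j ≡ true → i ≢ j → adj G i j ≡ true
    complete : ∀ i j → C i ≡ true → I j ≡ true → adj G i j ≡ true

-- `J` goes into `I`, its neighbours `Y` into `C`, and everything else into the remainder of `C` and
-- `Q`. An edge at `J` has its other end in `Y` and is supplied by `complete`; any other edge lands
-- in the clique.
target-contains : ∀ {t n} {G : Graph n} → Target t G → (H : Graph (3 * t)) → IsTwoTree H → H ⊆ᵍ G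
target-contains {t} {n} {G} target H tree = f , (λ {i} {j} → f-injective i j) , λ i j h → true⇒T (f-adj i j (T⇒true h))
  where
  open Target target
  open SparseSet (sparseSet {H = H} (twoTree-sparse tree) s (*-monoʳ-≤ 3 s≤t))
    renaming (I to J)
  Z P : Fin (3 * t) → Bool
  Z i = not (J i ∨ Y i)
  module J→I = Injection (injection J I (≤-trans (≤-reflexive #I) s≤#I))
  module Y→C = Injection (injection Y C (≤-trans #Y 2s≤#C))
  P i = J i ∨ Y i
  free : Fin n → Bool
  free j = Y→C.rest j ∨ Q j
  -- There are 3t - |J| - |Y| vertices left for |C| - |Y| + |Q| places; as |J| = s, this is `total`.
  room : # Z ≤ # free
  room = +-cancelˡ-≤ (# J + # Y) (# Z) (# free) (begin
    # J + # Y + # Z          ≡⟨ cong (_+ # Z) (≡-sym #P) ⟩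
    # P + # Z                ≡⟨ #-complement P ⟩
    3 * t                    ≤⟨ total ⟩
    # C + # Q + s            ≡⟨ cong₂ (λ x y → x + # Q + y) (≡-sym Y→C.#rest) (≡-sym #I) ⟩
    # Y→C.rest + # Y + # Q + # J ≡⟨ arith (# Y→C.rest) (# Y) (# Q) (# J) ⟩
    # J + # Y + (# Y→C.rest + # Q) ≤⟨ +-monoʳ-≤ (# J + # Y) (#-disjoint {p = Y→C.rest} {Q} {free}
                                      (λ _ → ∨-introˡ) (λ j → ∨-introʳ {Y→C.rest j}) (λ j e → C-Q j (Y→C.rest⊆q j e))) ⟩
    # J + # Y + # free       ∎)
    where
    open ≤-Reasoning
    arith : ∀ a b c d → a + b + c + d ≡ d + b + (a + c)
    arith = solve-∀
    #P : # P ≡ # J + # Y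
    #P = ≤-antisym (#-∪ {p = P} {J} {Y} λ _ e → e)
           (#-disjoint {p = J} {Y} {P} (λ _ → ∨-introˡ) (λ j → ∨-introʳ {J j}) disjoint)
  module Z→free = Injection (injection Z free room)

  data Kind (i : Fin (3 * t)) : Set where
    inJ : J i ≡ true → Kind i
    inY : Y i ≡ true → Kind i
    inZ : Z i ≡ true → Kind i

  kind : ∀ i → Kind i
  kind i with true⊎false (J i) | true⊎false (Y i)
  ... | inj₁ e | _      = inJ e
  ... | inj₂ _ | inj₁ e = inY e
  ... | inj₂ a | inj₂ b = inZ (not-intro (cong₂ _∨_ a b))

  image : ∀ i → Kind i → Fin n
  image i (inJ e) = J→I.to i e
  image i (inY e) = Y→C.to i e
  image i (inZ e) = Z→free.to i e

  f : Fin (3 * t) → Fin n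
  f i = image i (kind i)

  free⊆ : ∀ {j} → free j ≡ true → C j ∨ Q j ≡ true
  free⊆ {j} e with ∨-elim e
  ... | inj₁ r = ∨-introˡ (Y→C.rest⊆q j r)
  ... | inj₂ q = ∨-introʳ {C j} q

  inI : ∀ i e → I (J→I.to i e) ≡ true
  inI = J→I.hit
  inC : ∀ i e → C (Y→C.to i e) ≡ true
  inC = Y→C.hit
  inCQ : ∀ i e → C (Z→free.to i e) ∨ Q (Z→free.to i e) ≡ true
  inCQ i e = free⊆ (Z→free.hit i e)

  separate : ∀ {i j x y} → I x ≡ true → C y ∨ Q y ≡ true → x ≡ y → i ≡ j
  separate a b refl = ⊥-elim (true≢false b (I-CQ _ a))

  apartYZ : ∀ i j e h → Y→C.to i e ≢ Z→free.to j h
  apartYZ i j e h k with ∨-elim (Z→free.hit j h)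
  ... | inj₁ r = true≢false r (subst (λ x → Y→C.rest x ≡ false) k (Y→C.rest-unhit i e))
  ... | inj₂ q = true≢false q (subst (λ x → Q x ≡ false) k (C-Q _ (inC i e)))

  image-injective : ∀ i j a b → image i a ≡ image j b → i ≡ j
  image-injective i j (inJ e) (inJ h) k = J→I.injective i j e h k
  image-injective i j (inJ e) (inY h) k = separate (inI i e) (∨-introˡ (inC j h)) k
  image-injective i j (inJ e) (inZ h) k = separate (inI i e) (inCQ j h) k
  image-injective i j (inY e) (inJ h) k = separate (inI j h) (∨-introˡ (inC i e)) (≡-sym k)
  image-injective i j (inY e) (inY h) k = Y→C.injective i j e h k
  image-injective i j (inY e) (inZ h) k = ⊥-elim (apartYZ i j e h k)
  image-injective i j (inZ e) (inJ h) k = separate (inI j h) (inCQ i e) (≡-sym k)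
  image-injective i j (inZ e) (inY h) k = ⊥-elim (apartYZ j i h e (≡-sym k))
  image-injective i j (inZ e) (inZ h) k = Z→free.injective i j e h k

  f-injective : ∀ i j → f i ≡ f j → i ≡ j
  f-injective i j = image-injective i j (kind i) (kind j)

  J-Y : ∀ {i j} → J i ≡ true → adj H i j ≡ true → ∀ (a : Kind j) → C (image j a) ≡ true
  J-Y {i} {j} e h (inJ k) = ⊥-elim (true≢false (closed i j e h) (disjoint j k))
  J-Y {i} {j} e h (inY k) = inC j k
  J-Y {i} {j} e h (inZ k) = ⊥-elim (true≢false (∨-introʳ {J j} (closed i j e h)) (not-elim k))

  image-CQ : ∀ i (a : Kind i) → J i ≡ true ⊎ C (image i a) ∨ Q (image i a) ≡ true
  image-CQ i (inJ e) = inj₁ e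
  image-CQ i (inY e) = inj₂ (∨-introˡ (inC i e))
  image-CQ i (inZ e) = inj₂ (inCQ i e)

  image-I : ∀ i (a : Kind i) → J i ≡ true → I (image i a) ≡ true
  image-I i (inJ e) _ = inI i e
  image-I i (inY e) h = ⊥-elim (true≢false e (disjoint i h))
  image-I i (inZ e) h = ⊥-elim (true≢false (∨-introˡ h) (not-elim e))

  f-adj : ∀ i j → adj H i j ≡ true → adj G (f i) (f j) ≡ true
  f-adj i j h with image-CQ i (kind i) | image-CQ j (kind j)
  ... | inj₁ e | _ = trans (sym G (f i) (f j)) (complete (f j) (f i) (J-Y e h (kind j)) (image-I i (kind i) e))
  ... | inj₂ _ | inj₁ e = complete (f i) (f j) (J-Y e (trans (sym H j i) h) (kind i)) (image-I j (kind j) e)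
  ... | inj₂ a | inj₂ b = clique (f i) (f j) a b (λ k → edge-≢ H h (f-injective i j k))

Realized : ∀ {n} → ℕ → (Fin n → ℕ) → Set
Realized {n} t d = ∃ λ (G : Graph n) → dg G ≗ d × Target t G

-- Cliques on 3t vertices

-- A nonadjacent pair in S can be joined by an exchange, unless the neighbours outside S of one of the
-- two vertices form a clique; there are at least 3t of them, so that clique serves as well.
module Clique {n} (d : Fin n → ℕ) (t : ℕ) (3t≤n : 3 * t ≤ n)
              (large : ∀ i → toℕ i < 3 * t → 6 * t ≤ d i + 2) where

  S : Fin n → Bool
  S = below (3 * t)

  F : Fin n → Fin n → Bool
  F i j = S i ∧ (S j ∧ not (i == j))

  F-intro : ∀ {i j} → S i ≡ true → S j ≡ true → i ≢ j → F i j ≡ true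
  F-intro si sj ne = ∧-intro si (∧-intro sj (not-intro (≢⇒== ne)))

  free : ∀ a {b} → S b ≡ false → Free F (a , b)
  free a {b} h = ∧-falseʳ (S a) (∧-falseˡ (not (a == b)) h) , ∧-falseˡ (S a ∧ not (b == a)) h

  clique-target : ∀ G (K : Fin n → Bool) → 3 * t ≤ # K →
                  (∀ i j → K i ≡ true → K j ≡ true → i ≢ j → adj G i j ≡ true) → Target t G
  clique-target G K h clique = record
    { C = λ _ → false ; Q = K ; I = λ _ → false ; s = 0 ; C-Q = λ _ () ; I-CQ = λ _ ()
    ; s≤#I = z≤n ; 2s≤#C = z≤n ; s≤t = z≤n
    ; total = ≤-trans h (≤-trans (m≤n+m (# K) _) (m≤m+n _ 0))
    ; clique = clique ; complete = λ _ _ () }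

  outside : Graph n → Fin n → Fin n → Bool
  outside G w j = adj G w j ∧ not (S j)

  -- Neither `u` nor `v` is a neighbour of `u`, so at most 3t - 2 of its at least 6t - 2 neighbours
  -- are in `S`.
  outside-large : ∀ G → dg G ≗ d → ∀ {u v} → S u ≡ true → S v ≡ true → u ≢ v → adj G u v ≡ false →
                  3 * t ≤ # (outside G u)
  outside-large G r {u} {v} Su Sv u≢v uv = +-cancelˡ-≤ (3 * t) _ _ (begin
    3 * t + 3 * t                              ≡⟨ arith t ⟩
    6 * t                                      ≤⟨ large u (below-< Su) ⟩
    d u + 2                                    ≡⟨ cong (_+ 2) (≡-sym (r u)) ⟩
    dg G u + 2                                 ≡⟨ cong (_+ 2) (#-split (adj G u) S) ⟩
    # (inside) + # (outside G u) + 2           ≡⟨ swap (# inside) (# (outside G u)) ⟩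
    suc (suc (# inside)) + # (outside G u)     ≤⟨ +-monoˡ-≤ (# (outside G u)) small ⟩
    3 * t + # (outside G u)                    ∎)
    where
    open ≤-Reasoning
    inside : Fin n → Bool
    inside j = adj G u j ∧ S j
    arith : ∀ t → 3 * t + 3 * t ≡ 6 * t
    arith = solve-∀
    swap : ∀ a b → a + b + 2 ≡ suc (suc a) + b
    swap = solve-∀
    inside⁺ : Fin n → Bool
    inside⁺ j = inside j ∨ (j == v)
    v∉ : inside v ≡ false
    v∉ rewrite uv = refl
    u∉ : inside⁺ u ≡ false
    u∉ rewrite irrefl G u = ≢⇒== u≢v
    ⊆S : ∀ j → inside⁺ j ≡ true → S j ≡ true
    ⊆S j e with ∨-elim e
    ... | inj₁ a = proj₂ (∧-elim {adj G u j} a)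
    ... | inj₂ b rewrite ==⇒≡ b = Sv
    small : suc (suc (# inside)) ≤ 3 * t
    small = ≤-trans (≤-trans (≤-reflexive (cong suc (≡-sym (#-insert v v∉)))) (#-mono-< ⊆S u u∉ Su))
                    (≤-reflexive (#-below 3t≤n))

  nonadjacent : Graph n → (Fin n → Bool) → Fin n → Fin n → Bool
  nonadjacent G K p q = K p ∧ (K q ∧ (not (p == q) ∧ not (adj G p q)))

  clique-or-gap : ∀ G → dg G ≗ d → ∀ K → 3 * t ≤ # K →
    Realized t d ⊎ (∃ λ p → ∃ λ q → K p ≡ true × K q ≡ true × p ≢ q × adj G p q ≡ false)
  clique-or-gap G r K h with search₂ (nonadjacent G K)
  ... | inj₂ none = inj₁ (G , r , clique-target G K h λ i j Ki Kj ne →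
          not-false λ e → true≢false (∧-intro Ki (∧-intro Kj (∧-intro (not-intro (≢⇒== ne)) (not-intro e)))) (none i j))
  ... | inj₁ (p , q , e) =
        let (Kp , e₁) = ∧-elim e ; (Kq , e₂) = ∧-elim {K q} e₁ ; (ne , e₃) = ∧-elim {not (p == q)} e₂
        in inj₂ (p , q , Kp , Kq , ==⇒≢ (not-elim ne) , not-elim e₃)

  improve : ∀ G → dg G ≗ d → ∀ u v → F u v ≡ true → adj G u v ≡ false → Realized t d ⊎ Progress F G
  improve G r u v f uv = wrap (go
    (clique-or-gap G r (outside G u) (outside-large G r Su Sv u≢v uv))
    (clique-or-gap G r (outside G v) (outside-large G r Sv Su (u≢v ∘ ≡-sym) (trans (sym G v u) uv))))
    where
    wrap : Realized t d ⊎ Gain F G u v → Realized t d ⊎ Progress F G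
    wrap (inj₁ w) = inj₁ w
    wrap (inj₂ g) = inj₂ (u , v , f , uv , g)
    Su = proj₁ (∧-elim f)
    Sv = proj₁ (∧-elim {S v} (proj₂ (∧-elim {S u} f)))
    u≢v : u ≢ v
    u≢v = ==⇒≢ (not-elim (proj₂ (∧-elim {S v} (proj₂ (∧-elim {S u} f)))))
    out : ∀ {w z} → outside G w z ≡ true → adj G w z ≡ true × S z ≡ false
    out {w} {z} e = proj₁ (∧-elim e) , not-elim (proj₂ (∧-elim {adj G w z} e))
    Gap : Fin n → Set
    Gap w = ∃ λ p → ∃ λ q → outside G w p ≡ true × outside G w q ≡ true × p ≢ q × adj G p q ≡ false
    two : ∀ {z w} → outside G u z ≡ true → outside G v w ≡ true → z ≢ w → adj G z w ≡ false → Gain F G u v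
    two hz hw ne zw = let (uz , Sz) = out hz ; (vw , Sw) = out hw in
      swap₂ F G u≢v uv uz vw ne zw (free u Sz) (free v Sw)
    go : Realized t d ⊎ Gap u → Realized t d ⊎ Gap v → Realized t d ⊎ Gain F G u v
    go (inj₁ w) _ = inj₁ w
    go (inj₂ _) (inj₁ w) = inj₁ w
    -- If q = y, or if `q` and `y` are nonadjacent, four vertices suffice. Otherwise the edge `q y`
    -- is the third edge given up, and the gaps `p q` and `x y` are filled.
    go (inj₂ (p , q , hp , hq , p≢q , pq)) (inj₂ (x , y , hx , hy , x≢y , xy)) with ==-dec q y
    ... | inj₁ refl = inj₂ (two hp hy p≢q pq)
    ... | inj₂ q≢y with true⊎false (adj G q y)
    ... | inj₂ qy = inj₂ (two hq hy q≢y qy)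
    ... | inj₁ qy = inj₂ (let (up , Sp) = out hp ; (vx , Sx) = out hx ; (_ , Sy) = out hy in
            swap₃ F G u≢v uv up vx qy p≢q pq x≢y xy (free u Sp) (free v Sx) (free q Sy))

  realized : ∀ G → dg G ≗ d → Realized t d
  realized G r with saturate F d improve G r
  ... | inj₁ w = w
  ... | inj₂ (G′ , r′ , full) = G′ , r′ , clique-target G′ S (≤-reflexive (≡-sym (#-below 3t≤n)))
          (λ i j Si Sj ne → full i j (F-intro Si Sj ne))

-- Planting a fixed graph on the vertices of largest degree

-- F is K_i ∨ (K_(k-i) ∪ (3t-k) K_1) on the first 3t vertices, which are those of largest degree.
module Plant {n} (d : Fin n → ℕ) (t i k : ℕ) (i≤k : i ≤ k) (k≤3t : k ≤ 3 * t) (3t≤n : 3 * t ≤ n) where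

  C D S : Fin n → Bool
  C = below i
  D = below k
  S = below (3 * t)

  C⊆D : ∀ {a} → C a ≡ true → D a ≡ true
  C⊆D e = below-true (≤-trans (below-< e) i≤k)

  D⊆S : ∀ {a} → D a ≡ true → S a ≡ true
  D⊆S e = below-true (≤-trans (below-< e) k≤3t)

  C⊆S : ∀ {a} → C a ≡ true → S a ≡ true
  C⊆S e = D⊆S (C⊆D e)

  S-C : ∀ {a} → S a ≡ false → C a ≡ false
  S-C h = not-true λ e → true≢false (C⊆S e) h

  #C : # C ≡ i
  #C = #-below (≤-trans i≤k (≤-trans k≤3t 3t≤n))

  #S : # S ≡ 3 * t
  #S = #-below 3t≤n

  core F : Fin n → Fin n → Bool
  core a b = C a ∨ (C b ∨ (D a ∧ D b))
  F a b = not (a == b) ∧ (S a ∧ (S b ∧ core a b))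

  F-intro : ∀ {a b} → a ≢ b → S a ≡ true → S b ≡ true → core a b ≡ true → F a b ≡ true
  F-intro ne sa sb c = ∧-intro (not-intro (≢⇒== ne)) (∧-intro sa (∧-intro sb c))

  F-elim : ∀ {a b} → F a b ≡ true → a ≢ b × S a ≡ true × S b ≡ true × core a b ≡ true
  F-elim {a} {b} f =
    let (ne , f₁) = ∧-elim f ; (sa , f₂) = ∧-elim {S a} f₁ ; (sb , c) = ∧-elim {S b} f₂
    in ==⇒≢ (not-elim ne) , sa , sb , c

  core-sym : ∀ a b → core a b ≡ true → core b a ≡ true
  core-sym a b h with ∨-elim {C a} h
  ... | inj₁ e = ∨-introʳ {C b} (∨-introˡ e)
  ... | inj₂ h′ with ∨-elim {C b} h′
  ... | inj₁ e = ∨-introˡ e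
  ... | inj₂ e = ∨-introʳ {C b} (∨-introʳ {C a} (∧-intro (proj₂ (∧-elim {D a} e)) (proj₁ (∧-elim e))))

  F-sym : ∀ a b → F a b ≡ true → F b a ≡ true
  F-sym a b f = let (ne , sa , sb , c) = F-elim f in F-intro (ne ∘ ≡-sym) sb sa (core-sym a b c)

  free-F : ∀ {a b} → F a b ≡ false → Free F (a , b)
  free-F {a} {b} f = f , not-true λ e → true≢false (F-sym b a e) f

  free-S : ∀ a {b} → S b ≡ false → Free F (a , b)
  free-S a {b} h = free-F (not-true λ e → true≢false (proj₁ (proj₂ (proj₂ (F-elim e)))) h)

  C-full : ∀ {a b} → C a ≡ true → S b ≡ true → a ≢ b → F a b ≡ true
  C-full ca sb ne = F-intro ne (C⊆S ca) sb (∨-introˡ ca)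

  -- In `F` the degrees are 3t - 1 on `C`, k - 1 on the rest of `D`, and i on the rest of `S`.
  F-degree : (∀ u → C u ≡ true → 3 * t ≤ suc (d u)) → (∀ u → D u ≡ true → k ≤ suc (d u)) →
             (∀ u → S u ≡ true → i ≤ d u) → ∀ u → S u ≡ true → # (F u) ≤ d u
  F-degree hC hD hS u Su with true⊎false (C u) | true⊎false (D u)
  ... | inj₁ Cu | _ = s≤s⁻¹ (≤-trans (#-mono-< {p = F u} {S} (λ j f → proj₁ (proj₂ (proj₂ (F-elim f)))) u Fuu Su)
                        (≤-trans (≤-reflexive #S) (hC u Cu)))
    where
    Fuu : F u u ≡ false
    Fuu rewrite ==-refl u = refl
  ... | inj₂ Cu | inj₁ Du = s≤s⁻¹ (≤-trans (#-mono-< {p = F u} {D} inD u Fuu Du)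
                        (≤-trans (≤-reflexive (#-below (≤-trans k≤3t 3t≤n))) (hD u Du)))
    where
    Fuu : F u u ≡ false
    Fuu rewrite ==-refl u = refl
    inD : ∀ j → F u j ≡ true → D j ≡ true
    inD j f with ∨-elim {C u} (proj₂ (proj₂ (proj₂ (F-elim f))))
    ... | inj₁ e = ⊥-elim (true≢false e Cu)
    ... | inj₂ e with ∨-elim {C j} e
    ... | inj₁ Cj = C⊆D Cj
    ... | inj₂ e′ = proj₂ (∧-elim {D u} e′)
  ... | inj₂ Cu | inj₂ Du = ≤-trans (#-mono {p = F u} {C} inC) (≤-trans (≤-reflexive #C) (hS u Su))
    where
    inC : ∀ j → F u j ≡ true → C j ≡ true
    inC j f with ∨-elim {C u} (proj₂ (proj₂ (proj₂ (F-elim f))))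
    ... | inj₁ e = ⊥-elim (true≢false e Cu)
    ... | inj₂ e with ∨-elim {C j} e
    ... | inj₁ Cj = Cj
    ... | inj₂ e′ = ⊥-elim (true≢false (proj₁ (∧-elim e′)) Du)

  module _ (degrees : ∀ u → S u ≡ true → # (F u) ≤ d u) (G : Graph n) (r : dg G ≗ d) where

    -- `u` has at least as many neighbours in `G` as in `F`, and `v` is one in `F` only.
    spare-F : ∀ {u v} → F u v ≡ true → adj G u v ≡ false → ∃ λ z → adj G u z ≡ true × F u z ≡ false
    spare-F {u} {v} f uv = spare (adj G u) (F u)
      (≤-trans (degrees u (proj₁ (proj₂ (F-elim f)))) (≤-reflexive (≡-sym (r u)))) v f uv

    outside-C : ∀ {u z} → C u ≡ true → adj G u z ≡ true → F u z ≡ false → S z ≡ false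
    outside-C {u} {z} Cu uz f = not-true λ Sz → true≢false (C-full Cu Sz (edge-≢ G uz)) f

    spare-∉C : ∀ {u z} → S u ≡ true → adj G u z ≡ true → F u z ≡ false → C z ≡ false
    spare-∉C {u} {z} Su uz f = not-true λ Cz →
      true≢false (F-sym z u (C-full Cz Su (edge-≢ G uz ∘ ≡-sym))) f

  cover : ∀ G {u v z w} → u ≢ v → adj G u v ≡ false → adj G u z ≡ true → adj G v w ≡ true →
          Free F (u , z) → Free F (v , w) →
          Gain F G u v ⊎ (∀ a b → adj G a b ≡ true → F a b ≡ false → nbr G z a ∨ nbr G w b ≡ true)
  cover G {u} {v} {z} {w} u≢v uv uz vw fuz fvw
    with search₂ (λ a b → (adj G a b ∧ not (F a b)) ∧ not (nbr G z a ∨ nbr G w b))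
  ... | inj₂ none = inj₂ λ a b ab f → not-false λ e →
          true≢false (∧-intro (∧-intro ab (not-intro f)) (not-intro e)) (none a b)
  ... | inj₁ (a , b , h) =
    let (h₁ , h₂) = ∧-elim {adj G a b ∧ not (F a b)} h
        (za , wb) = ∨-false {nbr G z a} (not-elim h₂)
    in inj₁ (swap₃ F G u≢v uv uz vw (proj₁ (∧-elim h₁))
         (proj₂ (nbr-false {G = G} za)) (proj₁ (nbr-false {G = G} za))
         (proj₂ (nbr-false {G = G} wb)) (proj₁ (nbr-false {G = G} wb))
         fuz fvw (free-F (not-elim (proj₂ (∧-elim {adj G a b} h₁)))))

  half : Graph n → Fin n → Fin n → Fin n → Bool
  half G w a b = nbr G w a ∧ inner G C a b

  inner-sym : ∀ G a b → inner G C a b ≡ true → inner G C b a ≡ true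
  inner-sym G a b h =
    let (h₁ , cb) = ∧-elim {adj G a b ∧ not (C a)} h ; (ab , ca) = ∧-elim {adj G a b} h₁
    in ∧-intro (∧-intro (trans (sym G b a) ab) cb) ca

  -- Two weights, because a few vertices (later those of `L`) may exceed the general degree bound
  -- `B`; their excess `E` is charged separately.
  half-bound : ∀ G w (p q : Fin n → Bool) B E →
    (∀ a → C a ≡ false → nbr G w a ≡ true → dg G a ≤ χ (p a) * B + χ (q a) * E) →
    ## (half G w) ≤ # p * B + # q * E
  half-bound G w p q B E h = ##-rows (half G w) p q B E row
    where
    row : ∀ a → # (half G w a) ≤ χ (p a) * B + χ (q a) * E
    row a with true⊎false (nbr G w a) | true⊎false (C a)
    ... | inj₁ na | inj₂ ca = ≤-trans (#-mono {p = half G w a} {adj G a} λ b e →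
            proj₁ (∧-elim (proj₁ (∧-elim {adj G a b ∧ not (C a)} (proj₂ (∧-elim {nbr G w a} e)))))) (h a ca na)
    ... | inj₁ na | inj₁ ca = ≤-trans (≤-reflexive (#-zero {p = half G w a} λ b → not-true λ e →
            true≢false ca (not-elim (proj₂ (∧-elim {adj G a b} (proj₁ (∧-elim {adj G a b ∧ not (C a)} (proj₂ (∧-elim {nbr G w a} e)))))))) ) z≤n
    ... | inj₂ na | _ = ≤-trans (≤-reflexive (#-zero {p = half G w a} λ b → not-true λ e → true≢false (proj₁ (∧-elim e)) na)) z≤n

  -- The condition on `w` concerns the second coordinate; as `inner` is symmetric, transposing turns
  -- it into `half G w`. `X` collects the pairs exempt from the covering, namely edges of `F`
  -- avoiding `C`.
  halves : ∀ G z w (X : Fin n → Fin n → Bool) →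
    (∀ a b → inner G C a b ≡ true → X a b ∨ (nbr G z a ∨ nbr G w b) ≡ true) →
    ## (inner G C) ≤ ## X + (## (half G z) + ## (half G w))
  halves G z w X h = ≤-trans (##-∪ {r = inner G C} {X} {rest} first)
    (+-monoʳ-≤ (## X) (≤-trans (##-∪ {r = rest} {half G z} {λ a b → half G w b a} second)
      (+-monoʳ-≤ (## (half G z)) (≤-reflexive (≡-sym (##-flip (half G w)))))))
    where
    rest : Fin n → Fin n → Bool
    rest a b = inner G C a b ∧ (nbr G z a ∨ nbr G w b)
    first : ∀ a b → inner G C a b ≡ true → X a b ∨ rest a b ≡ true
    first a b e with ∨-elim {X a b} (h a b e)
    ... | inj₁ x = ∨-introˡ x
    ... | inj₂ y = ∨-introʳ {X a b} (∧-intro e y)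
    second : ∀ a b → rest a b ≡ true → half G z a b ∨ half G w b a ≡ true
    second a b e with ∨-elim {nbr G z a} (proj₂ (∧-elim {inner G C a b} e))
    ... | inj₁ x = ∨-introˡ (∧-intro x (proj₁ (∧-elim e)))
    ... | inj₂ y = ∨-introʳ {half G z a b} (∧-intro y (inner-sym G a b (proj₁ (∧-elim e))))

-- The common form of the numerical contradictions: naming the slack `c` turns a polynomial
-- inequality into an identity for the ring solver.
overshoot : ∀ {a b} c → a ≤ b → a ≡ suc (b + c) → ⊥
overshoot {a} {b} c h e = <-irrefl refl (≤-trans (s≤s (m≤m+n b c)) (≤-trans (≤-reflexive (≡-sym e)) h))

-- At least 2t − 1 vertices of degree at least 3t − 1

-- Here t = s + 1. First the first 2t − 1 vertices (the rows C) are joined to all of S; then an edge is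
-- found between two vertices outside C that are joined to all of C.
module Rich {n} (d : Fin n → ℕ) (s : ℕ) (3t≤n : 3 * suc s ≤ n)
  (mono : ∀ a b → toℕ a ≤ toℕ b → d b ≤ d a)
  (rows : ∀ a → toℕ a < suc (2 * s) → 3 * suc s ≤ suc (d a))
  (top : ∀ a → toℕ a < 3 * suc s → suc (2 * s) ≤ d a)
  (low : ∀ a → 3 * suc s ≤ toℕ a → d a ≤ 6 * s + 3)
  (big : 20 * (suc s * suc s) ≤ n + suc s)
  (sum : 4 * suc s * n + 2 * suc s < ∑ d + 2 * n + 4 * (suc s * suc s)) where

  t i : ℕ
  t = suc s
  i = suc (2 * s)

  i≤3t : i ≤ 3 * t
  i≤3t = ≤-trans (m≤m+n i (s + 2)) (≤-reflexive (arith s))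
    where
    arith : ∀ s → suc (2 * s) + (s + 2) ≡ 3 * suc s
    arith = solve-∀

  open Plant d t i i ≤-refl i≤3t 3t≤n

  L O : Fin n → Bool
  L a = S a ∧ not (C a)
  O a = not (S a)

  #L : # L ≡ s + 2
  #L = +-cancelˡ-≡ i (# L) (s + 2) (trans (cong (_+ # L) (≡-sym (trans S∧C #C)))
         (trans (≡-sym (#-split S C)) (trans #S (arith s))))
    where
    S∧C : # (λ a → S a ∧ C a) ≡ # C
    S∧C = ≤-antisym (#-mono {p = λ a → S a ∧ C a} {C} λ a e → proj₂ (∧-elim {S a} e))
                    (#-mono {p = C} {λ a → S a ∧ C a} λ a e → ∧-intro (C⊆S e) e)
    arith : ∀ s → 3 * suc s ≡ suc (2 * s) + (s + 2)
    arith = solve-∀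

  o : ℕ
  o = # O

  3t+o : 3 * t + o ≡ n
  3t+o = trans (cong (_+ o) (≡-sym #S)) (#-complement S)

  o-large : 20 * (s * s) + 36 * s + 16 ≤ o
  o-large = +-cancelʳ-≤ (4 * s + 4) _ _ (≤-trans (≤-reflexive (arith₁ s)) (≤-trans big
    (≤-reflexive (trans (cong (_+ suc s) (≡-sym 3t+o)) (arith₂ s o)))))
    where
    arith₁ : ∀ s → 20 * (s * s) + 36 * s + 16 + (4 * s + 4) ≡ 20 * (suc s * suc s)
    arith₁ = solve-∀
    arith₂ : ∀ s o → 3 * suc s + o + suc s ≡ o + (4 * s + 4)
    arith₂ = solve-∀

  degrees : ∀ u → S u ≡ true → # (F u) ≤ d u
  degrees = F-degree (λ u e → rows u (below-< e)) (λ u e → m≤n⇒m≤1+n (top u (≤-trans (below-< e) i≤3t)))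
                     (λ u e → top u (below-< e))

  F-false : ∀ {a b} → C a ≡ false → C b ≡ false → F a b ≡ false
  F-false {a} {b} ca cb = not-true λ f → absurd (proj₂ (proj₂ (proj₂ (F-elim f))))
    where
    absurd : core a b ≡ true → ⊥
    absurd rewrite ca | cb = λ ()

  mono-C : ∀ {c a} → C c ≡ true → C a ≡ false → d a ≤ d c
  mono-C cc ca = mono _ _ (≤-trans (<⇒≤ (below-< cc)) (below-≥ ca))

  Complete : Graph n → Fin n → Set
  Complete G a = ∀ c → C c ≡ true → adj G c a ≡ true

  Full : Graph n → Set
  Full G = ∀ a b → F a b ≡ true → adj G a b ≡ true

  L-elim : ∀ {a} → L a ≡ true → S a ≡ true × C a ≡ false
  L-elim {a} e = proj₁ (∧-elim e) , not-elim (proj₂ (∧-elim {S a} e))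

  full-complete : ∀ {G} → Full G → ∀ {a} → L a ≡ true → Complete G a
  full-complete full e c Cc = full c _ (C-full Cc (proj₁ (L-elim e)) λ { refl → true≢false Cc (proj₂ (L-elim e)) })

  -- The edge is the K_2 of the target. Removing its ends costs at most two of the t + 1 vertices of
  -- `L`, so s = t - 1 remain, and (2t - 1) + 2 + (t - 1) exceeds 3t - 1.
  edge-target : ∀ {G a b} → Full G → C a ≡ false → C b ≡ false → Complete G a → Complete G b →
                adj G a b ≡ true → Target t G
  edge-target {G} {a} {b} full Ca Cb Ga Gb ab = record
    { C = C ; Q = Q ; I = J ; s = s
    ; C-Q = λ c Cc → not-true λ e → true≢false Cc (Q-case {λ j → C j ≡ false} Ca Cb c e)
    ; I-CQ = λ j e → cong₂ _∨_ (proj₂ (L-elim (proj₁ (∧-elim e)))) (not-elim (proj₂ (∧-elim {L j} e)))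
    ; s≤#I = +-cancelʳ-≤ 2 s (# J) (≤-trans (≤-reflexive (≡-sym #L)) (≤-trans (#-∪ {p = L} {J} {Q} part)
               (+-monoʳ-≤ (# J) (≤-reflexive #Q))))
    ; 2s≤#C = ≤-trans (n≤1+n _) (≤-reflexive (≡-sym #C))
    ; s≤t = n≤1+n s
    ; total = ≤-reflexive (trans (arith s) (≡-sym (cong₂ (λ x y → x + y + s) #C #Q)))
    ; clique = clique
    ; complete = λ c j Cc e → full-complete {G} full (proj₁ (∧-elim e)) c Cc }
    where
    Q J : Fin n → Bool
    Q j = (j == a) ∨ (j == b)
    J j = L j ∧ not (Q j)
    #Q : # Q ≡ 2
    #Q = trans (#-insert {p = _== a} b (≢⇒== (edge-≢ G ab ∘ ≡-sym))) (cong suc (#-single a))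
    Q-case : ∀ {P : Fin n → Set} → P a → P b → ∀ j → Q j ≡ true → P j
    Q-case pa pb j e with ∨-elim e
    ... | inj₁ k rewrite ==⇒≡ k = pa
    ... | inj₂ k rewrite ==⇒≡ k = pb
    part : ∀ j → L j ≡ true → J j ∨ Q j ≡ true
    part j e with true⊎false (Q j)
    ... | inj₁ q = ∨-introʳ {J j} q
    ... | inj₂ q = ∨-introˡ (∧-intro e (not-intro q))
    arith : ∀ s → 3 * suc s ≡ suc (2 * s) + 2 + s
    arith = solve-∀
    Q-complete : ∀ j → Q j ≡ true → Complete G j
    Q-complete = Q-case {Complete G} Ga Gb
    clique : ∀ j k → C j ∨ Q j ≡ true → C k ∨ Q k ≡ true → j ≢ k → adj G j k ≡ true
    clique j k hj hk ne with ∨-elim {C j} hj | ∨-elim {C k} hk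
    ... | inj₁ Cj | inj₁ Ck = full j k (C-full Cj (C⊆S Ck) ne)
    ... | inj₁ Cj | inj₂ Qk = Q-complete k Qk j Cj
    ... | inj₂ Qj | inj₁ Ck = trans (sym G j k) (Q-complete j Qj k Ck)
    ... | inj₂ Qj | inj₂ Qk with ∨-elim Qj | ∨-elim Qk
    ... | inj₁ p | inj₁ q = ⊥-elim (ne (trans (==⇒≡ p) (≡-sym (==⇒≡ q))))
    ... | inj₂ p | inj₂ q = ⊥-elim (ne (trans (==⇒≡ p) (≡-sym (==⇒≡ q))))
    ... | inj₁ p | inj₂ q rewrite ==⇒≡ p | ==⇒≡ q = ab
    ... | inj₂ p | inj₁ q rewrite ==⇒≡ p | ==⇒≡ q = trans (sym G b a) ab

  -- Exchanges in a fixed realization, and the count when they fail.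

  module _ (G : Graph n) (r : dg G ≗ d) where

    Z : Fin n → Fin n → Bool
    Z b j = adj G b j ∧ not (S j)

    Z-intro : ∀ {b j} → adj G b j ≡ true → S j ≡ false → Z b j ≡ true
    Z-intro bj sj = ∧-intro bj (not-intro sj)

    Z-elim : ∀ {b j} → Z b j ≡ true → adj G b j ≡ true × S j ≡ false
    Z-elim {b} {j} e = proj₁ (∧-elim e) , not-elim (proj₂ (∧-elim {adj G b j} e))

    low-nbr : ∀ {w} → S w ≡ false → # (nbr G w) ≤ 6 * s + 4
    low-nbr {w} sw = ≤-trans (≤-reflexive (trans (#-nbr G w) (cong suc (r w))))
      (≤-trans (s≤s (low w (below-≥ sw))) (≤-reflexive (≡-sym (+-suc (6 * s) 3))))

    row-degree : ∀ {b h} → C b ≡ true → # (Z b) ≤ h → d b < h + 3 * t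
    row-degree {b} {h} Cb k = ≤-trans (s≤s (≤-reflexive (trans (≡-sym (r b)) (trans (#-split (adj G b) S) (+-comm _ (# (Z b)))))))
      (≤-trans (≤-reflexive (≡-sym (+-suc (# (Z b)) _))) (+-mono-≤ k (≤-trans
        (#-mono-< {p = λ j → adj G b j ∧ S j} {S} (λ j e → proj₂ (∧-elim {adj G b j} e)) b
          (∧-falseˡ (S b) (irrefl G b)) (C⊆S Cb)) (≤-reflexive #S))))

    -- For |C| = 2t - 1 the degree sum of the join in `inner-lower-bound` is precisely the
    -- threshold, so the strict excess is passed on undiminished.
    inner-large : 1 + 2 * ## (outer G C) ≤ ## (inner G C)
    inner-large = +-cancelʳ-≤ X _ _ (≤-trans (≤-reflexive (arith₁ s l M (∑ d)))
      (≤-trans (+-mono-≤ sum′ bound) (≤-reflexive (arith₂ s l I (∑ d)))))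
      where
      l M I X : ℕ
      l = # (not ∘ C)
      M = ## (outer G C)
      I = ## (inner G C)
      X = ∑ d + (4 * suc s * (suc (2 * s) + l) + 2 * suc s) + suc (2 * s)
      n≡ : n ≡ suc (2 * s) + l
      n≡ = trans (≡-sym (#-complement C)) (cong (_+ l) #C)
      sum′ : suc (4 * suc s * (suc (2 * s) + l) + 2 * suc s) ≤ ∑ d + 2 * (suc (2 * s) + l) + 4 * (suc s * suc s)
      sum′ = subst (λ m → 4 * suc s * m + 2 * suc s < ∑ d + 2 * m + 4 * (suc s * suc s)) n≡ sum
      bound : ∑ d + 2 * M + suc (2 * s) ≤ I + 2 * (suc (2 * s) * l) + suc (2 * s) * suc (2 * s)
      bound = subst (λ c → ∑ d + 2 * M + c ≤ I + 2 * (c * l) + c * c) #C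
        (subst (λ x → x + 2 * M + # C ≤ I + 2 * (# C * l) + # C * # C) (sum-cong-≗ r) (inner-lower-bound G C))
      arith₁ : ∀ s l M D → 1 + 2 * M + (D + (4 * suc s * (suc (2 * s) + l) + 2 * suc s) + suc (2 * s))
             ≡ suc (4 * suc s * (suc (2 * s) + l) + 2 * suc s) + (D + 2 * M + suc (2 * s))
      arith₁ = solve-∀
      arith₂ : ∀ s l I D →
        (D + 2 * (suc (2 * s) + l) + 4 * (suc s * suc s)) + (I + 2 * (suc (2 * s) * l) + suc (2 * s) * suc (2 * s))
        ≡ I + (D + (4 * suc s * (suc (2 * s) + l) + 2 * suc s) + suc (2 * s))
      arith₂ = solve-∀

    outer-large : ∀ (R : Fin n → Bool) h → (∀ b → R b ≡ true → C b ≡ true) → (∀ b → R b ≡ true → # (Z b) ≤ h) →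
                  # R * o ≤ ## (outer G C) + # R * h
    outer-large R h R⊆C few = ≤-trans (≤-reflexive (≡-sym (∑-*ʳ (χ ∘ R) o)))
      (≤-trans (∑-mono row) (≤-reflexive (trans (∑-distrib-+ (λ b → # (outer G C b)) (λ b → χ (R b) * h))
        (cong (## (outer G C) +_) (∑-*ʳ (χ ∘ R) h)))))
      where
      row : ∀ b → χ (R b) * o ≤ # (outer G C b) + χ (R b) * h
      row b with true⊎false (R b)
      ... | inj₂ e rewrite e = z≤n
      ... | inj₁ e rewrite e = ≤-trans (≤-reflexive (+-identityʳ o))
          (≤-trans (#-∪ {p = O} {outer G C b} {Z b} part) (+-monoʳ-≤ (# (outer G C b)) (≤-trans (few b e) (≤-reflexive (≡-sym (+-identityʳ h))))))
        where
        part : ∀ j → O j ≡ true → outer G C b j ∨ Z b j ≡ true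
        part j oj with true⊎false (adj G b j)
        ... | inj₁ bj = ∨-introʳ {outer G C b j} (∧-intro bj oj)
        ... | inj₂ bj = ∨-introˡ (∧-intro (∧-intro (R⊆C b e) (not-intro (S-C (not-elim oj)))) (not-intro bj))

    Covered : Fin n → Fin n → Set
    Covered z w = ∀ a b → adj G a b ≡ true → F a b ≡ false → nbr G z a ∨ nbr G w b ≡ true

    inner-bound : ∀ {z w} → Covered z w → ## (inner G C) ≤ ## (half G z) + ## (half G w)
    inner-bound {z} {w} cov = ≤-trans (halves G z w (λ _ _ → false) λ a b e →
        let (e₁ , cb) = ∧-elim {adj G a b ∧ not (C a)} e ; (ab , ca) = ∧-elim {adj G a b} e₁
        in cov a b ab (F-false (not-elim ca) (not-elim cb)))
      (≤-reflexive (cong (_+ (## (half G z) + ## (half G w))) none))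
      where
      none : ## {n} {n} (λ _ _ → false) ≡ 0
      none = ##-zero {n} {n} {λ _ _ → false} λ _ _ → refl

    -- Degrees are non-increasing, so the short row `u` bounds those outside `C` by 9s + 7. Outside
    -- `S` the bound 6s + 3 is better; the difference 3s + 4 is charged to the s + 2 vertices of `L`
    -- only.
    half-poor : ∀ {u w} → C u ≡ true → # (Z u) ≤ 6 * s + 4 → S w ≡ false →
                ## (half G w) ≤ (6 * s + 4) * (6 * s + 3) + (s + 2) * (3 * s + 4)
    half-poor {u} {w} Cu few Sw = ≤-trans (half-bound G w (nbr G w) L (6 * s + 3) (3 * s + 4) row)
      (+-mono-≤ (*-monoˡ-≤ (6 * s + 3) (low-nbr Sw)) (≤-reflexive (cong (_* (3 * s + 4)) #L)))
      where
      arith : ∀ s → 6 * s + 4 + 3 * suc s ≡ 1 * (6 * s + 3) + 1 * (3 * s + 4)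
      arith = solve-∀
      row : ∀ a → C a ≡ false → nbr G w a ≡ true → dg G a ≤ χ (nbr G w a) * (6 * s + 3) + χ (L a) * (3 * s + 4)
      row a ca na rewrite na | ca with true⊎false (S a)
      ... | inj₁ sa rewrite sa = ≤-trans (≤-reflexive (r a)) (≤-trans (mono-C Cu ca)
              (≤-trans (<⇒≤ (row-degree Cu few)) (≤-reflexive (arith s))))
      ... | inj₂ sa rewrite sa = ≤-trans (≤-reflexive (r a)) (≤-trans (low a (below-≥ sa))
              (≤-reflexive (≡-sym (trans (+-identityʳ _) (+-identityʳ _)))))

    -- Both rows miss all but 6s + 4 of the `o` vertices outside `S`, and the edges these missing
    -- pairs force no longer fit into the two neighbourhoods.
    poor-absurd : ∀ {u b z w} → C u ≡ true → C b ≡ true → u ≢ b → # (Z u) ≤ 6 * s + 4 → # (Z b) ≤ 6 * s + 4 →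
                  S z ≡ false → S w ≡ false → Covered z w → ⊥
    poor-absurd {u} {b} {z} {w} Cu Cb u≢b hu hb Sz Sw cov = overshoot (2 * (s * s) + 16 * s + 8) chain (arith₃ s)
      where
      M I H : ℕ
      M = ## (outer G C)
      I = ## (inner G C)
      H = (6 * s + 4) * (6 * s + 3) + (s + 2) * (3 * s + 4)
      pair : Fin n → Bool
      pair j = (j == u) ∨ (j == b)
      #pair : # pair ≡ 2
      #pair = trans (#-insert {p = _== u} b (≢⇒== (u≢b ∘ ≡-sym))) (cong suc (#-single u))
      pair-case : ∀ {P : Fin n → Set} → P u → P b → ∀ j → pair j ≡ true → P j
      pair-case pu pb j e with ∨-elim e
      ... | inj₁ k rewrite ==⇒≡ k = pu
      ... | inj₂ k rewrite ==⇒≡ k = pb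
      missing : 2 * o ≤ M + 2 * (6 * s + 4)
      missing = subst (λ x → x * o ≤ M + x * (6 * s + 4)) #pair (outer-large pair (6 * s + 4)
        (pair-case {λ j → C j ≡ true} Cu Cb) (pair-case {λ j → # (Z j) ≤ 6 * s + 4} hu hb))
      upper : I ≤ H + H
      upper = ≤-trans (inner-bound cov) (+-mono-≤ (half-poor Cu hu Sz) (half-poor Cu hu Sw))
      open ≤-Reasoning
      arith₁ : ∀ M s → 1 + 2 * (M + 2 * (6 * s + 4)) ≡ 1 + 2 * M + (24 * s + 16)
      arith₁ = solve-∀
      chain : 1 + 2 * (2 * (20 * (s * s) + 36 * s + 16)) ≤ H + H + (24 * s + 16)
      chain = begin
        1 + 2 * (2 * (20 * (s * s) + 36 * s + 16)) ≤⟨ +-monoʳ-≤ 1 (*-monoʳ-≤ 2 (*-monoʳ-≤ 2 o-large)) ⟩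
        1 + 2 * (2 * o)                            ≤⟨ +-monoʳ-≤ 1 (*-monoʳ-≤ 2 missing) ⟩
        1 + 2 * (M + 2 * (6 * s + 4))              ≡⟨ arith₁ M s ⟩
        1 + 2 * M + (24 * s + 16)                  ≤⟨ +-monoˡ-≤ (24 * s + 16) (≤-trans inner-large upper) ⟩
        H + H + (24 * s + 16)                      ∎
      arith₃ : ∀ s → 1 + 2 * (2 * (20 * (s * s) + 36 * s + 16)) ≡
        suc (((6 * s + 4) * (6 * s + 3) + (s + 2) * (3 * s + 4)) + ((6 * s + 4) * (6 * s + 3) + (s + 2) * (3 * s + 4))
             + (24 * s + 16) + (2 * (s * s) + 16 * s + 8))
      arith₃ = solve-∀

    -- In the first case `b x` can be given up, with `w x` as a new edge. In the second case `b` is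
    -- short, provided that `w` itself has small degree.
    escape : ∀ b w → (∃ λ x → adj G b x ≡ true × S x ≡ false × w ≢ x × adj G w x ≡ false)
                   ⊎ (∀ x → Z b x ≡ true → nbr G w x ≡ true)
    escape b w with search (λ x → Z b x ∧ not (nbr G w x))
    ... | inj₂ none = inj₂ λ x e → not-false λ f → true≢false (∧-intro e (not-intro f)) (none x)
    ... | inj₁ (x , e) =
      let (bx , sx) = Z-elim {b} {x} (proj₁ (∧-elim e)) ; (wx , ne) = nbr-false {G = G} (not-elim (proj₂ (∧-elim {Z b x} e)))
      in inj₁ (x , bx , sx , ne , wx)

    short : ∀ {b w} → S w ≡ false → (∀ x → Z b x ≡ true → nbr G w x ≡ true) → # (Z b) ≤ 6 * s + 4
    short Sw h = ≤-trans (#-mono h) (low-nbr Sw)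

    free-C : ∀ {v b} → C v ≡ false → C b ≡ false → Free F (v , b)
    free-C cv cb = free-F (F-false cv cb)

    -- If nothing works then w is adjacent to all of Z u. As d z ≤ d v, some neighbour b of v is not adjacent
    -- to z; it is a row, and short for the same reason. Two short rows force too many edges outside C.
    improve-poor : ∀ {u v w} → C u ≡ true → S v ≡ true → u ≢ v → adj G u v ≡ false →
                   adj G v w ≡ true → S w ≡ false → Gain F G u v
    improve-poor {u} {v} {w} Cu Sv u≢v uv vw Sw = first (spare-F degrees G r (C-full Cu Sv u≢v) uv)
      where
      first : (∃ λ z → adj G u z ≡ true × F u z ≡ false) → Gain F G u v
      first (z , uz , fz) = second (escape u w)
        where
        Sz : S z ≡ false
        Sz = outside-C degrees G r Cu uz fz
        Second : Set
        Second = Gain F G u v ⊎ (∃ λ b → C b ≡ true × u ≢ b × # (Z b) ≤ 6 * s + 4)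
        other : Second
        other with true⊎false (C v)
        -- If `v` is a row too, it is its own candidate for the second short row, measured against
        -- `z` instead of `w`.
        ... | inj₁ Cv with escape v z
        ... | inj₁ (x , vx , Sx , z≢x , zx) = inj₁ (swap₂ F G u≢v uv uz vx z≢x zx (free-S u Sz) (free-S v Sx))
        ... | inj₂ h = inj₂ (v , Cv , u≢v , short Sz h)
        other | inj₂ Cv = row (exchange G {u} {v} {z}
            (≤-trans (≤-reflexive (r z)) (≤-trans (mono v z (≤-trans (<⇒≤ (below-< Sv)) (below-≥ Sz))) (≤-reflexive (≡-sym (r v)))))
            (trans (sym G z u) uz) (trans (sym G v u) uv) u≢v)
          where
          row : (∃ λ b → adj G v b ≡ true × adj G z b ≡ false × z ≢ b) → Second
          row (b , vb , zb , z≢b) with true⊎false (C b)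
          ... | inj₂ Cb = inj₁ (swap₂ F G u≢v uv uz vb z≢b zb (free-S u Sz) (free-C Cv Cb))
          ... | inj₁ Cb with escape b w
          ... | inj₁ (x , bx , Sx , w≢x , wx) =
                inj₁ (swap₃ F G u≢v uv uz vw bx z≢b zb w≢x wx (free-S u Sz) (free-S v Sw) (free-S b Sx))
          ... | inj₂ h = inj₂ (b , Cb , (λ { refl → true≢false (trans (sym G z u) uz) zb }) , short Sw h)
        second : _ → Gain F G u v
        second (inj₁ (x , ux , Sx , w≢x , wx)) =
          swap₂ F G u≢v uv ux vw (w≢x ∘ ≡-sym) (trans (sym G x w) wx) (free-S u Sx) (free-S v Sw)
        second (inj₂ h) with other
        ... | inj₁ g = g
        ... | inj₂ (b , Cb , u≢b , hb) with cover G u≢v uv uz vw (free-S u Sz) (free-S v Sw)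
        ... | inj₁ g = g
        ... | inj₂ cov = ⊥-elim (poor-absurd Cu Cb u≢b (short Sw h) hb Sz Sw cov)

    tame : Fin n → Fin n → Bool
    tame w b = C b ∧ empty (λ x → Z b x ∧ not (nbr G w x))

    tame-elim : ∀ {w b} → tame w b ≡ true → C b ≡ true × (∀ x → Z b x ≡ true → nbr G w x ≡ true)
    tame-elim {w} {b} e = proj₁ (∧-elim e) , λ x zx → not-false λ f → true≢false (∧-intro zx (not-intro f))
      (empty-true (λ x → Z b x ∧ not (nbr G w x)) (proj₂ (∧-elim {C b} e)) x)

    tame-intro : ∀ {w b} → C b ≡ true → (∀ x → Z b x ≡ true → nbr G w x ≡ true) → tame w b ≡ true
    tame-intro {w} {b} Cb h = ∧-intro Cb (not-false λ f →
      let (x , e) = empty-false (λ x → Z b x ∧ not (nbr G w x)) f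
      in true≢false (h x (proj₁ (∧-elim e))) (not-elim (proj₂ (∧-elim {Z b x} e))))

    -- Outside S the tame rows and w have almost the same neighbours: far-few. Each vertex of Z u is missed
    -- by one of the k other tame rows, so w and all tame rows have few neighbours outside S, and the pairs
    -- missing at these rows force too many edges outside C.
    rich-absurd : ∀ {u z w} → C u ≡ true → S w ≡ true → C w ≡ false → Z u z ≡ true →
                  (∀ c → C c ≡ true → adj G c w ≡ true) →
                  (∀ x → Z u x ≡ true → nbr G w x ≡ true) →
                  (∀ y → Z u y ≡ true → ∃ λ b → tame w b ≡ true × b ≢ u × adj G y b ≡ false) →
                  Covered z w → ⊥
    rich-absurd {u} {z} {w} Cu Sw Cw Zuz complete Zu⊆ gap cov = count k refl
      where
      R′ : Fin n → Bool
      R′ b = tame w b ∧ not (b == u)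
      far : Fin n → Fin n → Bool
      far b y = nbr G w y ∧ not (nbr G b y)
      outN : Fin n → Bool
      outN y = nbr G w y ∧ not (S y)
      k : ℕ
      k = # R′
      tame-u : tame w u ≡ true
      tame-u = tame-intro Cu Zu⊆
      #R : suc k ≡ # (tame w)
      #R = #-remove (tame w) u tame-u

      -- As d w ≤ d b, `w` has no more private neighbours than `b`. Those of `b` lie in `L` without
      -- `w`, a set of t vertices: tameness excludes them outside `S`, and `w` is adjacent to all of
      -- `C`.
      far-few : ∀ b → tame w b ≡ true → # (far b) ≤ t
      far-few b e = s≤s⁻¹ (≤-trans (s≤s (≤-trans cancel back)) bound)
        where
        Cb = proj₁ (tame-elim e)
        common : Fin n → Bool
        common y = nbr G w y ∧ nbr G b y
        farb : Fin n → Bool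
        farb y = nbr G b y ∧ not (nbr G w y)
        sizes : # (nbr G w) ≤ # (nbr G b)
        sizes = ≤-trans (≤-reflexive (trans (#-nbr G w) (cong suc (r w))))
          (≤-trans (s≤s (mono-C Cb Cw)) (≤-reflexive (≡-sym (trans (#-nbr G b) (cong suc (r b))))))
        cancel : # (far b) ≤ # farb
        cancel = +-cancelˡ-≤ (# common) _ _ (≤-trans (≤-reflexive (≡-sym (#-split (nbr G w) (nbr G b))))
          (≤-trans sizes (≤-reflexive (trans (#-split (nbr G b) (nbr G w)) (cong (_+ # farb)
            (#-cong λ y → ∧-comm (nbr G b y) (nbr G w y)))))))
        L∖w : Fin n → Bool
        L∖w y = L y ∧ not (y == w)
        inside : ∀ y → farb y ≡ true → L∖w y ≡ true
        inside y f = ∧-intro (∧-intro Sy (not-intro Cy)) (not-intro (≢⇒== (w≢y ∘ ≡-sym)))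
          where
          by = proj₁ (∧-elim f)
          wy = proj₁ (nbr-false {G = G} (not-elim (proj₂ (∧-elim {nbr G b y} f))))
          w≢y = proj₂ (nbr-false {G = G} (not-elim (proj₂ (∧-elim {nbr G b y} f))))
          Cy : C y ≡ false
          Cy = not-true λ cy → true≢false (trans (sym G w y) (complete y cy)) wy
          b~y : adj G b y ≡ true
          b~y with ∨-elim by
          ... | inj₁ a = a
          ... | inj₂ a = ⊥-elim (true≢false (trans (cong C (==⇒≡ a)) Cb) Cy)
          Sy : S y ≡ true
          Sy = not-false λ sy → true≢false (proj₂ (tame-elim e) y (Z-intro b~y sy)) (not-elim (proj₂ (∧-elim {nbr G b y} f)))
        back : # farb ≤ # L∖w
        back = #-mono inside
        bound : suc (# L∖w) ≤ suc t
        bound = ≤-reflexive (trans (#-remove L w (∧-intro Sw (not-intro Cw))) (trans #L (+-comm s 2)))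

      Zu-few : # (Z u) ≤ k * t
      Zu-few = ≤-trans (∑-mono each) (≤-trans (≤-reflexive (≡-sym (##-flip pairs))) (##-rows₁ pairs R′ t
          (λ b e → ≤-trans (#-mono {p = pairs b} {far b} λ y f → proj₂ (∧-elim {R′ b} f)) (far-few b (proj₁ (∧-elim e))))
          (λ b y f → proj₁ (∧-elim f))))
        where
        pairs : Fin n → Fin n → Bool
        pairs b y = R′ b ∧ far b y
        each : ∀ y → χ (Z u y) ≤ # (λ b → pairs b y)
        each y with true⊎false (Z u y)
        ... | inj₂ e rewrite e = z≤n
        ... | inj₁ e with gap y e
        ... | b , tb , b≢u , yb = ≤-trans (≤-reflexive (trans (cong χ e) (≡-sym (cong χ hit)))) (∑-term (λ b → χ (pairs b y)) b)
          where
          b≁y : nbr G b y ≡ false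
          b≁y = cong₂ _∨_ (trans (sym G b y) yb) (≢⇒== λ { refl → true≢false (C⊆S (proj₁ (tame-elim tb))) (proj₂ (Z-elim {u} {y} e)) })
          hit : pairs b y ≡ true
          hit = ∧-intro (∧-intro tb (not-intro (≢⇒== b≢u))) (∧-intro (Zu⊆ y e) (not-intro b≁y))

      outN-few : # outN ≤ suc k * t
      outN-few = ≤-trans (#-∪ {p = outN} {far u} {Z u} part) (+-mono-≤ (far-few u tame-u) Zu-few)
        where
        part : ∀ y → outN y ≡ true → far u y ∨ Z u y ≡ true
        part y e with true⊎false (adj G u y)
        ... | inj₁ uy = ∨-introʳ {far u y} (∧-intro uy (proj₂ (∧-elim {nbr G w y} e)))
        ... | inj₂ uy = ∨-introˡ {far u y} {Z u y} (∧-intro {nbr G w y} {not (nbr G u y)} (proj₁ (∧-elim e)) (not-intro (cong₂ _∨_ uy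
                (≢⇒== λ { refl → true≢false (C⊆S Cu) (not-elim (proj₂ (∧-elim {nbr G w y} e))) }))))

      M I Δ : ℕ
      M = ## (outer G C)
      I = ## (inner G C)
      Δ = k * t + 3 * t

      missing : suc k * o ≤ M + suc k * (suc k * t)
      missing = subst (λ x → x * o ≤ M + x * (suc k * t)) (≡-sym #R) (outer-large (tame w) (suc k * t)
        (λ b e → proj₁ (tame-elim e))
        (λ b e → ≤-trans (#-mono {p = Z b} {outN} λ y f → ∧-intro (proj₂ (tame-elim e) y f) (proj₂ (∧-elim {adj G b y} f))) outN-few))

      -- Bounding one factor of K²t by the number of rows keeps the final inequality linear in K,
      -- with a slack that has nonnegative coefficients.
      k-small : suc k ≤ suc (2 * s)
      k-small = ≤-trans (≤-reflexive #R) (≤-trans (#-mono {p = tame w} {C} λ b e → proj₁ (∧-elim e)) (≤-reflexive #C))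

      L-degree : ∀ {a} → C a ≡ false → d a ≤ Δ
      L-degree ca = ≤-trans (mono-C Cu ca) (<⇒≤ (row-degree Cu Zu-few))

      bounded : ∀ (p : Fin n → Bool) a → C a ≡ false → (S a ≡ false → p a ≡ true) →
                dg G a ≤ χ (p a) * (6 * s + 3) + χ (L a) * Δ
      bounded p a ca h rewrite ca with true⊎false (S a)
      ... | inj₁ sa rewrite sa = ≤-trans (≤-reflexive (r a)) (≤-trans (L-degree ca)
              (≤-trans (≤-reflexive (≡-sym (+-identityʳ Δ))) (m≤n+m (Δ + 0) (χ (p a) * (6 * s + 3)))))
      ... | inj₂ sa rewrite sa | h refl = ≤-trans (≤-reflexive (r a)) (≤-trans (low a (below-≥ sa))
              (≤-reflexive (≡-sym (trans (+-identityʳ _) (+-identityʳ _)))))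

      half-z : ## (half G z) ≤ (6 * s + 4) * (6 * s + 3) + (s + 2) * Δ
      half-z = ≤-trans (half-bound G z (nbr G z) L (6 * s + 3) Δ (λ a ca na → bounded (nbr G z) a ca λ _ → na))
        (+-mono-≤ (*-monoˡ-≤ (6 * s + 3) (low-nbr (proj₂ (Z-elim {u} {z} Zuz)))) (≤-reflexive (cong (_* Δ) #L)))

      half-w : ## (half G w) ≤ suc k * t * (6 * s + 3) + (s + 2) * Δ
      half-w = ≤-trans (half-bound G w outN L (6 * s + 3) Δ
          (λ a ca na → bounded outN a ca λ sa → ∧-intro na (not-intro sa)))
        (+-mono-≤ (*-monoˡ-≤ (6 * s + 3) outN-few) (≤-reflexive (cong (_* Δ) #L)))

      count : ∀ m → m ≡ k → ⊥
      count zero    e = <-irrefl e (≤-trans (≤-reflexive (≡-sym (cong χ R′b))) (∑-term (χ ∘ R′) b))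
        where
        b = proj₁ (gap z Zuz)
        R′b : R′ b ≡ true
        R′b = ∧-intro (proj₁ (proj₂ (gap z Zuz))) (not-intro (≢⇒== (proj₁ (proj₂ (proj₂ (gap z Zuz))))))
      -- The leading terms are 40K against 40 + 12K, times s². This needs K ≥ 2, that is, the second
      -- tame row that `gap` supplies.
      count (suc j) e = overshoot (16 * (s * s) + 48 * s + 26 + j * (28 * (s * s) + 51 * s + 23)) chain (arith₃ s j)
        where
        K : ℕ
        K = suc (suc j)
        K≡ : suc k ≡ K
        K≡ = cong suc (≡-sym e)
        Δ′ H : ℕ
        Δ′ = suc j * suc s + 3 * suc s
        H = ((6 * s + 4) * (6 * s + 3) + (s + 2) * Δ′) + (K * suc s * (6 * s + 3) + (s + 2) * Δ′)
        Δ≡ : Δ ≡ Δ′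
        Δ≡ = cong (λ x → x * t + 3 * t) (≡-sym e)
        upper : I ≤ H
        upper = ≤-trans (inner-bound cov) (+-mono-≤
          (≤-trans half-z (≤-reflexive (cong (λ x → (6 * s + 4) * (6 * s + 3) + (s + 2) * x) Δ≡)))
          (≤-trans half-w (≤-reflexive (cong₂ (λ y x → y * t * (6 * s + 3) + (s + 2) * x) K≡ Δ≡))))
        missing′ : K * o ≤ M + K * (K * suc s)
        missing′ = subst (λ x → x * o ≤ M + x * (x * t)) K≡ missing
        K≤ : K ≤ suc (2 * s)
        K≤ = ≤-trans (≤-reflexive (≡-sym K≡)) k-small
        open ≤-Reasoning
        arith₁ : ∀ M x → 1 + 2 * (M + x) ≡ 1 + 2 * M + 2 * x
        arith₁ = solve-∀
        chain : 1 + 2 * (K * (20 * (s * s) + 36 * s + 16)) ≤ H + 2 * (K * (suc (2 * s) * suc s))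
        chain = begin
          1 + 2 * (K * (20 * (s * s) + 36 * s + 16)) ≤⟨ +-monoʳ-≤ 1 (*-monoʳ-≤ 2 (*-monoʳ-≤ K o-large)) ⟩
          1 + 2 * (K * o)                            ≤⟨ +-monoʳ-≤ 1 (*-monoʳ-≤ 2 missing′) ⟩
          1 + 2 * (M + K * (K * suc s))              ≡⟨ arith₁ M (K * (K * suc s)) ⟩
          1 + 2 * M + 2 * (K * (K * suc s))          ≤⟨ +-mono-≤ (≤-trans inner-large upper)
                                                         (*-monoʳ-≤ 2 (*-monoʳ-≤ K (*-monoˡ-≤ (suc s) K≤))) ⟩
          H + 2 * (K * (suc (2 * s) * suc s))        ∎
        arith₃ : ∀ s j → 1 + 2 * ((2 + j) * (20 * (s * s) + 36 * s + 16)) ≡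
          suc (((6 * s + 4) * (6 * s + 3) + (s + 2) * ((1 + j) * (1 + s) + 3 * (1 + s)))
               + ((2 + j) * (1 + s) * (6 * s + 3) + (s + 2) * ((1 + j) * (1 + s) + 3 * (1 + s)))
               + 2 * ((2 + j) * ((1 + 2 * s) * (1 + s)))
               + (16 * (s * s) + 48 * s + 26 + j * (28 * (s * s) + 51 * s + 23)))
        arith₃ = solve-∀

    -- For `y` in `Z u`, `exchange` yields a neighbour `b` of `v` not adjacent to `y`. Unless `b`
    -- permits an exchange, it is a tame row other than `u`. So failure means that every such `y`
    -- misses another tame row, as `rich-absurd` requires.
    improve-rich : ∀ {u v w} → C u ≡ true → S v ≡ true → C v ≡ false → adj G u v ≡ false →
                   adj G v w ≡ true → S w ≡ true → C w ≡ false → (∀ c → C c ≡ true → adj G c w ≡ true) →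
                   Gain F G u v
    improve-rich {u} {v} {w} Cu Sv Cv uv vw Sw Cw complete = first (spare-F degrees G r (C-full Cu Sv u≢v) uv)
      where
      u≢v : u ≢ v
      u≢v refl = true≢false Cu Cv
      closed : Fin n → Fin n → Bool
      closed y b = (tame w b ∧ not (b == u)) ∧ not (adj G y b)
      first : (∃ λ z → adj G u z ≡ true × F u z ≡ false) → Gain F G u v
      first (z , uz , fz) with escape u w
      ... | inj₁ (x , ux , Sx , w≢x , wx) =
            swap₂ F G u≢v uv ux vw (w≢x ∘ ≡-sym) (trans (sym G x w) wx) (free-S u Sx) (free-C Cv Cw)
      ... | inj₂ Zu⊆ with search (λ y → Z u y ∧ empty (closed y))
      ... | inj₁ (y , e) = second (exchange G {u} {v} {y}
              (≤-trans (≤-reflexive (r y)) (≤-trans (mono v y (≤-trans (<⇒≤ (below-< Sv)) (below-≥ Sy))) (≤-reflexive (≡-sym (r v)))))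
              (trans (sym G y u) uy) (trans (sym G v u) uv) u≢v)
        where
        uy = proj₁ (Z-elim {u} {y} (proj₁ (∧-elim e)))
        Sy = proj₂ (Z-elim {u} {y} (proj₁ (∧-elim e)))
        second : (∃ λ b → adj G v b ≡ true × adj G y b ≡ false × y ≢ b) → Gain F G u v
        second (b , vb , yb , y≢b) with true⊎false (C b)
        ... | inj₂ Cb = swap₂ F G u≢v uv uy vb y≢b yb (free-S u Sy) (free-C Cv Cb)
        ... | inj₁ Cb with escape b w
        ... | inj₁ (x , bx , Sx , w≢x , wx) =
              swap₃ F G u≢v uv uy vw bx y≢b yb w≢x wx (free-S u Sy) (free-C Cv Cw) (free-S b Sx)
        ... | inj₂ h = ⊥-elim (true≢false
              (∧-intro (∧-intro (tame-intro Cb h) (not-intro (≢⇒== λ { refl → true≢false (trans (sym G y u) uy) yb }))) (not-intro yb))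
              (empty-true (closed y) (proj₂ (∧-elim {Z u y} e)) b))
      ... | inj₂ none with cover G u≢v uv uz vw (free-S u Sz) (free-C Cv Cw)
        where
        Sz = outside-C degrees G r Cu uz fz
      ... | inj₁ g = g
      ... | inj₂ cov = ⊥-elim (rich-absurd Cu Sw Cw (Z-intro uz (outside-C degrees G r Cu uz fz)) complete Zu⊆ gap cov)
        where
        gap : ∀ y → Z u y ≡ true → ∃ λ b → tame w b ≡ true × b ≢ u × adj G y b ≡ false
        gap y zy with true⊎false (empty (closed y))
        ... | inj₁ e = ⊥-elim (true≢false (∧-intro zy e) (none y))
        ... | inj₂ e =
          let (b , h) = empty-false (closed y) e ; (h₁ , yb) = ∧-elim {tame w b ∧ not (b == u)} h
              (tb , ne) = ∧-elim {tame w b} h₁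
          in b , tb , ==⇒≢ (not-elim ne) , not-elim yb

    improve : ∀ u v → F u v ≡ true → adj G u v ≡ false → Progress F G
    improve u v f uv = by-end (true⊎false (C u))
      where
      go : ∀ {u v} → C u ≡ true → S v ≡ true → u ≢ v → adj G u v ≡ false → Progress F G
      go {u} {v} Cu Sv u≢v uv = first (spare-F degrees G r (F-sym u v fuv) (trans (sym G v u) uv))
        where
        fuv : F u v ≡ true
        fuv = C-full Cu Sv u≢v
        first : (∃ λ w → adj G v w ≡ true × F v w ≡ false) → Progress F G
        first (w , vw , fw) with true⊎false (S w)
        ... | inj₂ Sw = u , v , fuv , uv , improve-poor Cu Sv u≢v uv vw Sw
        ... | inj₁ Sw with search (λ c → C c ∧ not (adj G c w))
        ... | inj₂ none = u , v , fuv , uv , improve-rich Cu Sv Cv uv vw Sw (spare-∉C degrees G r Sv vw fw)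
                (λ c Cc → not-false λ e → true≢false (∧-intro Cc (not-intro e)) (none c))
          where
          Cv : C v ≡ false
          Cv = not-true λ Cv → true≢false (C-full Cv Sw (edge-≢ G vw)) fw
        ... | inj₁ (c , e) with spare-F degrees G r fuv uv
        ... | z , uz , fz with true⊎false (adj G w z)
        ... | inj₂ wz = u , v , fuv , uv , swap₂ F G u≢v uv uz vw (λ { refl → true≢false Sw Sz })
                (trans (sym G z w) wz) (free-S u Sz) (free-F fw)
          where
          Sz = outside-C degrees G r Cu uz fz
        -- Here `c w` is gained instead of `u v`: `w` has the neighbour `z` outside `S`, which makes
        -- `improve-poor` applicable.
        ... | inj₁ wz = c , w , C-full Cc Sw c≢w , cw , improve-poor Cc Sw c≢w cw wz (outside-C degrees G r Cu uz fz)
          where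
          Cc = proj₁ (∧-elim {C c} e)
          cw = not-elim (proj₂ (∧-elim {C c} e))
          c≢w : c ≢ w
          c≢w refl = true≢false Cc (spare-∉C degrees G r Sv vw fw)
      by-end : C u ≡ true ⊎ C u ≡ false → Progress F G
      by-end (inj₁ Cu) = let (ne , _ , Sv , _) = F-elim f in go Cu Sv ne uv
      by-end (inj₂ Cu) = let (ne , Su , _ , c) = F-elim f in go (other Cu c) Su (ne ∘ ≡-sym) (trans (sym G v u) uv)
        where
        other : C u ≡ false → core u v ≡ true → C v ≡ true
        other h c with ∨-elim {C u} c
        ... | inj₁ e = ⊥-elim (true≢false e h)
        ... | inj₂ c′ with ∨-elim {C v} c′
        ... | inj₁ e = e
        ... | inj₂ e = proj₂ (∧-elim {C u} e)

    -- Now d c ≤ 3t bounds all degrees outside `C`. The neighbourhoods cover only about 18s² pairs,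
    -- and the 40s² forced by this one row suffice.
    single-absurd : ∀ {c z w} → C c ≡ true → # (Z c) ≤ 1 → S z ≡ false → S w ≡ false → Covered z w → ⊥
    single-absurd {c} {z} {w} Cc few Sz Sw cov = overshoot (22 * (s * s) + 30 * s + 6) chain (arith₂ s)
      where
      M I H : ℕ
      M = ## (outer G C)
      I = ## (inner G C)
      H = (1 + (3 * suc s)) * (3 * suc s)
      L-degree : ∀ {a} → C a ≡ false → dg G a ≤ (3 * suc s)
      L-degree {a} ca = ≤-trans (≤-reflexive (r a)) (≤-trans (mono-C Cc ca) (s≤s⁻¹ (row-degree Cc few)))
      missing : 1 * o ≤ M + 1 * 1
      missing = subst (λ x → x * o ≤ M + x * 1) (#-single c) (outer-large (_== c) 1
        (λ j e → trans (cong C (==⇒≡ e)) Cc) (λ j e → ≤-trans (≤-reflexive (cong (# ∘ Z) (==⇒≡ e))) few))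
      half≤ : ∀ {w} → S w ≡ false → ## (half G w) ≤ H
      half≤ {w} Sw = ≤-trans (half-bound G w (nbr G w) (λ _ → false) ((3 * suc s)) 0 row)
          (≤-trans (≤-reflexive (trans (cong (# (nbr G w) * (3 * suc s) +_) (*-zeroʳ (# {n} λ _ → false))) (+-identityʳ _)))
                   (*-monoˡ-≤ ((3 * suc s)) (≤-trans (≤-reflexive (#-nbr G w)) (s≤s (L-degree (S-C Sw))))))
        where
        row : ∀ a → C a ≡ false → nbr G w a ≡ true → dg G a ≤ χ (nbr G w a) * (3 * suc s) + χ false * 0
        row a ca na rewrite na = ≤-trans (L-degree ca) (≤-reflexive (≡-sym (trans (+-identityʳ _) (+-identityʳ _))))
      open ≤-Reasoning
      arith₁ : ∀ M → 1 + 2 * (M + 1 * 1) ≡ 1 + 2 * M + 2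
      arith₁ = solve-∀
      chain : 1 + 2 * (1 * (20 * (s * s) + 36 * s + 16)) ≤ H + H + 2
      chain = begin
        1 + 2 * (1 * (20 * (s * s) + 36 * s + 16)) ≤⟨ +-monoʳ-≤ 1 (*-monoʳ-≤ 2 (*-monoʳ-≤ 1 o-large)) ⟩
        1 + 2 * (1 * o)                            ≤⟨ +-monoʳ-≤ 1 (*-monoʳ-≤ 2 missing) ⟩
        1 + 2 * (M + 1 * 1)                        ≡⟨ arith₁ M ⟩
        1 + 2 * M + 2                              ≤⟨ +-monoˡ-≤ 2 (≤-trans inner-large
                                                      (≤-trans (inner-bound cov) (+-mono-≤ (half≤ Sz) (half≤ Sw)))) ⟩
        H + H + 2                                  ∎
      arith₂ : ∀ s → 1 + 2 * (1 * (20 * (s * s) + 36 * s + 16)) ≡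
        suc ((1 + (3 * suc s)) * (3 * suc s) + (1 + (3 * suc s)) * (3 * suc s) + 2 + (22 * (s * s) + 30 * s + 6))
      arith₂ = solve-∀

    -- Otherwise all but the first 2t vertices have degree at most 2t - 1, and `tail-bound` gives
    -- exactly the threshold, which only the strictness of the hypothesis rules out: the slack is 0.
    two-large : ∀ a → toℕ a < 2 * s + 3 → suc (suc (2 * s)) ≤ d a
    two-large a h = ≮⇒≥ λ lt → overshoot 0 (chain (s≤s⁻¹ lt)) (arith s (# (not ∘ K)) (∑ d))
      where
      K : Fin n → Bool
      K = below (2 * s + 2)
      #K : # K ≡ 2 * s + 2
      #K = #-below (≤-trans (≤-trans (m≤m+n (2 * s + 2) (s + 1)) (≤-reflexive (arith₀ s))) 3t≤n)
        where
        arith₀ : ∀ s → 2 * s + 2 + (s + 1) ≡ 3 * suc s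
        arith₀ = solve-∀
      n≡ : n ≡ 2 * s + 2 + # (not ∘ K)
      n≡ = trans (≡-sym (#-complement K)) (cong (_+ # (not ∘ K)) #K)
      chain : d a ≤ suc (2 * s) →
        suc (4 * suc s * (2 * s + 2 + # (not ∘ K)) + 2 * suc s) + (∑ d + (2 * s + 2)) ≤
        (∑ d + 2 * (2 * s + 2 + # (not ∘ K)) + 4 * (suc s * suc s)) + ((2 * s + 2) * (2 * s + 2) + 2 * (# (not ∘ K) * suc (2 * s)))
      chain small = +-mono-≤ (subst (λ m → 4 * suc s * m + 2 * suc s < ∑ d + 2 * m + 4 * (suc s * suc s)) n≡ sum)
        (subst (λ k → ∑ d + k ≤ k * k + 2 * (# (not ∘ K) * suc (2 * s))) #K
          (subst (λ x → x + # K ≤ # K * # K + 2 * (# (not ∘ K) * suc (2 * s))) (sum-cong-≗ r) (tail-bound G K (suc (2 * s)) tail)))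
        where
        tail : ∀ j → K j ≡ false → dg G j ≤ suc (2 * s)
        tail j e = ≤-trans (≤-reflexive (r j)) (≤-trans (mono a j (≤-trans (s≤s⁻¹ (≤-trans h (≤-reflexive (+-suc (2 * s) 2)))) (below-≥ e))) small)
      arith : ∀ s l D →
        suc (4 * suc s * (2 * s + 2 + l) + 2 * suc s) + (D + (2 * s + 2)) ≡
        suc ((D + 2 * (2 * s + 2 + l) + 4 * (suc s * suc s)) + ((2 * s + 2) * (2 * s + 2) + 2 * (l * suc (2 * s))) + 0)
      arith = solve-∀

    -- Finding an edge between two vertices joined to all rows.

    module _ (full : Full G) where

      complete? : ∀ a → (∃ λ c → C c ≡ true × adj G c a ≡ false) ⊎ Complete G a
      complete? a with search (λ c → C c ∧ not (adj G c a))
      ... | inj₁ (c , e) = inj₁ (c , proj₁ (∧-elim e) , not-elim (proj₂ (∧-elim {C c} e)))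
      ... | inj₂ none = inj₂ λ c Cc → not-false λ e → true≢false (∧-intro Cc (not-intro e)) (none c)

      -- A row missed by z or w is short, and there cannot be two short rows: z and w miss the same row c only.
      module Stuck {x y} (Lx : L x ≡ true) (Ly : L y ≡ true) (x≢y : x ≢ y)
                   (no-edge : ∀ a b → C a ≡ false → C b ≡ false → Complete G a → Complete G b → adj G a b ≡ true → Realized t d)
                   {z w} (xz : adj G x z ≡ true) (yw : adj G y w ≡ true) (Sz : S z ≡ false) (Sw : S w ≡ false)
                   {c} (Cc : C c ≡ true) (cz : adj G c z ≡ false) where

        Sx = proj₁ (L-elim Lx)
        Sy = proj₁ (L-elim Ly)
        Cx = proj₂ (L-elim Lx)
        Cy = proj₂ (L-elim Ly)

        apart : ∀ {a b} → S a ≡ true → S b ≡ false → a ≢ b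
        apart sa sb refl = true≢false sa sb

        rowcol : ∀ {a b} → C a ≡ true → C b ≡ false → a ≢ b
        rowcol sa sb refl = true≢false sa sb

        Gx : Complete G x
        Gx = full-complete {G} full Lx
        win : ∀ {a b} → L a ≡ true → L b ≡ true → Gain F G a b → Realized t d
        win {a} {b} La Lb g = graph g , (λ i → trans (same-dg g i) (r i)) ,
            edge-target {graph g} full′ (proj₂ (L-elim La)) (proj₂ (L-elim Lb))
              (full-complete {graph g} full′ La) (full-complete {graph g} full′ Lb) (gained g)
          where
          full′ : Full (graph g)
          full′ j k f = kept g j k f (full j k f)

        by-xy : Gain F G x y → Realized t d
        by-xy = win Lx Ly

        module _ (xy : adj G x y ≡ false) where

          covered : Realized t d ⊎ Covered z w
          covered with cover G x≢y xy xz yw (free-S x Sz) (free-S y Sw)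
          ... | inj₁ g = inj₁ (by-xy g)
          ... | inj₂ cov = inj₂ cov

          -- A neighbour `v` of `b` outside `S` and N[w] would allow `x z`, `y w`, `b v` to give way
          -- to `x y`, `z b`, `w v`.
          escape-w : ∀ {b} → C b ≡ true → adj G b z ≡ false → Realized t d ⊎ (∀ v → Z b v ≡ true → nbr G w v ≡ true)
          escape-w {b} Cb bz with escape b w
          ... | inj₂ h = inj₂ h
          ... | inj₁ (v , bv , Sv , w≢v , wv) = inj₁ (by-xy
                (swap₃ F G x≢y xy xz yw bv (apart (C⊆S Cb) Sz ∘ ≡-sym) (trans (sym G z b) bz) w≢v wv
                  (free-S x Sz) (free-S y Sw) (free-S b Sv)))

          escape-z : ∀ {b} → C b ≡ true → adj G b w ≡ false → Realized t d ⊎ (∀ v → Z b v ≡ true → nbr G z v ≡ true)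
          escape-z {b} Cb bw with escape b z
          ... | inj₂ h = inj₂ h
          ... | inj₁ (v , bv , Sv , z≢v , zv) = inj₁ (win Ly Lx
                (swap₃ F G (x≢y ∘ ≡-sym) (trans (sym G y x) xy) yw xz bv (apart (C⊆S Cb) Sw ∘ ≡-sym) (trans (sym G w b) bw) z≢v zv
                  (free-S y Sw) (free-S x Sz) (free-S b Sv)))

          second-row : # (Z c) ≤ 6 * s + 4 → ∀ {b} → C b ≡ true → b ≢ c → # (Z b) ≤ 6 * s + 4 → Realized t d
          second-row hc Cb b≢c hb with covered
          ... | inj₁ done = done
          ... | inj₂ cov = ⊥-elim (poor-absurd Cc Cb (b≢c ∘ ≡-sym) hc hb Sz Sw cov)

          module _ (Zc⊆w : ∀ v → Z c v ≡ true → nbr G w v ≡ true) where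

            hc : # (Z c) ≤ 6 * s + 4
            hc = short Sw Zc⊆w

            misses-c : ∀ {b} → C b ≡ true → adj G b w ≡ false → Realized t d ⊎ b ≡ c
            misses-c {b} Cb bw with ==-dec b c | escape-z Cb bw
            ... | inj₁ e | _ = inj₂ e
            ... | inj₂ ne | inj₁ done = inj₁ done
            ... | inj₂ ne | inj₂ h = inj₁ (second-row hc Cb ne (short Sz h))

            row-c-only : ∀ {b} → C b ≡ true → adj G b z ≡ false → Realized t d ⊎ b ≡ c
            row-c-only {b} Cb bz with ==-dec b c | escape-w Cb bz
            ... | inj₁ e | _ = inj₂ e
            ... | inj₂ ne | inj₁ done = inj₁ done
            ... | inj₂ ne | inj₂ h = inj₁ (second-row hc Cb ne (short Sw h))

            module _ (cw : adj G c w ≡ false) where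

              -- A row `b` missing `v` is not `c`. If it is short, it is the second short row;
              -- otherwise it has a neighbour `u` outside N[w], and `x z`, `y w`, `c v`, `b u` give
              -- way to `x y`, `z c`, `w u`, `v b`.
              Zc-complete : ∀ {v} → Z c v ≡ true → Realized t d ⊎ Complete G v
              Zc-complete {v} e with complete? v
              ... | inj₂ h = inj₂ h
              ... | inj₁ (b , Cb , bv) with escape b w
              ... | inj₂ h = inj₁ (second-row hc Cb (λ { refl → true≢false (proj₁ (Z-elim {c} {v} e)) bv }) (short Sw h))
              ... | inj₁ (u , bu , Su , w≢u , wu) = inj₁ (by-xy
                    (swap₄ F G x≢y xy xz yw (proj₁ (Z-elim {c} {v} e)) (trans (sym G u b) bu)
                      (apart (C⊆S Cc) Sz ∘ ≡-sym) (trans (sym G z c) cz) w≢u wu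
                      (apart (C⊆S Cb) Sv ∘ ≡-sym) (trans (sym G v b) bv)
                      (apart Sx Su) (rowcol Cb Cx ∘ ≡-sym) (apart Sx Sv) (rowcol Cc Cy ∘ ≡-sym) (apart Sy Sv)
                      (off (λ _ c≡u → apart (C⊆S Cc) Su c≡u) (λ _ c≡w → apart (C⊆S Cc) Sw c≡w))
                      (free-S x Sz) (free-S y Sw) (free-S c Sv) (proj₂ (free-S b Su) , proj₁ (free-S b Su))))
                where
                Sv = proj₂ (Z-elim {c} {v} e)

              -- Moving z from x to c makes z complete, next to y.
              shift : z ≡ w → ∀ {v} → Z c v ≡ true → Complete G v → adj G x v ≡ false →
                      (∀ b → C b ≡ true → b ≢ c → adj G b z ≡ true) → Realized t d
              shift refl {v} e Gv xv others = graph g , (λ i → trans (same-dg g i) (r i)) ,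
                  edge-target {graph g} full′ Cy (S-C Sz) (full-complete {graph g} full′ Ly) Gz
                    (kept g y z (F′-intro (λ y≡z _ → apart Sy Sz y≡z) (λ y≡x _ → x≢y (≡-sym y≡x))
                                          (λ y≡c _ → rowcol Cc Cy (≡-sym y≡c)) (λ y≡v _ → apart Sy Sv y≡v)) yw)
                where
                cv = proj₁ (Z-elim {c} {v} e)
                Sv = proj₂ (Z-elim {c} {v} e)
                -- Everything but the two removed pairs is protected, since the edge `y z`, which is
                -- outside `F`, has to survive as well.
                F′ : Fin n → Fin n → Bool
                F′ a b = not (same (z , x) a b) ∧ not (same (c , v) a b)
                F′-intro : ∀ {a b} → (a ≡ z → b ≡ x → ⊥) → (a ≡ x → b ≡ z → ⊥) →
                           (a ≡ c → b ≡ v → ⊥) → (a ≡ v → b ≡ c → ⊥) → F′ a b ≡ true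
                F′-intro h₁ h₂ h₃ h₄ = ∧-intro (not-intro (off h₁ h₂)) (not-intro (off h₃ h₄))
                freeˡ : Free F′ (z , x)
                freeˡ = ∧-falseˡ _ (cong not (same-self z x)) , ∧-falseˡ _ (cong not (trans (same-sym (z , x) x z) (same-self z x)))
                freeʳ : Free F′ (c , v)
                freeʳ = ∧-falseʳ _ (cong not (same-self c v)) , ∧-falseʳ _ (cong not (trans (same-sym (c , v) v c) (same-self c v)))
                g : Gain F′ G z c
                g = swap₂ F′ G (apart (C⊆S Cc) Sz ∘ ≡-sym) (trans (sym G z c) cz) (trans (sym G z x) xz) cv (apart Sx Sv) xv freeˡ freeʳ
                full′ : Full (graph g)
                full′ a b f = let (_ , Sa , Sb , _) = F-elim f in
                  kept g a b (F′-intro (λ a≡z _ → apart Sa Sz a≡z) (λ _ b≡z → apart Sb Sz b≡z)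
                                       (λ _ b≡v → apart Sb Sv b≡v) (λ a≡v _ → apart Sa Sv a≡v)) (full a b f)
                Gz : Complete (graph g) z
                Gz b Cb with ==-dec b c
                ... | inj₁ refl = trans (sym (graph g) c z) (gained g)
                ... | inj₂ ne = kept g b z (F′-intro (λ b≡z _ → apart (C⊆S Cb) Sz b≡z) (λ b≡x _ → rowcol Cb Cx b≡x)
                                                     (λ b≡c _ → ne b≡c) (λ _ z≡c → apart (C⊆S Cc) Sz (≡-sym z≡c))) (others b Cb ne)

              -- `c` trades `v` and `u` for `z` and `w`. If z = w, the same edge would be added
              -- twice; `shift` treats that case.
              twins : z ≢ w → ∀ {v u} → Z c v ≡ true → Z c u ≡ true → v ≢ u → adj G v u ≡ false → Realized t d
              twins z≢w {v} {u} ev eu v≢u vu = by-xy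
                (swap₄ F G x≢y xy xz yw (proj₁ (Z-elim {c} {v} ev)) (proj₁ (Z-elim {c} {u} eu))
                  (apart (C⊆S Cc) Sz ∘ ≡-sym) (trans (sym G z c) cz) (apart (C⊆S Cc) Sw ∘ ≡-sym) (trans (sym G w c) cw)
                  v≢u vu (rowcol Cc Cx ∘ ≡-sym) (apart Sx Su) (apart Sx Sv) (rowcol Cc Cy ∘ ≡-sym) (apart Sy Sv)
                  (off (λ z≡w _ → z≢w z≡w) (λ z≡c _ → apart (C⊆S Cc) Sz (≡-sym z≡c)))
                  (free-S x Sz) (free-S y Sw) (free-S c Sv) (free-S c Su))
                where
                Sv = proj₂ (Z-elim {c} {v} ev)
                Su = proj₂ (Z-elim {c} {u} eu)

              conclude : ∀ {v u} → Z c v ≡ true → Z c u ≡ true → v ≢ u → Realized t d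
              conclude {v} {u} ev eu v≢u with Zc-complete ev | Zc-complete eu
              ... | inj₁ done | _ = done
              ... | inj₂ _ | inj₁ done = done
              ... | inj₂ Gv | inj₂ Gu with true⊎false (adj G v u) | true⊎false (adj G x v)
              ... | inj₁ vu | _ = no-edge v u (S-C (proj₂ (Z-elim {c} {v} ev))) (S-C (proj₂ (Z-elim {c} {u} eu))) Gv Gu vu
              ... | inj₂ vu | inj₁ xv = no-edge x v Cx (S-C (proj₂ (Z-elim {c} {v} ev))) Gx Gv xv
              ... | inj₂ vu | inj₂ xv with ==-dec z w
              ... | inj₂ z≢w = twins z≢w ev eu v≢u vu
              ... | inj₁ z≡w with search (λ b → (C b ∧ not (b == c)) ∧ not (adj G b z))
              ... | inj₂ none = shift z≡w ev Gv xv λ b Cb ne → not-false λ e →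
                      true≢false (∧-intro (∧-intro Cb (not-intro (≢⇒== ne))) (not-intro e)) (none b)
              ... | inj₁ (b , e) with row-c-only (proj₁ (∧-elim (proj₁ (∧-elim {C b ∧ not (b == c)} e))))
                                                 (not-elim (proj₂ (∧-elim {C b ∧ not (b == c)} e)))
              ... | inj₁ done = done
              ... | inj₂ b≡c = ⊥-elim (==⇒≢ (not-elim (proj₂ (∧-elim {C b} (proj₁ (∧-elim {C b ∧ not (b == c)} e))))) b≡c)

              result : Realized t d
              result with # (Z c) ≤? 1
              ... | yes few with covered
              ... | inj₁ done = done
              ... | inj₂ cov = ⊥-elim (single-absurd Cc few Sz Sw cov)
              result | no many with #-witness (Z c) (≤-trans (s≤s z≤n) (≰⇒> many))
              ... | v , ev with #-witness (λ j → Z c j ∧ not (j == v)) (s≤s⁻¹ (≤-trans (≰⇒> many) (≤-reflexive (≡-sym (#-remove (Z c) v ev)))))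
              ... | u , eu = conclude ev (proj₁ (∧-elim eu)) λ v≡u → ==⇒≢ (not-elim (proj₂ (∧-elim {Z c u} eu))) (≡-sym v≡u)

            all-rows : (∃ λ b → C b ≡ true × adj G b w ≡ false) → Realized t d
            all-rows (b , Cb , bw) with misses-c Cb bw
            ... | inj₁ done = done
            ... | inj₂ refl = result bw

          start : (∃ λ b → C b ≡ true × adj G b w ≡ false) → Realized t d
          start miss with escape-w Cc cz
          ... | inj₁ done = done
          ... | inj₂ h = all-rows h miss

      -- The first two vertices of `L`. Their degree exceeds |C| = 2t - 1, so each has a neighbour
      -- outside `C`.
      vertex : ∀ k → k < 2 → ∃ λ x → L x ≡ true × toℕ x ≡ suc (2 * s) + k × suc (suc (2 * s)) ≤ d x
      vertex k k<2 = fromℕ< k<n , ∧-intro (below-true (≤-trans (s≤s (≤-reflexive e)) k<3t))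
          (not-intro (below-false (≤-trans (m≤m+n _ k) (≤-reflexive (≡-sym e))))) , e ,
          two-large _ (≤-trans (s≤s (≤-reflexive e))
            (≤-trans (s≤s (+-monoʳ-≤ (suc (2 * s)) (s≤s⁻¹ k<2))) (≤-reflexive (arith₂ s))))
        where
        arith₁ : ∀ s → suc (2 * s) + (s + 2) ≡ 3 * suc s
        arith₁ = solve-∀
        arith₂ : ∀ s → suc (suc (2 * s) + 1) ≡ 2 * s + 3
        arith₂ = solve-∀
        k<3t : suc (2 * s) + k < 3 * suc s
        k<3t = ≤-trans (+-monoʳ-< (suc (2 * s)) (≤-trans k<2 (m≤n+m 2 s))) (≤-reflexive (arith₁ s))
        k<n = ≤-trans k<3t 3t≤n
        e = toℕ-fromℕ< k<n

      second-phase : Realized t d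
      second-phase = by-edge (search₂ λ a b → ((not (C a) ∧ not (C b)) ∧ (complete a ∧ complete b)) ∧ adj G a b)
        where
        complete : Fin n → Bool
        complete a = empty (λ c → C c ∧ not (adj G c a))
        complete-elim : ∀ {a} → complete a ≡ true → Complete G a
        complete-elim {a} e c Cc = not-false λ f → true≢false (∧-intro Cc (not-intro f)) (empty-true (λ c → C c ∧ not (adj G c a)) e c)
        complete-intro : ∀ {a} → Complete G a → complete a ≡ true
        complete-intro {a} h = not-false λ f → let (c , e) = empty-false (λ c → C c ∧ not (adj G c a)) f in
          true≢false (h c (proj₁ (∧-elim e))) (not-elim (proj₂ (∧-elim {C c} e)))
        joined : ∀ a b → C a ≡ false → C b ≡ false → Complete G a → Complete G b → adj G a b ≡ true → Realized t d
        joined a b Ca Cb Ga Gb ab = G , r , edge-target {G} full Ca Cb Ga Gb ab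
        Neighbour : Fin n → Set
        Neighbour v = ∃ λ z → adj G v z ≡ true × S z ≡ false × (∃ λ c → C c ≡ true × adj G c z ≡ false)
        neighbour : ∀ v → L v ≡ true → suc (suc (2 * s)) ≤ d v → Realized t d ⊎ Neighbour v
        neighbour v Lv big′ with spare-< (adj G v) C (≤-trans (s≤s (≤-reflexive #C)) (≤-trans big′ (≤-reflexive (≡-sym (r v)))))
        ... | z , vz , Cz with complete? z
        ... | inj₂ Gz = inj₁ (joined v z (proj₂ (L-elim Lv)) Cz (full-complete {G} full Lv) Gz vz)
        ... | inj₁ miss = inj₂ (z , vz , Sz , miss)
          where
          Sz : S z ≡ false
          Sz = not-true λ e → let (c , Cc , cz) = miss in
            true≢false (full-complete {G} full (∧-intro e (not-intro Cz)) c Cc) cz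
        by-edge : _ → Realized t d
        by-edge (inj₁ (a , b , e)) =
          let (e₁ , ab) = ∧-elim {(not (C a) ∧ not (C b)) ∧ (complete a ∧ complete b)} e
              (e₂ , e₃) = ∧-elim {not (C a) ∧ not (C b)} e₁
              (Ca , Cb) = ∧-elim {not (C a)} e₂ ; (Ga , Gb) = ∧-elim {complete a} e₃
          in joined a b (not-elim Ca) (not-elim Cb) (complete-elim Ga) (complete-elim Gb) ab
        by-edge (inj₂ none) = both (vertex 0 (s≤s z≤n)) (vertex 1 ≤-refl)
          where
          Vertex : ℕ → Set
          Vertex k = ∃ λ x → L x ≡ true × toℕ x ≡ suc (2 * s) + k × suc (suc (2 * s)) ≤ d x
          arith : ∀ s → suc (2 * s) + 1 ≡ suc (suc (2 * s) + 0 + 0)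
          arith = solve-∀
          both : Vertex 0 → Vertex 1 → Realized t d
          both (x , Lx , x≡ , dx) (y , Ly , y≡ , dy) = combine (neighbour x Lx dx) (neighbour y Ly dy)
            where
            x≢y : x ≢ y
            x≢y e = m≢1+m+n (suc (2 * s) + 0) {0} (trans (≡-sym x≡) (trans (cong toℕ e) (trans y≡ (arith s))))
            xy : adj G x y ≡ false
            xy = not-true λ xy → true≢false
              (∧-intro (∧-intro (∧-intro (not-intro (proj₂ (L-elim Lx))) (not-intro (proj₂ (L-elim Ly))))
                (∧-intro (complete-intro (full-complete {G} full Lx)) (complete-intro (full-complete {G} full Ly)))) xy) (none x y)
            combine : Realized t d ⊎ Neighbour x → Realized t d ⊎ Neighbour y → Realized t d
            combine (inj₁ done) _ = done
            combine (inj₂ _) (inj₁ done) = done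
            combine (inj₂ (z , xz , Sz , c , Cc , cz)) (inj₂ (w , yw , Sw , miss)) =
              Stuck.start Lx Ly x≢y joined xz yw Sz Sw Cc cz xy miss

  realized : ∀ G → dg G ≗ d → Realized t d
  realized G r = conclude (saturate F d {⊥} (λ G r u v f uv → inj₂ (improve G r u v f uv)) G r)
    where
    conclude : ⊥ ⊎ (∃ λ G′ → dg G′ ≗ d × Full G′) → Realized t d
    conclude (inj₂ (G′ , r′ , full)) = second-phase G′ r′ full

-- Fewer than 2t − 1 vertices of degree at least 3t − 1

-- If there are i of them, where i = 2s + p and
-- t = s + p + 1, the remaining degrees average about 2(2t − 1 − i), which leaves room for a clique on the
-- next 2(2t − 1 − i) + 1 vertices.
module Bounded {n} (d : Fin n → ℕ) (s p : ℕ) (3t≤n : 3 * suc (s + p) ≤ n)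
  (rows : ∀ a → toℕ a < 2 * s + p → 3 * suc (s + p) ≤ suc (d a))
  (low : ∀ a → 2 * s + p ≤ toℕ a → d a ≤ suc (3 * s + 3 * p))
  (next : ∀ a → toℕ a < 2 * s + p + (2 * p + 3) → 2 * s + p + (2 * p + 3) ≤ suc (d a))
  (top : ∀ a → toℕ a < 3 * suc (s + p) → 2 * s + p ≤ d a)
  (big : 20 * (suc (s + p) * suc (s + p)) ≤ n + suc (s + p))
  (sum : 4 * suc (s + p) * n + 2 * suc (s + p) < ∑ d + 2 * n + 4 * (suc (s + p) * suc (s + p))) where

  -- Here 2t - 1 - i = p + 1, so q = 2(p + 1) + 1, and e = 3t - 2 bounds the degrees outside `C`.
  t i q k e : ℕ
  t = suc (s + p)
  i = 2 * s + p
  q = 2 * p + 3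
  k = i + q
  e = suc (3 * s + 3 * p)

  k+s : k + s ≡ 3 * t
  k+s = arith s p
    where
    arith : ∀ s p → 2 * s + p + (2 * p + 3) + s ≡ 3 * suc (s + p)
    arith = solve-∀

  k≤3t : k ≤ 3 * t
  k≤3t = ≤-trans (m≤m+n k s) (≤-reflexive k+s)

  open Plant d t i k (m≤m+n i q) k≤3t 3t≤n

  degrees : ∀ u → S u ≡ true → # (F u) ≤ d u
  degrees = F-degree (λ u h → rows u (below-< h)) (λ u h → next u (below-< h)) (λ u h → top u (below-< h))

  Q I : Fin n → Bool
  Q a = D a ∧ not (C a)
  I a = S a ∧ not (D a)

  #C+#Q : # C + # Q ≡ k
  #C+#Q = trans (cong (_+ # Q) (≡-sym D∧C)) (trans (≡-sym (#-split D C)) (#-below (≤-trans k≤3t 3t≤n)))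
    where
    D∧C : # (λ a → D a ∧ C a) ≡ # C
    D∧C = ≤-antisym (#-mono {p = λ a → D a ∧ C a} {C} λ a h → proj₂ (∧-elim {D a} h))
                    (#-mono {p = C} {λ a → D a ∧ C a} λ a h → ∧-intro (C⊆D h) h)

  #Q : # Q ≡ q
  #Q = +-cancelˡ-≡ i (# Q) q (trans (cong (_+ # Q) (≡-sym #C)) #C+#Q)

  s≤#I : s ≤ # I
  s≤#I = +-cancelˡ-≤ k s (# I) (≤-trans (≤-reflexive (trans k+s (≡-sym #S)))
    (≤-trans (#-∪ {p = S} {D} {I} part) (+-monoˡ-≤ (# I) (≤-reflexive (#-below (≤-trans k≤3t 3t≤n))))))
    where
    part : ∀ a → S a ≡ true → D a ∨ I a ≡ true
    part a h with true⊎false (D a)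
    ... | inj₁ e = ∨-introˡ e
    ... | inj₂ e = ∨-introʳ {D a} (∧-intro h (not-intro e))

  full-target : ∀ {G} → (∀ a b → F a b ≡ true → adj G a b ≡ true) → Target t G
  full-target {G} full = record
    { C = C ; Q = Q ; I = I ; s = s
    ; C-Q = λ a h → ∧-falseʳ (D a) (cong not h)
    ; I-CQ = λ a h → let Da = not-elim (proj₂ (∧-elim {S a} h)) in
        cong₂ _∨_ (not-true λ c → true≢false (C⊆D c) Da) (∧-falseˡ (not (C a)) Da)
    ; s≤#I = s≤#I
    ; 2s≤#C = ≤-trans (m≤m+n (2 * s) p) (≤-reflexive (≡-sym #C))
    ; s≤t = ≤-trans (m≤m+n s p) (n≤1+n _)
    ; total = ≤-reflexive (trans (≡-sym k+s) (cong (_+ s) (≡-sym #C+#Q)))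
    ; clique = λ a b ha hb ne → full a b (F-intro ne (D⊆S (inD ha)) (D⊆S (inD hb))
        (∨-introʳ {C a} (∨-introʳ {C b} (∧-intro (inD ha) (inD hb)))))
    ; complete = λ a b Ca h → full a b (C-full Ca (proj₁ (∧-elim h)) λ { refl →
        true≢false (C⊆D Ca) (not-elim (proj₂ (∧-elim {S a} h))) }) }
    where
    inD : ∀ {a} → C a ∨ Q a ≡ true → D a ≡ true
    inD {a} h with ∨-elim {C a} h
    ... | inj₁ c = C⊆D c
    ... | inj₂ c = proj₁ (∧-elim c)

  module _ (G : Graph n) (r : dg G ≗ d) where

    low-degree : ∀ {a} → C a ≡ false → dg G a ≤ e
    low-degree {a} h = ≤-trans (≤-reflexive (r a)) (low a (below-≥ h))

    half≤ : ∀ {w} → C w ≡ false → ## (half G w) ≤ suc e * e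
    half≤ {w} Cw = ≤-trans (half-bound G w (nbr G w) (λ _ → false) e 0 row)
        (≤-trans (≤-reflexive (trans (cong (# (nbr G w) * e +_) (*-zeroʳ (# {n} λ _ → false))) (+-identityʳ _)))
                 (*-monoˡ-≤ e (≤-trans (≤-reflexive (#-nbr G w)) (s≤s (low-degree Cw)))))
      where
      row : ∀ a → C a ≡ false → nbr G w a ≡ true → dg G a ≤ χ (nbr G w a) * e + χ false * 0
      row a ca na rewrite na = ≤-trans (low-degree ca) (≤-reflexive (≡-sym (trans (+-identityʳ _) (+-identityʳ _))))

    -- The threshold has leading term (4t - 2)n = 2in + (2p + 2)n, and edges meeting `C` account for
    -- 2in only. About (2p + 2)n pairs avoid `C`, but at most q² of them lie in `F`, and the
    -- neighbourhoods cover at most 2e(e + 1).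
    covered-absurd : ∀ {z w} → C z ≡ false → C w ≡ false →
      (∀ a b → adj G a b ≡ true → F a b ≡ false → nbr G z a ∨ nbr G w b ≡ true) → ⊥
    covered-absurd {z} {w} Cz Cw cov = overshoot
        (40 * (p * (s * s)) + 40 * (p * (p * p)) + 80 * (s * (p * p)) + 22 * (s * s) + 93 * (p * p)
          + 118 * (s * p) + 56 * s + 81 * p + 23)
        chain (arith s p)
      where
      J l : ℕ
      J = ## (inner G C)
      l = # (not ∘ C)
      X : Fin n → Fin n → Bool
      X a b = Q a ∧ Q b
      split : ∀ a b → inner G C a b ≡ true → X a b ∨ (nbr G z a ∨ nbr G w b) ≡ true
      split a b h with true⊎false (F a b)
      ... | inj₂ f = ∨-introʳ {X a b} (cov a b (proj₁ (∧-elim (proj₁ (∧-elim {adj G a b ∧ not (C a)} h)))) f)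
      ... | inj₁ f = ∨-introˡ (both (proj₂ (proj₂ (proj₂ (F-elim f)))))
        where
        Ca = not-elim (proj₂ (∧-elim {adj G a b} (proj₁ (∧-elim {adj G a b ∧ not (C a)} h))))
        Cb = not-elim (proj₂ (∧-elim {adj G a b ∧ not (C a)} h))
        both : core a b ≡ true → X a b ≡ true
        both c with ∨-elim {C a} c
        ... | inj₁ x = ⊥-elim (true≢false x Ca)
        ... | inj₂ c′ with ∨-elim {C b} c′
        ... | inj₁ x = ⊥-elim (true≢false x Cb)
        ... | inj₂ x = ∧-intro (∧-intro (proj₁ (∧-elim {D a} {D b} x)) (not-intro Ca)) (∧-intro (proj₂ (∧-elim {D a} {D b} x)) (not-intro Cb))
      upper : J ≤ q * q + (suc e * e + suc e * e)
      upper = ≤-trans (halves G z w X split) (+-mono-≤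
        (≤-reflexive (trans (#-product Q Q) (cong₂ _*_ #Q #Q))) (+-mono-≤ (half≤ Cz) (half≤ Cw)))
      bound : ∑ d + i ≤ J + 2 * (i * l) + i * i
      bound = subst (λ c → ∑ d + c ≤ J + 2 * (c * l) + c * c) #C
        (≤-trans (+-monoˡ-≤ (# C) (≤-trans (≤-reflexive (≡-sym (sum-cong-≗ r))) (m≤m+n (∑ (dg G)) (2 * ## (outer G C)))))
                 (inner-lower-bound G C))
      n≡ : n ≡ i + l
      n≡ = trans (≡-sym (#-complement C)) (cong (_+ l) #C)
      sum′ : suc (4 * t * (i + l) + 2 * t) ≤ ∑ d + 2 * (i + l) + 4 * (t * t)
      sum′ = subst (λ m → 4 * t * m + 2 * t < ∑ d + 2 * m + 4 * (t * t)) n≡ sum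
      big′ : (2 * p + 2) * (20 * (t * t)) ≤ (2 * p + 2) * (i + l + t)
      big′ = *-monoʳ-≤ (2 * p + 2) (subst (λ m → 20 * (t * t) ≤ m + t) n≡ big)
      Y B : ℕ
      Y = ∑ d + 2 * (i + l) + 2 * (i * l) + (2 * p + 2) * (i + l)
      B = (2 * p + 2) * (20 * (t * t))
      2t : 4 * t * (i + l) ≡ 2 * ((i + p + 2) * (i + l))
      2t = trans (cong (_* (i + l)) (arith s p)) (*-assoc 2 (i + p + 2) (i + l))
        where
        arith : ∀ s p → 4 * suc (s + p) ≡ 2 * (2 * s + p + p + 2)
        arith = solve-∀
      left : ∀ i p l D B x → suc (2 * ((i + p + 2) * (i + l)) + x) + (D + i) + B ≡
             1 + (2 * (i * i) + x + i + B) + (D + 2 * (i + l) + 2 * (i * l) + (2 * p + 2) * (i + l))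
      left = solve-∀
      right : ∀ i p l D a b c t → D + 2 * (i + l) + a + (b + 2 * (i * l) + c) + (2 * p + 2) * (i + l + t) ≡
              a + (b + c) + (2 * p + 2) * t + (D + 2 * (i + l) + 2 * (i * l) + (2 * p + 2) * (i + l))
      right = solve-∀
      chain : 1 + (2 * (i * i) + 2 * t + i + B) ≤
              4 * (t * t) + (q * q + (suc e * e + suc e * e) + i * i) + (2 * p + 2) * t
      chain = +-cancelʳ-≤ Y _ _ (begin
        1 + (2 * (i * i) + 2 * t + i + B) + Y
          ≡⟨ ≡-sym (left i p l (∑ d) B (2 * t)) ⟩
        suc (2 * ((i + p + 2) * (i + l)) + 2 * t) + (∑ d + i) + B
          ≡⟨ cong (λ x → suc (x + 2 * t) + (∑ d + i) + B) (≡-sym 2t) ⟩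
        suc (4 * t * (i + l) + 2 * t) + (∑ d + i) + B
          ≤⟨ +-mono-≤ (+-mono-≤ sum′ (≤-trans bound (+-monoˡ-≤ (i * i) (+-monoˡ-≤ (2 * (i * l)) upper)))) big′ ⟩
        ∑ d + 2 * (i + l) + 4 * (t * t) + (q * q + (suc e * e + suc e * e) + 2 * (i * l) + i * i) + (2 * p + 2) * (i + l + t)
          ≡⟨ right i p l (∑ d) (4 * (t * t)) (q * q + (suc e * e + suc e * e)) (i * i) t ⟩
        4 * (t * t) + (q * q + (suc e * e + suc e * e) + i * i) + (2 * p + 2) * t + Y ∎)
        where open ≤-Reasoning
      arith : ∀ s p →
        1 + (2 * ((2 * s + p) * (2 * s + p)) + 2 * suc (s + p) + (2 * s + p) + (2 * p + 2) * (20 * (suc (s + p) * suc (s + p)))) ≡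
        suc (4 * (suc (s + p) * suc (s + p))
          + ((2 * p + 3) * (2 * p + 3) + (suc (suc (3 * s + 3 * p)) * suc (3 * s + 3 * p) + suc (suc (3 * s + 3 * p)) * suc (3 * s + 3 * p))
             + (2 * s + p) * (2 * s + p))
          + (2 * p + 2) * suc (s + p)
          + (40 * (p * (s * s)) + 40 * (p * (p * p)) + 80 * (s * (p * p)) + 22 * (s * s) + 93 * (p * p)
          + 118 * (s * p) + 56 * s + 81 * p + 23))
      arith = solve-∀

    improve : ∀ u v → F u v ≡ true → adj G u v ≡ false → Progress F G
    improve u v f uv = go (spare-F degrees G r f uv) (spare-F degrees G r (F-sym u v f) (trans (sym G v u) uv))
      where
      go : (∃ λ z → adj G u z ≡ true × F u z ≡ false) → (∃ λ w → adj G v w ≡ true × F v w ≡ false) → Progress F G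
      go (z , uz , fz) (w , vw , fw) with cover G (proj₁ (F-elim f)) uv uz vw (free-F fz) (free-F fw)
      ... | inj₁ g = u , v , f , uv , g
      ... | inj₂ cov = ⊥-elim (covered-absurd
              (spare-∉C degrees G r (proj₁ (proj₂ (F-elim f))) uz fz)
              (spare-∉C degrees G r (proj₁ (proj₂ (proj₂ (F-elim f)))) vw fw) cov)

  realized : ∀ G → dg G ≗ d → Realized t d
  realized G r = conclude (saturate F d {⊥} (λ G r u v f uv → inj₂ (improve G r u v f uv)) G r)
    where
    conclude : ⊥ ⊎ (∃ λ G′ → dg G′ ≗ d × (∀ a b → F a b ≡ true → adj G′ a b ≡ true)) → Realized t d
    conclude (inj₂ (G′ , r′ , full)) = G′ , r′ , full-target {G′} full

threshold : ∀ {n} (p : Fin n → Bool) → (∀ a b → toℕ a ≤ toℕ b → p b ≡ true → p a ≡ true) →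
            ∃ λ i → (∀ a → toℕ a < i → p a ≡ true) × (∀ a → i ≤ toℕ a → p a ≡ false)
threshold {zero}  p anti = 0 , (λ ()) , (λ ())
threshold {suc n} p anti with true⊎false (p zero)
... | inj₂ h = 0 , (λ _ ()) , λ a _ → not-true λ e → true≢false (anti zero a z≤n e) h
... | inj₁ h with threshold (p ∘ suc) (λ a b le → anti (suc a) (suc b) (s≤s le))
... | i , yes′ , no′ = suc i , (λ { zero _ → h ; (suc a) lt → yes′ a (s≤s⁻¹ lt) }) , λ { (suc a) le → no′ a (s≤s⁻¹ le) }

-- The case distinction

module Main {n} (d : Fin n → ℕ) (r : ℕ)
  (mono : ∀ a b → toℕ a ≤ toℕ b → d b ≤ d a)
  (big : 20 * (suc r * suc r) ≤ n + suc r)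
  (sum : 4 * suc r * n + 2 * suc r < ∑ d + 2 * n + 4 * (suc r * suc r))
  (G : Graph n) (real : dg G ≗ d) where

  t : ℕ
  t = suc r

  3t≤n : 3 * t ≤ n
  3t≤n = +-cancelʳ-≤ t _ _ (≤-trans (≤-trans (m≤m+n (3 * t + t) (16 + (36 * r + 20 * (r * r)))) (≤-reflexive (arith r))) big)
    where
    arith : ∀ r → 3 * suc r + suc r + (16 + (36 * r + 20 * (r * r))) ≡ 20 * (suc r * suc r)
    arith = solve-∀

  -- Lowering the coefficient of n below 4t - 2 by one loses n ≥ 20t² - t, more than 9t² and the
  -- lower terms of the threshold can make up for.
  sum-large : ∀ A → A + 3 ≤ 4 * t → ∑ d ≤ A * n + 9 * (t * t) → ⊥
  sum-large A h le = overshoot (2 * t + 6 * (t * t) + (r + r * r)) chain (arith r n (∑ d) A)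
    where
    chain : suc (4 * t * n + 2 * t) + ∑ d + (A + 3) * n + 20 * (t * t) ≤
            (∑ d + 2 * n + 4 * (t * t)) + (A * n + 9 * (t * t)) + 4 * t * n + (n + t)
    chain = +-mono-≤ (+-mono-≤ (+-mono-≤ sum le) (*-monoˡ-≤ n h)) big
    arith : ∀ r n D A → suc (4 * suc r * n + 2 * suc r) + D + (A + 3) * n + 20 * (suc r * suc r) ≡
      suc ((D + 2 * n + 4 * (suc r * suc r)) + (A * n + 9 * (suc r * suc r)) + 4 * suc r * n + (n + suc r)
           + (2 * suc r + 6 * (suc r * suc r) + (r + r * r)))
    arith = solve-∀

  -- Only the first i vertices and the constant `K` contribute multiples of n; the vertices before
  -- 3t add just (3t)².
  sum-bound : ∀ i K → i ≤ n → (∀ b → d b ≤ χ (below i b) * n + (χ (below (3 * t) b) * (3 * t) + K)) →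
              ∑ d ≤ (i + K) * n + 9 * (t * t)
  sum-bound i K i≤n h = ≤-trans (∑-mono h) (≤-reflexive (begin
    ∑ {n} (λ b → χ (below i b) * n + (χ (below (3 * t) b) * (3 * t) + K))
      ≡⟨ ∑-distrib-+ {n} (λ b → χ (below i b) * n) (λ b → χ (below (3 * t) b) * (3 * t) + K) ⟩
    ∑ {n} (λ b → χ (below i b) * n) + ∑ {n} (λ b → χ (below (3 * t) b) * (3 * t) + K)
      ≡⟨ cong₂ _+_ (∑-*ʳ {n} (χ ∘ below i) n)
           (trans (∑-distrib-+ {n} (λ b → χ (below (3 * t) b) * (3 * t)) (λ _ → K))
                  (cong₂ _+_ (∑-*ʳ {n} (χ ∘ below (3 * t)) (3 * t)) (∑-const n K))) ⟩
    # {n} (below i) * n + (# {n} (below (3 * t)) * (3 * t) + n * K)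
      ≡⟨ cong₂ (λ x y → x * n + (y * (3 * t) + n * K)) (#-below i≤n) (#-below 3t≤n) ⟩
    i * n + (3 * t * (3 * t) + n * K)
      ≡⟨ arith i n t K ⟩
    (i + K) * n + 9 * (t * t) ∎))
    where
    open Relation.Binary.PropositionalEquality.≡-Reasoning
    arith : ∀ i n t K → i * n + (3 * t * (3 * t) + n * K) ≡ (i + K) * n + 9 * (t * t)
    arith = solve-∀

  d≤n : ∀ a → d a ≤ n
  d≤n a = ≤-trans (≤-reflexive (≡-sym (real a))) (#≤n (adj G a))

  top : ∀ a → toℕ a < 3 * t → suc (2 * r) ≤ d a
  top a a<3t = ≮⇒≥ λ lt → sum-large (4 * r) (≤-trans (n≤1+n _) (≤-reflexive (arith₁ r))) (bound (s≤s⁻¹ lt))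
    where
    S : Fin n → Bool
    S = below (3 * t)
    l : ℕ
    l = # (not ∘ S)
    arith₁ : ∀ r → suc (4 * r + 3) ≡ 4 * suc r
    arith₁ = solve-∀
    arith₂ : ∀ r n t → 3 * t * (3 * t) + 2 * (n * (2 * r)) ≡ 4 * r * n + 9 * (t * t)
    arith₂ = solve-∀
    bound : d a ≤ 2 * r → ∑ d ≤ 4 * r * n + 9 * (t * t)
    bound small = begin
      ∑ d                               ≡⟨ ≡-sym (sum-cong-≗ real) ⟩
      ∑ (dg G)                          ≤⟨ m≤m+n _ (# S) ⟩
      ∑ (dg G) + # S                    ≤⟨ tail-bound G S (2 * r) (λ b e → ≤-trans (≤-reflexive (real b))
                                            (≤-trans (mono a b (≤-trans (<⇒≤ a<3t) (below-≥ e))) small)) ⟩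
      # S * # S + 2 * (l * (2 * r))     ≤⟨ +-mono-≤ (≤-reflexive (cong₂ _*_ (#-below 3t≤n) (#-below 3t≤n)))
                                            (*-monoʳ-≤ 2 (*-monoˡ-≤ (2 * r) (#≤n (not ∘ S)))) ⟩
      3 * t * (3 * t) + 2 * (n * (2 * r)) ≡⟨ arith₂ r n t ⟩
      4 * r * n + 9 * (t * t)           ∎
      where open ≤-Reasoning

  module Few (a₀ : Fin n) (a₀-early : toℕ a₀ < suc (2 * r)) (a₀-small : suc (d a₀) < 3 * t) where

    rich : Fin n → Bool
    rich a = 3 * t ≤ᵇ suc (d a)

    rich-elim : ∀ {a} → rich a ≡ true → 3 * t ≤ suc (d a)
    rich-elim {a} h = ≤ᵇ⇒≤ (3 * t) (suc (d a)) (true⇒T h)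

    rich-false : ∀ {a} → rich a ≡ false → d a ≤ suc (3 * r)
    rich-false {a} h = s≤s⁻¹ (s≤s⁻¹ (≤-trans (≰⇒> λ le → true≢false (T⇒true (≤⇒≤ᵇ le)) h) (≤-reflexive (arith r))))
      where
      arith : ∀ r → 3 * suc r ≡ suc (suc (suc (3 * r)))
      arith = solve-∀

    module _ (i : ℕ) (early : ∀ a → toℕ a < i → rich a ≡ true) (late : ∀ a → i ≤ toℕ a → rich a ≡ false) where

      i≤2r : i ≤ 2 * r
      i≤2r = ≤-trans (≮⇒≥ λ lt → <⇒≱ a₀-small (rich-elim (early a₀ lt))) (s≤s⁻¹ a₀-early)

      i≤n : i ≤ n
      i≤n = ≤-trans i≤2r (≤-trans (m≤m+n (2 * r) (r + 3)) (≤-trans (≤-reflexive (arith r)) 3t≤n))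
        where
        arith : ∀ r → 2 * r + (r + 3) ≡ 3 * suc r
        arith = solve-∀

      early≤ : ∀ {b} X → below i b ≡ true → d b ≤ χ (below i b) * n + X
      early≤ {b} X e rewrite e = ≤-trans (d≤n b) (≤-trans (≤-reflexive (≡-sym (+-identityʳ n))) (m≤m+n _ X))

      -- With i ≤ t - 2 the coefficient of n is at most (t - 2) + (3t - 2) = 4t - 4.
      r≤i : r ≤ i
      r≤i = ≮⇒≥ λ lt → sum-large (i + suc (3 * r))
          (≤-trans (+-monoˡ-≤ 3 (+-monoˡ-≤ (suc (3 * r)) (<⇒≤pred lt))) (arith r (≤-trans (s≤s z≤n) lt)))
          (sum-bound i (suc (3 * r)) i≤n bound)
        where
        arith : ∀ r → 0 < r → pred r + suc (3 * r) + 3 ≤ 4 * suc r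
        arith (suc r) _ = ≤-trans (n≤1+n _) (≤-reflexive (eq r))
          where
          eq : ∀ r → suc (r + suc (3 * suc r) + 3) ≡ 4 * suc (suc r)
          eq = solve-∀
        bound : ∀ b → d b ≤ χ (below i b) * n + (χ (below (3 * t) b) * (3 * t) + suc (3 * r))
        bound b with true⊎false (below i b)
        ... | inj₁ e = early≤ _ e
        ... | inj₂ e = ≤-trans (rich-false (late b (below-≥ e))) (≤-trans (m≤n+m _ (χ (below (3 * t) b) * (3 * t))) (m≤n+m _ (χ (below i b) * n)))

      module _ (s p : ℕ) (r≡ : r ≡ s + p) (i≡ : i ≡ 2 * s + p) where

        -- On failure the degrees beyond `3 * t` are at most K = k - 2, and i + K = 4t - 3 is the
        -- largest coefficient that `sum-large` excludes. This determines how large the clique can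
        -- be.
        next : ∀ a → toℕ a < 2 * s + p + (2 * p + 3) → 2 * s + p + (2 * p + 3) ≤ suc (d a)
        next a a<k = ≮⇒≥ λ lt → sum-large (i + K)
            (≤-reflexive (trans (cong (λ x → x + K + 3) i≡) (trans (arith₁ s p) (cong (λ x → 4 * suc x) (≡-sym r≡)))))
            (sum-bound i K i≤n (bound (s≤s⁻¹ (s≤s⁻¹ (≤-trans lt (≤-reflexive (arith₂ s p)))))))
          where
          K : ℕ
          K = 2 * s + (3 * p + 1)
          arith₁ : ∀ s p → 2 * s + p + (2 * s + (3 * p + 1)) + 3 ≡ 4 * suc (s + p)
          arith₁ = solve-∀
          arith₂ : ∀ s p → 2 * s + p + (2 * p + 3) ≡ suc (suc (2 * s + (3 * p + 1)))
          arith₂ = solve-∀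
          arith₃ : ∀ s p → 2 * s + p + (2 * p + 3) + s ≡ 3 * suc (s + p)
          arith₃ = solve-∀
          arith₄ : ∀ r → suc (3 * r) + 2 ≡ 3 * suc r
          arith₄ = solve-∀
          a<3t : toℕ a < 3 * t
          a<3t = ≤-trans a<k (≤-trans (m≤m+n _ s) (≤-reflexive (trans (arith₃ s p) (cong (λ x → 3 * suc x) (≡-sym r≡)))))
          bound : d a ≤ K → ∀ b → d b ≤ χ (below i b) * n + (χ (below (3 * t) b) * (3 * t) + K)
          bound small b with true⊎false (below i b) | true⊎false (below (3 * t) b)
          ... | inj₁ e | _ = early≤ _ e
          ... | inj₂ e | inj₂ f = ≤-trans (mono a b (≤-trans (<⇒≤ a<3t) (below-≥ f)))
                  (≤-trans small (≤-trans (m≤n+m K (χ (below (3 * t) b) * (3 * t))) (m≤n+m _ (χ (below i b) * n))))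
          ... | inj₂ e | inj₁ f rewrite f = ≤-trans (rich-false (late b (below-≥ e)))
                  (≤-trans (≤-trans (m≤m+n _ 2) (≤-reflexive (trans (arith₄ r) (≡-sym (+-identityʳ (3 * t))))))
                    (≤-trans (m≤m+n _ K) (m≤n+m _ (χ (below i b) * n))))

        bounded : Realized t d
        bounded = subst (λ x → Realized (suc x) d) (≡-sym r≡) (Bounded.realized d s p
          (subst (λ x → 3 * suc x ≤ n) r≡ 3t≤n)
          (λ a lt → subst (λ x → 3 * suc x ≤ suc (d a)) r≡ (rich-elim (early a (≤-trans lt (≤-reflexive (≡-sym i≡))))))
          (λ a le → ≤-trans (rich-false (late a (≤-trans (≤-reflexive i≡) le)))
                      (≤-reflexive (trans (cong (λ x → suc (3 * x)) r≡) (cong suc (*-distribˡ-+ 3 s p)))))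
          next
          (λ a lt → ≤-trans (≤-reflexive (≡-sym i≡)) (≤-trans i≤2r (≤-trans (n≤1+n _)
             (top a (≤-trans lt (≤-reflexive (cong (λ x → 3 * suc x) (≡-sym r≡))))))))
          (subst (λ x → 20 * (suc x * suc x) ≤ n + suc x) r≡ big)
          (subst (λ x → 4 * suc x * n + 2 * suc x < ∑ d + 2 * n + 4 * (suc x * suc x)) r≡ sum)
          G real)

    realized : Realized t d
    realized = split (threshold rich λ a b le h → T⇒true (≤⇒≤ᵇ (≤-trans (rich-elim h) (s≤s (mono a b le)))))
      where
      split : (∃ λ i → (∀ a → toℕ a < i → rich a ≡ true) × (∀ a → i ≤ toℕ a → rich a ≡ false)) → Realized t d
      -- s is the excess of i over t - 1, and p is what i lacks to 2t - 2.
      split (i , early , late) = bounded i early late (i ∸ r) (r ∸ (i ∸ r)) r≡ i≡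
        where
        r+s : r + (i ∸ r) ≡ i
        r+s = m+[n∸m]≡n (r≤i i early late)
        s≤r : i ∸ r ≤ r
        s≤r = +-cancelˡ-≤ r _ _ (≤-trans (≤-reflexive r+s) (≤-trans (i≤2r i early late)
          (≤-reflexive (cong (r +_) (+-identityʳ r)))))
        r≡ : r ≡ i ∸ r + (r ∸ (i ∸ r))
        r≡ = ≡-sym (m+[n∸m]≡n s≤r)
        arith : ∀ s p → s + p + s ≡ 2 * s + p
        arith = solve-∀
        i≡ : i ≡ 2 * (i ∸ r) + (r ∸ (i ∸ r))
        i≡ = trans (≡-sym r+s) (trans (cong (_+ (i ∸ r)) r≡) (arith (i ∸ r) (r ∸ (i ∸ r))))

  realized : Realized t d
  realized = by-size (search λ a → below (3 * t) a ∧ not (6 * t ≤ᵇ d a + 2))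
    where
    by-size : _ → Realized t d
    by-size (inj₂ none) = Clique.realized d t 3t≤n (λ a lt → ≤ᵇ⇒≤ (6 * t) (d a + 2) (true⇒T (not-false λ e →
      true≢false (∧-intro (below-true lt) (not-intro e)) (none a)))) G real
    by-size (inj₁ (a , h)) = by-rows (search λ b → below (suc (2 * r)) b ∧ not (3 * t ≤ᵇ suc (d b)))
      where
      low : ∀ b → 3 * t ≤ toℕ b → d b ≤ 6 * r + 3
      low b le = ≤-trans (mono a b (≤-trans (<⇒≤ (below-< (proj₁ (∧-elim h)))) le))
        (+-cancelʳ-≤ 3 _ _ (≤-trans (≤-reflexive (+-suc (d a) 2)) (≤-trans
          (≰⇒> λ ge → true≢false (T⇒true (≤⇒≤ᵇ ge)) (not-elim (proj₂ (∧-elim {below (3 * t) a} h)))) (≤-reflexive (arith r)))))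
        where
        arith : ∀ r → 6 * suc r ≡ 6 * r + 3 + 3
        arith = solve-∀
      by-rows : _ → Realized t d
      by-rows (inj₂ none) = Rich.realized d r 3t≤n mono
        (λ b lt → ≤ᵇ⇒≤ (3 * t) (suc (d b)) (true⇒T (not-false λ e → true≢false (∧-intro (below-true lt) (not-intro e)) (none b))))
        top low big sum G real
      by-rows (inj₁ (b , e)) = Few.realized b (below-< (proj₁ (∧-elim e)))
        (≰⇒> λ ge → true≢false (T⇒true (≤⇒≤ᵇ ge)) (not-elim (proj₂ (∧-elim {below (suc (2 * r)) b} e))))

theorem4p1 : (t n : ℕ) → t ≥ 2 → n + t ≥ 20 * (t * t) →
    (π : Vector ℕ n) → Graphic π →
    σ π + 2 * n + 4 * (t * t) > 4 * t * n + 2 * t →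
    Σ (Graph n) λ G → Realizes G π ×
    ((H : Graph (3 * t)) → IsTwoTree H → H ⊆ᵍ G)
theorem4p1 (suc r) n _ big π (mono , G , real) sum =
  finish (Main.realized π r mono big
    (subst (λ x → 4 * suc r * n + 2 * suc r < x + 2 * n + 4 * (suc r * suc r)) (σ≡∑ π) sum)
    G (λ i → trans (≡-sym (degree≡dg G i)) (real i)))
  where
  finish : Realized (suc r) π → Σ (Graph n) λ G → Realizes G π × ((H : Graph (3 * suc r)) → IsTwoTree H → H ⊆ᵍ G)
  finish (G′ , real′ , target) = G′ , (λ i → trans (degree≡dg G′ i) (real′ i)) , target-contains target
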